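{- Let $G$ be a polygonal 2-tree and let $A \subseteq E(G)$ be a safe set for $G$ such that $\mathrm{bound}(A,G) \neq \emptyset$. Let $e$ be an edge in $\mathrm{bound}(A,G)$ for which $\mathrm{cost}(e)$ is minimum. Then $A \cup \{e\}$ is a safe set for $G$.
   Context: All graphs are finite, simple, undirected and unweighted. A polygonal 2-tree is defined recursively: every cycle is a polygonal 2-tree; if $G$ is a polygonal 2-tree and $(u,v) \in E(G)$, then adding a new path $P$ between $u$ and $v$ with $E(G) \cap E(P) = \emptyset$, $V(G) \cap V(P) = \{u,v\}$ and $|E(P)| \geq 2$ yields a polygonal 2-tree. For a set $X$ of edges, $G - X$ has vertex set $V(G)$ and edge set $E(G)\setminus X$. An induced cycle is a chordless cycle. In a graph $H$, an edge is internal if it lies in at least two induced cycles of $H$, and external otherwise; a bridge is an edge whose removal disconnects $H$. A 2-connected component is a maximal 2-connected subgraph. The intersection $H_1 \cap H_2$ of graphs has vertex set $V(H_1)\cap V(H_2)$ and edge set $E(H_1)\cap E(H_2)$. A set $A \subseteq E(G)$ of $k \geq 0$ edges is iterative for $G$ if its edges can be ordered $e_1,\ldots,e_k$ so that $e_1$ is external and not a bridge in $G$, and for each $2 \leq i \leq k$, $e_i$ is external and not a bridge in $G - \{e_1,\ldots,e_{i-1}\}$. For an iterative set $A$, $\mathrm{bound}(A,G)$ is the set of edges of $G - A$ that are external in $G-A$ and not bridges of $G-A$; for $e \in \mathrm{bound}(A,G)$, $G_e$ denotes the 2-connected component of $G-A$ containing $e$; $\mathrm{Sup}(e)$ is the set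 of edges $(u,v) \in A$ such that there is a path $P$ joining $u$ and $v$ in $G-A$ with $P \cap G_e$ equal to the single edge $e$ (as a graph); and $\mathrm{cost}(e) = |\mathrm{Sup}(e)|$. The average stretch of a spanning tree $T$ of $G$ is $\frac{1}{|E(G)|}\sum_{(u,v)\in E(G)} d_T(u,v)$, where $d_T$ is distance in $T$; a minimum average stretch spanning tree minimizes it. A set $A \subseteq E(G)$ is safe for $G$ if $A$ is iterative for $G$ and some minimum average stretch spanning tree of $G$ is contained in $G-A$. -}

module Defs where

open import Data.Bool using (Bool; true; false; _∧_; _∨_; not; if_then_else_)
open import Data.Nat as ℕ using (ℕ; zero; suc; _+_; _≡ᵇ_; _%_; _<_; _≤_)
open import Data.Fin as Fin using (Fin; toℕ; splitAt; _≟_)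
open import Data.Fin.Permutation using (Permutation′; _⟨$⟩ʳ_)
open import Data.List using (List; []; _∷_; _++_; [_]; length; allFin; map; cartesianProduct; filter)
open import Data.Bool.ListAction using (any)
open import Data.Nat.ListAction using (sum)
open import Data.List.Membership.Propositional using (_∈_)
open import Data.List.Relation.Unary.Linked using (Linked)
open import Data.List.Relation.Unary.Unique.Propositional using (Unique)
open import Data.Product using (Σ; ∃; ∃₂; _×_; _,_)
open import Data.Sum using (_⊎_; inj₁; inj₂)
open import Data.Integer using (+_)
open import Data.Rational as ℚ using (ℚ; 0ℚ)
open import Relation.Nullary using (¬_; ⌊_⌋)
open import Relation.Binary.PropositionalEquality using (_≡_; _≢_)
open import Relation.Binary.Construct.Closure.ReflexiveTransitive using (Star)
open import Function.Bundles using (_⇔_)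

-- Graphs on the vertex set Fin n, given by a Bool adjacency function.
-- (Polygonal 2-trees below are always symmetric and loopless, i.e. simple.)

Graph : ℕ → Set
Graph n = Fin n → Fin n → Bool

-- A set of edges (unordered pairs); the pair {u,v} belongs to X iff
-- X u v ∨ X v u.
ESet : ℕ → Set
ESet n = Fin n → Fin n → Bool

module _ {n : ℕ} where

  E : Graph n → Fin n → Fin n → Set
  E H u v = H u v ≡ true

  Mem : ESet n → Fin n → Fin n → Set
  Mem X u v = (X u v ∨ X v u) ≡ true

  _─_ : Graph n → ESet n → Graph n
  (H ─ X) u v = H u v ∧ not (X u v ∨ X v u)

  single : Fin n → Fin n → ESet n
  single x y u v = ⌊ u ≟ x ⌋ ∧ ⌊ v ≟ y ⌋

  _∪_ : ESet n → ESet n → ESet n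
  (X ∪ Y) u v = X u v ∨ Y u v

  Connected : Graph n → Fin n → Fin n → Set
  Connected H = Star (E H)

  Bridge : Graph n → Fin n → Fin n → Set
  Bridge H u v = E H u v × ¬ Connected (H ─ single u v) u v

  data Consec : List (Fin n) → Fin n → Fin n → Set where
    here  : ∀ {a b l} → Consec (a ∷ b ∷ l) a b
    there : ∀ {c a b l} → Consec l a b → Consec (c ∷ l) a b

  PathEdge : List (Fin n) → Fin n → Fin n → Set
  PathEdge xs a b = Consec xs a b ⊎ Consec xs b a

  IsPath : Graph n → Fin n → Fin n → List (Fin n) → Set
  IsPath H u v xs =
    (∃ λ mid → xs ≡ u ∷ mid ++ [ v ]) × Linked (E H) xs × Unique xs

  IsCycle : Graph n → List (Fin n) → Set
  IsCycle H [] = Data.Empty.⊥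
    where import Data.Empty
  IsCycle H (x ∷ rest) =
    (2 ≤ length rest) × Unique (x ∷ rest) × Linked (E H) (x ∷ rest ++ [ x ])

  CycEdge : List (Fin n) → Fin n → Fin n → Set
  CycEdge [] a b = Data.Empty.⊥
    where import Data.Empty
  CycEdge (x ∷ rest) a b = PathEdge (x ∷ rest ++ [ x ]) a b

  IsInducedCycle : Graph n → List (Fin n) → Set
  IsInducedCycle H C =
    IsCycle H C × (∀ a b → a ∈ C → b ∈ C → E H a b → CycEdge C a b)

  -- (u,v) lies in at least two (distinct) induced cycles of H.
  -- Two induced cycles are distinct subgraphs iff their vertex sets differ.
  Internal : Graph n → Fin n → Fin n → Set
  Internal H u v =
    ∃₂ λ C₁ C₂ → IsInducedCycle H C₁ × IsInducedCycle H C₂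
      × CycEdge C₁ u v × CycEdge C₂ u v
      × ∃ λ w → (w ∈ C₁ × ¬ w ∈ C₂) ⊎ (¬ w ∈ C₁ × w ∈ C₂)

  External : Graph n → Fin n → Fin n → Set
  External H u v = E H u v × ¬ Internal H u v

  ValidSeq : Graph n → List (Fin n × Fin n) → Set
  ValidSeq H [] = Data.Unit.⊤
    where import Data.Unit
  ValidSeq H ((u , v) ∷ es) =
    External H u v × ¬ Bridge H u v × ValidSeq (H ─ single u v) es

  Iterative : Graph n → ESet n → Set
  Iterative G A =
    Σ (List (Fin n × Fin n)) λ es → ValidSeq G es
      × (∀ u v → Mem A u v ⇔ ((u , v) ∈ es ⊎ (v , u) ∈ es))

  Bound : ESet n → Graph n → Fin n → Fin n → Set
  Bound A G u v = External (G ─ A) u v × ¬ Bridge (G ─ A) u v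

  record Subgraph : Set where
    field
      vs : Fin n → Bool
      es : Fin n → Fin n → Bool

  open Subgraph public

  InV : Subgraph → Fin n → Set
  InV B w = vs B w ≡ true

  InE : Subgraph → Fin n → Fin n → Set
  InE B a b = (es B a b ∨ es B b a) ≡ true

  IsSubgraphOf : Subgraph → Graph n → Set
  IsSubgraphOf B H = ∀ a b → InE B a b → E H a b × InV B a × InV B b

  _⊑_ : Subgraph → Subgraph → Set
  B ⊑ B' = (∀ w → InV B w → InV B' w) × (∀ a b → InE B a b → InE B' a b)

  TwoConnected : Subgraph → Set
  TwoConnected B =
    (∃ λ a → ∃ λ b → ∃ λ c → InV B a × InV B b × InV B c
       × a ≢ b × b ≢ c × a ≢ c)
    × (∀ a b → InV B a → InV B b → Star (InE B) a b)
    × (∀ x a b → InV B x → InV B a → InV B b → a ≢ x → b ≢ x →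
         Star (λ p q → InE B p q × p ≢ x × q ≢ x) a b)

  TwoConnComp : Graph n → Subgraph → Set
  TwoConnComp H B =
    IsSubgraphOf B H × TwoConnected B
    × (∀ B' → IsSubgraphOf B' H → TwoConnected B' → B ⊑ B' → B' ⊑ B)

  Sup : ESet n → Graph n → Fin n → Fin n → Fin n → Fin n → Set
  Sup A G x y a b =
    Mem A a b ×
    Σ Subgraph λ Ge → TwoConnComp (G ─ A) Ge × InE Ge x y ×
    Σ (List (Fin n)) λ P → IsPath (G ─ A) a b P
      -- P ∩ G_e is exactly the single edge (x,y), as a graph
      × (∀ w → (w ∈ P × InV Ge w) ⇔ (w ≡ x ⊎ w ≡ y))
      × (∀ p q → (PathEdge P p q × InE Ge p q)
                   ⇔ ((p ≡ x × q ≡ y) ⊎ (p ≡ y × q ≡ x)))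

  HasSize : (Fin n → Fin n → Set) → ℕ → Set
  HasSize S k =
    Σ (List (Fin n × Fin n)) λ L → length L ≡ k × Unique L
      × (∀ a b → (a , b) ∈ L → toℕ a < toℕ b)
      × (∀ a b → S a b ⇔ ((a , b) ∈ L ⊎ (b , a) ∈ L))

  Cost : ESet n → Graph n → Fin n → Fin n → ℕ → Set
  Cost A G x y c = HasSize (Sup A G x y) c

  symm : ESet n → Graph n
  symm T u v = T u v ∨ T v u

  SpanningTree : Graph n → ESet n → Set
  SpanningTree G T =
    (∀ a b → Mem T a b → E G a b)
    × (∀ a b → Connected (symm T) a b)
    × (∀ C → ¬ IsCycle (symm T) C)

  reach : Graph n → ℕ → Fin n → Fin n → Bool
  reach H zero u v = ⌊ u ≟ v ⌋
  reach H (suc k) u v = reach H k u v ∨ any (λ w → H u w ∧ reach H k w v) (allFin n)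

  distFrom : Graph n → ℕ → ℕ → Fin n → Fin n → ℕ
  distFrom H k zero u v = k
  distFrom H k (suc fuel) u v =
    if reach H k u v then k else distFrom H (suc k) fuel u v

  -- d_H(u,v): least k with a walk of length k (correct for connected H)
  dist : Graph n → Fin n → Fin n → ℕ
  dist H u v = distFrom H 0 n u v

  pairs : List (Fin n × Fin n)
  pairs = filter (λ p → toℕ (Data.Product.proj₁ p) ℕ.<? toℕ (Data.Product.proj₂ p))
                 (cartesianProduct (allFin n) (allFin n))
    where import Data.Product

  numEdges : Graph n → ℕ
  numEdges G = sum (map (λ p → if G (Data.Product.proj₁ p) (Data.Product.proj₂ p) then 1 else 0) pairs)
    where import Data.Product

  totalStretch : Graph n → ESet n → ℕ
  totalStretch G T =
    sum (map (λ p → if G (Data.Product.proj₁ p) (Data.Product.proj₂ p)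
                    then dist (symm T) (Data.Product.proj₁ p) (Data.Product.proj₂ p)
                    else 0) pairs)
    where import Data.Product

  ratio : ℕ → ℕ → ℚ
  ratio a zero = 0ℚ
  ratio a (suc d) = (+ a) ℚ./ suc d

  averageStretch : Graph n → ESet n → ℚ
  averageStretch G T = ratio (totalStretch G T) (numEdges G)

  MinAvgStretchTree : Graph n → ESet n → Set
  MinAvgStretchTree G T =
    SpanningTree G T
    × (∀ T' → SpanningTree G T' → averageStretch G T ℚ.≤ averageStretch G T')

  Safe : Graph n → ESet n → Set
  Safe G A =
    Iterative G A
    × ∃ λ T → MinAvgStretchTree G T × (∀ a b → Mem T a b → E (G ─ A) a b)

cycleGraph : (k : ℕ) → Graph (3 + k)
cycleGraph k i j =
  (suc (toℕ i) % (3 + k) ≡ᵇ toℕ j) ∨ (suc (toℕ j) % (3 + k) ≡ᵇ toℕ i)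

-- add a new path u - w₀ - w₁ - … - w_k - v (k+2 ≥ 2 edges) with new
-- vertices w₀,…,w_k (the last k+1 vertices of Fin (n + suc k))
addPath : ∀ {n} → Graph n → Fin n → Fin n → (k : ℕ) → Graph (n + suc k)
addPath {n} G u v k x y with splitAt n x | splitAt n y
... | inj₁ a | inj₁ b = G a b
... | inj₁ a | inj₂ i = oldNew a i
  where oldNew : Fin n → Fin (suc k) → Bool
        oldNew a i = (⌊ a ≟ u ⌋ ∧ (toℕ i ≡ᵇ 0)) ∨ (⌊ a ≟ v ⌋ ∧ (toℕ i ≡ᵇ k))
... | inj₂ i | inj₁ a = (⌊ a ≟ u ⌋ ∧ (toℕ i ≡ᵇ 0)) ∨ (⌊ a ≟ v ⌋ ∧ (toℕ i ≡ᵇ k))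
... | inj₂ i | inj₂ j = (suc (toℕ i) ≡ᵇ toℕ j) ∨ (suc (toℕ j) ≡ᵇ toℕ i)

data Polygonal2Tree : ∀ {n} → Graph n → Set where
  cycle : ∀ k → Polygonal2Tree (cycleGraph k)
  addP  : ∀ {n} {G : Graph n} → Polygonal2Tree G →
          (u v : Fin n) → G u v ≡ true → (k : ℕ) →
          Polygonal2Tree (addPath G u v k)
  relabel : ∀ {n} {G H : Graph n} → Polygonal2Tree G →
            (σ : Permutation′ n) →
            (∀ a b → H (σ ⟨$⟩ʳ a) (σ ⟨$⟩ʳ b) ≡ G a b) →
            Polygonal2Tree H

{-# OPTIONS --safe #-}
module Submission where

-- Let H = G ─ A, let T be a minimum average stretch tree inside H, and suppose T contains e = xy (otherwise T itself
-- will do). Deleting e splits T into a side of x and a side of y. Among the edges of H other than e that cross this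
-- cut, let ab be nearest to e in T and uv farthest from e, and exchange e for ab.
--
-- Two properties of polygonal 2-trees carry the argument: vertices joined by three internally disjoint paths are
-- adjacent, and two disjoint x–y paths are not linked off {x, y} when xy is an edge. With them, every crossing edge of
-- G other than e either has its tree paths running through a and b, and then the exchange shortens its detour by
-- d(a,x) + d(b,y), or it belongs to Sup(e), and then its detour grows by at most that amount. The edge uv is external
-- in H, and uv and Sup(uv) consist of edges of the first kind; as cost(e) ≤ cost(uv), the total stretch does not grow.
--
-- The nearest and farthest edges, the block of e and the sizes of the supports are only needed under a double
-- negation: whether some exchange does not increase the total stretch is decidable.

open import Defs
open import Data.Bool using (Bool; true; false; _∧_; _∨_; not; if_then_else_; T)
import Data.Bool as Bool
open import Data.Bool.ListAction using (any)
open import Data.Empty using (⊥; ⊥-elim)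
open import Data.Fin as Fin using (Fin; toℕ; splitAt; _≟_; _↑ˡ_; _↑ʳ_)
open import Data.Fin.Permutation using (Permutation′; _⟨$⟩ʳ_; _⟨$⟩ˡ_; inverseˡ; inverseʳ)
open import Data.Fin.Properties using (splitAt-↑ˡ; splitAt-↑ʳ; splitAt⁻¹-↑ˡ; splitAt⁻¹-↑ʳ; ↑ˡ-injective; toℕ-injective; toℕ<n; any?)
import Data.Integer as ℤ
import Data.Integer.Properties as ℤₚ
open import Data.List using (List; []; _∷_; _++_; [_]; length; map; filter; cartesianProduct; allFin; reverse)
open import Data.List.Properties using (length-++; ++-assoc; ∷-injectiveʳ; unfold-reverse; length-reverse; reverse-++; reverse-involutive; length-tabulate; length-filter)
open import Data.List.Membership.Propositional using (_∈_; find; lose)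
open import Data.List.Membership.Propositional.Properties using (∈-++⁺ˡ; ∈-++⁺ʳ; ∈-++⁻; ∈-∃++; ∈-allFin; ∈-filter⁺; ∈-filter⁻; ∈-cartesianProduct⁺)
open import Data.List.Membership.DecPropositional using (_∈?_)
open import Data.List.Relation.Unary.All as All using ([]; _∷_)
open import Data.List.Relation.Unary.AllPairs using ([]; _∷_)
open import Data.List.Relation.Unary.Any as Any using (here; there)
open import Data.List.Relation.Unary.Any.Properties using (reverse⁺; reverse⁻)
open import Data.List.Relation.Unary.Linked as Linked using (Linked; [-]; _∷_)
open import Data.List.Relation.Unary.Unique.Propositional using (Unique)
import Data.List.Relation.Unary.Unique.Propositional.Properties as Uniqueₚ
open import Data.Nat as ℕ using (ℕ; zero; suc; _+_; _*_; _∸_; _%_; _≡ᵇ_; _≤_; _<_; z≤n; s≤s)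
open import Data.Nat.DivMod using (m<n⇒m%n≡m; n%n≡0)
open import Data.Nat.ListAction using (sum)
import Data.Nat.Properties as ℕₚ
open import Data.Nat.Solver using (module +-*-Solver)
open import Data.Product using (Σ; ∃; ∃₂; _×_; _,_; proj₁; proj₂)
import Data.Product as Product
open import Data.Product.Properties using (≡-dec)
import Data.Rational as ℚ
import Data.Rational.Properties as ℚₚ
import Data.Rational.Unnormalised as ℚᵘ
import Data.Rational.Unnormalised.Properties as ℚᵘₚ
open import Data.Sum using (_⊎_; inj₁; inj₂; [_,_]′; swap)
open import Data.Unit using (tt)
open import Function using (_∘_; case_of_)
open import Function.Bundles using (mk⇔; Equivalence)
open import Relation.Binary using (tri<; tri≈; tri>)
open import Relation.Binary.Construct.Closure.ReflexiveTransitive using (Star; ε; _◅_; _◅◅_; gmap)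
open import Relation.Binary.PropositionalEquality using (_≡_; _≢_; refl; sym; trans; cong; cong₂; subst; subst₂; ≢-sym)
open import Relation.Nullary using (¬_; Dec; yes; no; ⌊_⌋)
open import Relation.Nullary.Decidable using (_×-dec_; _⊎-dec_; ¬?; decidable-stable; ¬¬-excluded-middle)
open import Relation.Unary using (Decidable)

-- The first property is where the polygons matter: K2,3 is series-parallel and violates it. The
-- second holds because a link between the two paths would complete, together with xy, a subdivision
-- of K4. The order of the deletions enters through one fact: when an edge of A was deleted, all of
-- H was still present, so two disjoint detours in H would have made that edge internal. Combined
-- with the first property, a path of G attached to a cycle of H forces an edge of H between its two
-- attachments. On the cycle that ab closes in T, such an edge would be a nearer crossing edge
-- unless it is ab or xy, whence the dichotomy. The farthest edge is there because minimality of the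
-- cost can be played only against an edge of bound(A,G): an ear of uv off its tree path would
-- contain a crossing edge still farther out. One and the same amount bounds every loss from above
-- and every gain from below, so comparing stretches reduces to counting: 1 + cost(e) against 1 +
-- cost(uv), the extra ones standing for e and uv themselves.

∧-split : ∀ {a b} → a ∧ b ≡ true → a ≡ true × b ≡ true
∧-split {true} {true} _ = refl , refl

∧-join : ∀ {a b} → a ≡ true → b ≡ true → a ∧ b ≡ true
∧-join refl refl = refl

∨-split : ∀ {a b} → a ∨ b ≡ true → a ≡ true ⊎ b ≡ true
∨-split {true} _ = inj₁ refl
∨-split {false} p = inj₂ p

∨-left : ∀ {a b} → a ≡ true → a ∨ b ≡ true
∨-left refl = refl

∨-right : ∀ {a b} → b ≡ true → a ∨ b ≡ true
∨-right {true} _ = refl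
∨-right {false} p = p

∨-swap : ∀ {a b} → a ∨ b ≡ true → b ∨ a ≡ true
∨-swap {a} p = [ ∨-right , ∨-left ]′ (∨-split {a} p)

≟-true : ∀ {n} {a b : Fin n} → ⌊ a ≟ b ⌋ ≡ true → a ≡ b
≟-true {a = a} {b} p with a ≟ b
... | yes q = q

≟-refl : ∀ {n} (a : Fin n) → ⌊ a ≟ a ⌋ ≡ true
≟-refl a with a ≟ a
... | yes _ = refl
... | no q = ⊥-elim (q refl)

≡ᵇ-true : ∀ {a b} → (a ≡ᵇ b) ≡ true → a ≡ b
≡ᵇ-true {a} {b} p = ℕₚ.≡ᵇ⇒≡ a b (subst T (sym p) _)

-- Two structural properties of polygonal 2-trees

SymG : ∀ {n} → Graph n → Set
SymG G = ∀ a b → E G a b → E G b a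

Loopless : ∀ {n} → Graph n → Set
Loopless G = ∀ a → ¬ E G a a

Within : ∀ {n} → Graph n → (Fin n → Set) → Fin n → Fin n → Set
Within G X a b = E G a b × X a × X b

within-sym : ∀ {n} {G : Graph n} {X} → SymG G → ∀ {a b} → Within G X a b → Within G X b a
within-sym s (e , p , q) = s _ _ e , q , p

reverse⋆ : ∀ {A : Set} {R : A → A → Set} → (∀ {a b} → R a b → R b a) → ∀ {a b} → Star R a b → Star R b a
reverse⋆ s ε = ε
reverse⋆ s (r ◅ rs) = reverse⋆ s rs ◅◅ (s r ◅ ε)

DisjointOff : ∀ {n} → Fin n → Fin n → (X Y : Fin n → Set) → Set
DisjointOff p q X Y = ∀ w → X w → Y w → w ≡ p ⊎ w ≡ q

-- Vertex sets stand in for the three paths. A set is easily pulled back when a graph is relabelled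
-- or a path is added, and a walk inside it is all that has to be carried along; simplicity never
-- has to be restored.
ThetaClosed : ∀ {n} → Graph n → Set₁
ThetaClosed {n} G = ∀ p q (X Y Z : Fin n → Set) → p ≢ q →
  DisjointOff p q X Y → DisjointOff p q Y Z → DisjointOff p q X Z →
  Star (Within G X) p q → Star (Within G Y) p q → Star (Within G Z) p q → E G p q

-- The interior of an x-y path of at least two edges, kept as a vertex set with a walk inside it
-- from a neighbour of x to a neighbour of y.
record Handle {n} (G : Graph n) (x y : Fin n) (X : Fin n → Set) : Set where
  constructor handle
  field
    first last : Fin n
    x-first : E G x first
    y-last : E G y last
    avoids-x : ¬ X x
    avoids-y : ¬ X y
    first∈ : X first
    last∈ : X last
    interior : Star (Within G X) first last
open Handle

-- The link is required to join the two `first` vertices only. A link between other vertices of the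
-- two interiors can be prolonged along them, since they avoid x and y.
NoCross : ∀ {n} → Graph n → Set₁
NoCross {n} G = ∀ x y (X Y : Fin n → Set) → E G x y →
  (h : Handle G x y X) (k : Handle G x y Y) → (∀ w → X w → ¬ Y w) →
  ¬ Star (Within G (λ w → w ≢ x × w ≢ y)) (first h) (first k)

-- Two predicates with at most one element each cover the neighbours, so nothing has to be counted,
-- and either may be empty.
Deg≤2 : ∀ {n} → Graph n → Fin n → Set₁
Deg≤2 {n} G w = Σ (Fin n → Set) λ P → Σ (Fin n → Set) λ Q →
  (∀ {a b} → P a → P b → a ≡ b) × (∀ {a b} → Q a → Q b → a ≡ b) × (∀ z → E G w z → P z ⊎ Q z)

deg≤2-pigeonhole : ∀ {n} {G : Graph n} {w a b c} → Deg≤2 G w →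
  E G w a → E G w b → E G w c → a ≢ b → b ≢ c → a ≢ c → ⊥
deg≤2-pigeonhole (P , Q , p! , q! , c) ea eb ec ab bc ac with c _ ea | c _ eb | c _ ec
... | inj₁ p | inj₁ q | _ = ab (p! p q)
... | inj₂ p | inj₂ q | _ = ab (q! p q)
... | _ | inj₁ p | inj₁ q = bc (p! p q)
... | _ | inj₂ p | inj₂ q = bc (q! p q)
... | inj₁ p | _ | inj₁ q = ac (p! p q)
... | inj₂ p | _ | inj₂ q = ac (q! p q)

first-step : ∀ {n} {G : Graph n} {X p q} → Loopless G → p ≢ q → Star (Within G X) p q →
  ∃ λ s → E G p s × X s × s ≢ p
first-step irr ne ε = ⊥-elim (ne refl)
first-step irr ne ((e , _ , xs) ◅ _) = _ , e , xs , λ { refl → irr _ e }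

-- The three walks leave p by edges of which two must coincide, and a vertex other than p shared by
-- two of the sets is q.
theta-at-deg≤2 : ∀ {n} {G : Graph n} {p} → Loopless G → Deg≤2 G p →
  ∀ q (X Y Z : Fin n → Set) → p ≢ q →
  DisjointOff p q X Y → DisjointOff p q Y Z → DisjointOff p q X Z →
  Star (Within G X) p q → Star (Within G Y) p q → Star (Within G Z) p q → E G p q
theta-at-deg≤2 {G = G} {p = p} irr d q X Y Z ne xy yz xz sx sy sz
  with first-step irr ne sx | first-step irr ne sy | first-step irr ne sz
... | a , ea , Xa , ap | b , eb , Yb , bp | c , ec , Zc , cp with a ≟ q | b ≟ q | c ≟ q
... | yes refl | _ | _ = ea
... | _ | yes refl | _ = eb
... | _ | _ | yes refl = ec
... | no aq | no bq | no cq = ⊥-elim (deg≤2-pigeonhole {G = G} {p} d ea eb ec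
       (λ { refl → [ ap , aq ]′ (xy _ Xa Yb) }) (λ { refl → [ bp , bq ]′ (yz _ Yb Zc) })
       (λ { refl → [ ap , aq ]′ (xz _ Xa Zc) }))

-- Besides y, the vertex x has a neighbour in each of two disjoint sets that avoid y.
three-neighbours : ∀ {n} {G : Graph n} {x y X Y} → Deg≤2 G x → E G x y →
  (h : Handle G x y X) (k : Handle G x y Y) → (∀ w → X w → ¬ Y w) → ⊥
three-neighbours {G = G} {x} {Y = Y} d e h k disj = deg≤2-pigeonhole {G = G} {x} d e (x-first h) (x-first k)
  (λ { refl → avoids-y h (first∈ h) }) (λ eq → disj _ (first∈ h) (subst Y (sym eq) (first∈ k)))
  (λ { refl → avoids-y k (first∈ k) })

flip-handle : ∀ {n} {G : Graph n} {x y X} → SymG G → Handle G x y X → Handle G y x X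
flip-handle s (handle f l xf yl ax ay f∈ l∈ i) =
  handle l f yl xf ay ax l∈ f∈ (reverse⋆ (within-sym s) i)

record TwoTreeLike {n} (G : Graph n) : Set₁ where
  field
    symmetric : SymG G
    loopless : Loopless G
    theta : ThetaClosed G
    noCross : NoCross G
open TwoTreeLike

-- Cycles

suc-mod : ∀ k (i : Fin (3 + k)) →
  (suc (toℕ i) < 3 + k × suc (toℕ i) % (3 + k) ≡ suc (toℕ i)) ⊎
  (suc (toℕ i) ≡ 3 + k × suc (toℕ i) % (3 + k) ≡ 0)
suc-mod k i with ℕₚ.m≤n⇒m<n∨m≡n (toℕ<n i)
... | inj₁ lt = inj₁ (lt , m<n⇒m%n≡m lt)
... | inj₂ eq = inj₂ (eq , trans (cong (_% (3 + k)) eq) (n%n≡0 (3 + k)))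

suc-mod-injective : ∀ k (i j : Fin (3 + k)) → suc (toℕ i) % (3 + k) ≡ suc (toℕ j) % (3 + k) → i ≡ j
suc-mod-injective k i j eq with suc-mod k i | suc-mod k j
... | inj₁ (_ , p) | inj₁ (_ , q) = toℕ-injective (ℕₚ.suc-injective (trans (sym p) (trans eq q)))
... | inj₁ (_ , p) | inj₂ (_ , q) = case trans (sym p) (trans eq q) of λ ()
... | inj₂ (_ , p) | inj₁ (_ , q) = case trans (sym p) (trans eq q) of λ ()
... | inj₂ (p , _) | inj₂ (q , _) = toℕ-injective (ℕₚ.suc-injective (trans p (sym q)))

suc-mod-≢ : ∀ k (i : Fin (3 + k)) → suc (toℕ i) % (3 + k) ≢ toℕ i
suc-mod-≢ k i eq with suc-mod k i
... | inj₁ (_ , p) = ℕₚ.1+n≢n (trans (sym p) eq)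
... | inj₂ (p , q) = case trans (cong suc (trans (sym q) eq)) p of λ ()

cycle-deg≤2 : ∀ k w → Deg≤2 (cycleGraph k) w
cycle-deg≤2 k w = (λ z → suc (toℕ w) % (3 + k) ≡ toℕ z) , (λ z → suc (toℕ z) % (3 + k) ≡ toℕ w) ,
  (λ p q → toℕ-injective (trans (sym p) q)) ,
  (λ {a} {b} p q → suc-mod-injective k a b (trans p (sym q))) ,
  λ z e → [ (λ p → inj₁ (≡ᵇ-true p)) , (λ p → inj₂ (≡ᵇ-true p)) ]′ (∨-split e)

cycle-loopless : ∀ k → Loopless (cycleGraph k)
cycle-loopless k a e with ∨-split e
... | inj₁ p = suc-mod-≢ k a (≡ᵇ-true p)
... | inj₂ p = suc-mod-≢ k a (≡ᵇ-true p)

cycle-twoTreeLike : ∀ k → TwoTreeLike (cycleGraph k)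
cycle-twoTreeLike k = record
  { symmetric = λ a b → ∨-swap {suc (toℕ a) % (3 + k) ≡ᵇ toℕ b}
  ; loopless = cycle-loopless k
  ; theta = λ p → theta-at-deg≤2 (cycle-loopless k) (cycle-deg≤2 k p)
  ; noCross = λ x y X Y e h l d _ → three-neighbours (cycle-deg≤2 k x) e h l d }

-- Relabelling

relabel-twoTreeLike : ∀ {n} {G H : Graph n} → TwoTreeLike G → (σ : Permutation′ n) →
  (∀ a b → H (σ ⟨$⟩ʳ a) (σ ⟨$⟩ʳ b) ≡ G a b) → TwoTreeLike H
relabel-twoTreeLike {n} {G} {H} t σ eq = record
  { symmetric = λ a b e → up (symmetric t _ _ (down e))
  ; loopless = λ a e → loopless t _ (down e)
  ; theta = λ p q X Y Z ne xy yz xz sx sy sz → up (theta t _ _ (X ∘ σ′) (Y ∘ σ′) (Z ∘ σ′)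
      (λ e → ne (τ-inj e)) (off xy) (off yz) (off xz) (map⋆ sx) (map⋆ sy) (map⋆ sz))
  ; noCross = λ x y X Y e h k d s → noCross t _ _ (X ∘ σ′) (Y ∘ σ′) (down e) (hmap h) (hmap k)
      (λ w → d (σ′ w)) (gmap τ (λ (e , (a , b) , c , d) → down e ,
        ((λ z → a (τ-inj z)) , λ z → b (τ-inj z)) , ((λ z → c (τ-inj z)) , λ z → d (τ-inj z))) s) }
  where
  σ′ τ : Fin n → Fin n
  σ′ a = σ ⟨$⟩ʳ a
  τ a = σ ⟨$⟩ˡ a
  στ : ∀ a → σ′ (τ a) ≡ a
  στ a = inverseʳ σ
  τσ : ∀ a → τ (σ′ a) ≡ a
  τσ a = inverseˡ σ
  τ-inj : ∀ {a b} → τ a ≡ τ b → a ≡ b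
  τ-inj {a} {b} e = trans (sym (στ a)) (trans (cong σ′ e) (στ b))
  down : ∀ {a b} → E H a b → E G (τ a) (τ b)
  down {a} {b} e = trans (sym (eq (τ a) (τ b))) (trans (cong₂ H (στ a) (στ b)) e)
  up : ∀ {a b} → E G (τ a) (τ b) → E H a b
  up {a} {b} e = trans (sym (cong₂ H (στ a) (στ b))) (trans (eq (τ a) (τ b)) e)
  lift : (X : Fin n → Set) → ∀ {a} → X a → X (σ′ (τ a))
  lift X {a} = subst X (sym (στ a))
  map⋆ : ∀ {X a b} → Star (Within H X) a b → Star (Within G (X ∘ σ′)) (τ a) (τ b)
  map⋆ {X} = gmap τ (λ (e , p , q) → down e , lift X p , lift X q)
  off : ∀ {p q X Y} → DisjointOff p q X Y → DisjointOff (τ p) (τ q) (X ∘ σ′) (Y ∘ σ′)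
  off d w a b with d (σ′ w) a b
  ... | inj₁ e = inj₁ (trans (sym (τσ w)) (cong τ e))
  ... | inj₂ e = inj₂ (trans (sym (τσ w)) (cong τ e))
  hmap : ∀ {x y X} → Handle H x y X → Handle G (τ x) (τ y) (X ∘ σ′)
  hmap {x} {y} {X} h = handle (τ (first h)) (τ (last h)) (down (x-first h)) (down (y-last h))
    (λ p → avoids-x h (subst X (στ x) p)) (λ p → avoids-y h (subst X (στ y) p))
    (lift X (first∈ h)) (lift X (last∈ h)) (map⋆ {X} (interior h))

-- Adding a path

module _ {n : ℕ} (G : Graph n) (t : TwoTreeLike G) (u v : Fin n) (uv : E G u v) (k : ℕ) where

  private
    G⁺ : Graph (n + suc k)
    G⁺ = addPath G u v k

    old : Fin n → Fin (n + suc k)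
    old a = a ↑ˡ suc k

    new : Fin (suc k) → Fin (n + suc k)
    new i = n ↑ʳ i

    data View : Fin (n + suc k) → Set where
      isOld : ∀ a → View (old a)
      isNew : ∀ i → View (new i)

    view : ∀ x → View x
    view x with splitAt n x in eq
    ... | inj₁ a = subst View (splitAt⁻¹-↑ˡ eq) (isOld a)
    ... | inj₂ i = subst View (splitAt⁻¹-↑ʳ {n} eq) (isNew i)

    old-inj : ∀ {a b} → old a ≡ old b → a ≡ b
    old-inj = ↑ˡ-injective (suc k) _ _

    old≢new : ∀ {a i} → old a ≢ new i
    old≢new {a} {i} e with trans (sym (splitAt-↑ˡ n a (suc k))) (trans (cong (splitAt n) e) (splitAt-↑ʳ n (suc k) i))
    ... | ()

    oo : ∀ a b → G⁺ (old a) (old b) ≡ G a b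
    oo a b rewrite splitAt-↑ˡ n a (suc k) | splitAt-↑ˡ n b (suc k) = refl

    on : ∀ a i → G⁺ (old a) (new i) ≡ (⌊ a ≟ u ⌋ ∧ (toℕ i ≡ᵇ 0)) ∨ (⌊ a ≟ v ⌋ ∧ (toℕ i ≡ᵇ k))
    on a i rewrite splitAt-↑ˡ n a (suc k) | splitAt-↑ʳ n (suc k) i = refl

    no′ : ∀ a i → G⁺ (new i) (old a) ≡ (⌊ a ≟ u ⌋ ∧ (toℕ i ≡ᵇ 0)) ∨ (⌊ a ≟ v ⌋ ∧ (toℕ i ≡ᵇ k))
    no′ a i rewrite splitAt-↑ˡ n a (suc k) | splitAt-↑ʳ n (suc k) i = refl

    nn : ∀ i j → G⁺ (new i) (new j) ≡ (suc (toℕ i) ≡ᵇ toℕ j) ∨ (suc (toℕ j) ≡ᵇ toℕ i)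
    nn i j rewrite splitAt-↑ʳ n (suc k) i | splitAt-↑ʳ n (suc k) j = refl

    G⁺-sym : SymG G⁺
    G⁺-sym x y e with view x | view y
    ... | isOld a | isOld b = trans (oo b a) (symmetric t _ _ (trans (sym (oo a b)) e))
    ... | isOld a | isNew i = trans (no′ a i) (trans (sym (on a i)) e)
    ... | isNew i | isOld a = trans (on a i) (trans (sym (no′ a i)) e)
    ... | isNew i | isNew j = trans (nn j i) (∨-swap {suc (toℕ i) ≡ᵇ toℕ j} (trans (sym (nn i j)) e))

    G⁺-loopless : Loopless G⁺
    G⁺-loopless x e with view x
    ... | isOld a = loopless t a (trans (sym (oo a a)) e)
    ... | isNew i with ∨-split {suc (toℕ i) ≡ᵇ toℕ i} (trans (sym (nn i i)) e)
    ...   | inj₁ p = ℕₚ.1+n≢n {toℕ i} (≡ᵇ-true p)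
    ...   | inj₂ p = ℕₚ.1+n≢n {toℕ i} (≡ᵇ-true p)

    attach : ∀ {a i} → E G⁺ (new i) (old a) → (a ≡ u × toℕ i ≡ 0) ⊎ (a ≡ v × toℕ i ≡ k)
    attach {a} {i} e with ∨-split (trans (sym (no′ a i)) e)
    ... | inj₁ p = let q , r = ∧-split p in inj₁ (≟-true q , ≡ᵇ-true r)
    ... | inj₂ p = let q , r = ∧-split p in inj₂ (≟-true q , ≡ᵇ-true r)

    new-deg≤2 : ∀ i → Deg≤2 G⁺ (new i)
    new-deg≤2 i = P , Q , P! , Q! , cover
      where
      P Q : Fin (n + suc k) → Set
      P z = (z ≡ old u × toℕ i ≡ 0) ⊎ ∃ λ j → z ≡ new j × suc (toℕ j) ≡ toℕ i
      Q z = (z ≡ old v × toℕ i ≡ k) ⊎ ∃ λ j → z ≡ new j × suc (toℕ i) ≡ toℕ j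
      P! : ∀ {a b} → P a → P b → a ≡ b
      P! (inj₁ (p , _)) (inj₁ (q , _)) = trans p (sym q)
      P! (inj₁ (_ , p)) (inj₂ (_ , _ , q)) = case trans q p of λ ()
      P! (inj₂ (_ , _ , q)) (inj₁ (_ , p)) = case trans q p of λ ()
      P! (inj₂ (j , p , q)) (inj₂ (l , r , s)) =
        trans p (trans (cong new (toℕ-injective (ℕₚ.suc-injective (trans q (sym s))))) (sym r))
      Q! : ∀ {a b} → Q a → Q b → a ≡ b
      Q! (inj₁ (p , _)) (inj₁ (q , _)) = trans p (sym q)
      Q! (inj₁ (_ , p)) (inj₂ (j , _ , q)) = ⊥-elim (ℕₚ.<-irrefl (trans (sym q) (cong suc p)) (toℕ<n j))
      Q! (inj₂ (j , _ , q)) (inj₁ (_ , p)) = ⊥-elim (ℕₚ.<-irrefl (trans (sym q) (cong suc p)) (toℕ<n j))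
      Q! (inj₂ (j , p , q)) (inj₂ (l , r , s)) = trans p (trans (cong new (toℕ-injective (trans (sym q) s))) (sym r))
      cover : ∀ z → E G⁺ (new i) z → P z ⊎ Q z
      cover z e with view z
      ... | isOld a = [ (λ (p , q) → inj₁ (inj₁ (cong old p , q))) , (λ (p , q) → inj₂ (inj₁ (cong old p , q))) ]′ (attach e)
      ... | isNew j with ∨-split (trans (sym (nn i j)) e)
      ...   | inj₁ p = inj₂ (inj₂ (j , refl , ≡ᵇ-true p))
      ...   | inj₂ p = inj₁ (inj₂ (j , refl , ≡ᵇ-true p))

    vu : E G v u
    vu = symmetric t _ _ uv

    -- Collapsing the new path onto whichever of its two ends the walk may visit turns walks of G⁺ into walks of G.
    Collapsed : (Fin (n + suc k) → Set) → Fin n → ∀ {x} → View x → Set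
    Collapsed X b (isOld a) = Star (Within G (X ∘ old)) a b
    Collapsed X b (isNew i) = (X (old u) ⊎ X (old v)) ×
      (X (old u) → Star (Within G (X ∘ old)) u b) × (X (old v) → Star (Within G (X ∘ old)) v b)

    collapse′ : ∀ {X x y b} → y ≡ old b → (vx : View x) → Star (Within G⁺ X) x y → Collapsed X b vx
    collapse′ {X} {b = b} eq (isOld a) ε = subst (Star _ a) (old-inj eq) ε
    collapse′ eq (isNew i) ε = ⊥-elim (old≢new (sym eq))
    collapse′ {X} {b = b} eq (isOld a) (_◅_ {j = z} (e , p , q) s) with view z
    ... | isOld c = (trans (sym (oo a c)) e , p , q) ◅ collapse′ {X} eq (isOld c) s
    ... | isNew i with attach (G⁺-sym _ _ e) | collapse′ {X} {b = b} eq (isNew i) s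
    ...   | inj₁ (refl , _) | (_ , f , _) = f p
    ...   | inj₂ (refl , _) | (_ , _ , g) = g p
    collapse′ {X} {b = b} eq (isNew i) (_◅_ {j = z} (e , p , q) s) with view z
    ... | isNew j = collapse′ {X} eq (isNew j) s
    ... | isOld c with attach e | collapse′ {X} eq (isOld c) s
    ...   | inj₁ (refl , _) | r = inj₁ q , (λ _ → r) , λ x → (vu , x , q) ◅ r
    ...   | inj₂ (refl , _) | r = inj₂ q , (λ x → (uv , x , q) ◅ r) , λ _ → r

    collapse : ∀ {X a b} → Star (Within G⁺ X) (old a) (old b) → Star (Within G (X ∘ old)) a b
    collapse {X} = collapse′ {X} refl (isOld _)

    -- A new vertex has degree at most two and cannot be a branch vertex; between old vertices the
    -- three walks collapse into G, with their sets merely restricted.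
    G⁺-theta : ThetaClosed G⁺
    G⁺-theta p q X Y Z ne xy yz xz sx sy sz with view p | view q
    ... | isNew i | _ = theta-at-deg≤2 G⁺-loopless (new-deg≤2 i) _ X Y Z ne xy yz xz sx sy sz
    ... | isOld a | isNew j = G⁺-sym _ _ (theta-at-deg≤2 G⁺-loopless (new-deg≤2 j) _ X Y Z (≢-sym ne)
          (flip xy) (flip yz) (flip xz) (r sx) (r sy) (r sz))
      where
      flip : ∀ {p q X Y} → DisjointOff p q X Y → DisjointOff q p X Y
      flip d w a b = [ inj₂ , inj₁ ]′ (d w a b)
      r : ∀ {X p q} → Star (Within G⁺ X) p q → Star (Within G⁺ X) q p
      r = reverse⋆ (within-sym G⁺-sym)
    ... | isOld a | isOld b = trans (oo a b) (theta t a b (X ∘ old) (Y ∘ old) (Z ∘ old) (λ e → ne (cong old e))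
          (off xy) (off yz) (off xz) (collapse {X} sx) (collapse {Y} sy) (collapse {Z} sz))
      where
      off : ∀ {X Y} → DisjointOff (old a) (old b) X Y → DisjointOff a b (X ∘ old) (Y ∘ old)
      off d w p q = [ (λ e → inj₁ (old-inj e)) , (λ e → inj₂ (old-inj e)) ]′ (d (old w) p q)

    Ends : Fin n → Fin n → Set
    Ends a b = (a ≡ u × b ≡ v) ⊎ (a ≡ v × b ≡ u)

    ends? : ∀ a b → Dec (Ends a b)
    ends? a b = ((a ≟ u) ×-dec (b ≟ v)) ⊎-dec ((a ≟ v) ×-dec (b ≟ u))

    u≢v : u ≢ v
    u≢v e = loopless t u (subst (E G u) (sym e) uv)

    -- The re-attached handle may start elsewhere than the given one. The old vertex `c` is
    -- reachable from both starts, so a link in G⁺ can be carried into G by way of it.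
    record OldHandle (a b : Fin n) (X : Fin (n + suc k) → Set) (h : Handle G⁺ (old a) (old b) X) : Set where
      field
        h′ : Handle G a b (X ∘ old)
        c : Fin n
        first-c : Star (Within G (X ∘ old)) (first h′) c
        up : Star (Within G⁺ X) (first h) (old c)

    otherEnd : ∀ {a i} → E G⁺ (old a) (new i) → (a ≡ u ⊎ a ≡ v)
    otherEnd e = [ (λ (p , _) → inj₁ p) , (λ (p , _) → inj₂ p) ]′ (attach (G⁺-sym _ _ e))

    -- Away from the pair u, v the handle can be re-attached at the end of the new path that it must contain.
    oldHandle : ∀ {a b X} → a ≢ b → ¬ Ends a b → (h : Handle G⁺ (old a) (old b) X) → OldHandle a b X h
    oldHandle {a} {b} {X} ne ¬ends h@(handle f l af bl ax ay f∈ l∈ s) with view f | view l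
    ... | isOld f′ | isOld l′ = record { h′ = handle f′ l′ (trans (sym (oo a f′)) af) (trans (sym (oo b l′)) bl) ax ay f∈ l∈ (collapse {X} s)
                                       ; c = f′ ; first-c = ε ; up = ε }
    ... | isNew i | isNew j = ⊥-elim (cases (otherEnd af) (otherEnd bl))
      where
      cases : a ≡ u ⊎ a ≡ v → b ≡ u ⊎ b ≡ v → ⊥
      cases (inj₁ p) (inj₁ q) = ne (trans p (sym q))
      cases (inj₁ p) (inj₂ q) = ¬ends (inj₁ (p , q))
      cases (inj₂ p) (inj₁ q) = ¬ends (inj₂ (p , q))
      cases (inj₂ p) (inj₂ q) = ne (trans p (sym q))
    ... | isNew i | isOld l′ with otherEnd af | collapse′ {X} {b = l′} refl (isNew i) s
    ...   | inj₁ refl | (inj₁ Xu , _) = ⊥-elim (ax Xu)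
    ...   | inj₁ refl | (inj₂ Xv , _ , g) = record { h′ = handle v l′ uv (trans (sym (oo b l′)) bl) ax ay Xv l∈ (g Xv)
                                                   ; c = l′ ; first-c = g Xv ; up = s }
    ...   | inj₂ refl | (inj₂ Xv , _) = ⊥-elim (ax Xv)
    ...   | inj₂ refl | (inj₁ Xu , g , _) = record { h′ = handle u l′ vu (trans (sym (oo b l′)) bl) ax ay Xu l∈ (g Xu)
                                                   ; c = l′ ; first-c = g Xu ; up = s }
    oldHandle {a} {b} {X} ne ¬ends h@(handle f l af bl ax ay f∈ l∈ s) | isOld f′ | isNew j
      with otherEnd bl | collapse′ {X} {b = f′} refl (isNew j) (reverse⋆ (within-sym G⁺-sym) s)
    ...   | inj₁ refl | (inj₁ Xu , _) = ⊥-elim (ay Xu)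
    ...   | inj₁ refl | (inj₂ Xv , _ , g) = record { h′ = handle f′ v (trans (sym (oo a f′)) af) uv ax ay f∈ Xv (reverse⋆ (within-sym (symmetric t)) (g Xv))
                                                   ; c = f′ ; first-c = ε ; up = ε }
    ...   | inj₂ refl | (inj₂ Xv , _) = ⊥-elim (ay Xv)
    ...   | inj₂ refl | (inj₁ Xu , g , _) = record { h′ = handle f′ u (trans (sym (oo a f′)) af) vu ax ay f∈ Xu (reverse⋆ (within-sym (symmetric t)) (g Xu))
                                                   ; c = f′ ; first-c = ε ; up = ε }

    widen : ∀ {m} {H : Graph m} {X Y : Fin m → Set} → (∀ w → X w → Y w) → ∀ {a b} → Star (Within H X) a b → Star (Within H Y) a b
    widen f = gmap (λ z → z) (λ (e , p , q) → e , f _ p , f _ q)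

    Off : ∀ {m} → Fin m → Fin m → Fin m → Set
    Off a b w = w ≢ a × w ≢ b

    avoids : ∀ {m} {H : Graph m} {a b X} → Handle H a b X → ∀ w → X w → Off a b w
    avoids h w Xw = (λ { refl → avoids-x h Xw }) , λ { refl → avoids-y h Xw }

    offOld : ∀ {a b c d} → Star (Within G⁺ (Off (old a) (old b))) (old c) (old d) → Star (Within G (Off a b)) c d
    offOld {a} {b} s = widen {H = G} (λ w (p , q) → (λ e → p (cong old e)) , λ e → q (cong old e)) (collapse {Off (old a) (old b)} s)

    ends-off : ∀ {a b} {P : Set} → Ends a b → Off (old a) (old b) (old u) ⊎ Off (old a) (old b) (old v) → P
    ends-off (inj₁ (refl , refl)) (inj₁ (p , _)) = ⊥-elim (p refl)
    ends-off (inj₁ (refl , refl)) (inj₂ (_ , p)) = ⊥-elim (p refl)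
    ends-off (inj₂ (refl , refl)) (inj₁ (_ , p)) = ⊥-elim (p refl)
    ends-off (inj₂ (refl , refl)) (inj₂ (p , _)) = ⊥-elim (p refl)

    ends-handle : ∀ {a b X} → Ends a b → (h : Handle G⁺ (old a) (old b) X) → ∀ {f′} → old f′ ≡ first h →
      Σ (Handle G a b (X ∘ old)) λ h′ → first h′ ≡ f′
    ends-handle {a} {b} {X} en h@(handle f l af bl ax ay f∈ l∈ s) {f′} refl with view l
    ... | isOld l′ = handle f′ l′ (trans (sym (oo a f′)) af) (trans (sym (oo b l′)) bl) ax ay f∈ l∈ (collapse {X} s) , refl
    ... | isNew j with collapse′ {X} {b = f′} refl (isNew j) (reverse⋆ (within-sym G⁺-sym) s)
    ...   | inj₁ Xu , _ = ends-off {a} {b} en (inj₁ (avoids {H = G⁺} h _ Xu))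
    ...   | inj₂ Xv , _ = ends-off {a} {b} en (inj₂ (avoids {H = G⁺} h _ Xv))

    same-first : ∀ {a b i j} → Ends a b → E G⁺ (old a) (new i) → E G⁺ (old a) (new j) → i ≡ j
    same-first en p q with attach (G⁺-sym _ _ p) | attach (G⁺-sym _ _ q)
    ... | inj₁ (_ , p) | inj₁ (_ , q) = toℕ-injective (trans p (sym q))
    ... | inj₂ (_ , p) | inj₂ (_ , q) = toℕ-injective (trans p (sym q))
    ... | inj₁ (p , _) | inj₂ (q , _) = ⊥-elim (u≢v (trans (sym p) q))
    ... | inj₂ (p , _) | inj₁ (q , _) = ⊥-elim (u≢v (trans (sym q) p))

    G⁺-noCross : NoCross G⁺
    G⁺-noCross x y X Y e h l d s with view x | view y
    ... | isNew i | _ = three-neighbours (new-deg≤2 i) e h l d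
    ... | isOld a | isNew j = three-neighbours (new-deg≤2 j) (G⁺-sym _ _ e) (flip-handle G⁺-sym h) (flip-handle G⁺-sym l) d
    ... | isOld a | isOld b with ends? a b
    ...   | no ¬en = noCross t a b (X ∘ old) (Y ∘ old) (trans (sym (oo a b)) e) h′ l′ (λ w → d (old w)) s′
      where
      a≢b : a ≢ b
      a≢b refl = G⁺-loopless _ e
      oh : OldHandle a b X h
      oh = oldHandle a≢b ¬en h
      ol : OldHandle a b Y l
      ol = oldHandle a≢b ¬en l
      h′ = OldHandle.h′ oh
      l′ = OldHandle.h′ ol
      G⁺sym⋆ : ∀ {X c d} → Star (Within G⁺ X) c d → Star (Within G⁺ X) d c
      G⁺sym⋆ = reverse⋆ (within-sym G⁺-sym)
      s′ : Star (Within G (Off a b)) (first h′) (first l′)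
      s′ = widen {H = G} (avoids {H = G} h′) (OldHandle.first-c oh) ◅◅
           offOld (G⁺sym⋆ (widen {H = G⁺} (avoids {H = G⁺} h) (OldHandle.up oh)) ◅◅ s ◅◅ widen {H = G⁺} (avoids {H = G⁺} l) (OldHandle.up ol)) ◅◅
           reverse⋆ (within-sym (symmetric t)) (widen {H = G} (avoids {H = G} l′) (OldHandle.first-c ol))
    G⁺-noCross x y X Y e h l d s | isOld a | isOld b | yes en = go (view (first h)) (view (first l)) refl refl
      where
      -- Here x and y are the ends of the new path, and removing them cuts its interior off from the
      -- old vertices. Linked first vertices are therefore both new, hence equal, or both old, in
      -- which case everything collapses into G.
      go : ∀ {f g} → View f → View g → f ≡ first h → g ≡ first l → ⊥
      go (isNew i) (isNew j) p q = d (first h) (first∈ h)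
        (subst Y (trans (sym q) (trans (cong new (sym (same-first {a} {b} en (subst (E G⁺ (old a)) (sym p) (x-first h)) (subst (E G⁺ (old a)) (sym q) (x-first l))))) p)) (first∈ l))
      go (isNew i) (isOld g′) p q = ends-off {a} {b} en (proj₁ (collapse′ {Off (old a) (old b)} {b = g′} (sym q) (isNew i) (subst (λ z → Star _ z _) (sym p) s)))
      go (isOld f′) (isNew j) p q = ends-off {a} {b} en (proj₁ (collapse′ {Off (old a) (old b)} {b = f′} (sym p) (isNew j)
        (subst (λ z → Star _ z _) (sym q) (reverse⋆ (within-sym G⁺-sym) s))))
      go (isOld f′) (isOld g′) p q with ends-handle en h p | ends-handle en l q
      ... | h′ , r | l′ , r′ = noCross t a b (X ∘ old) (Y ∘ old) (trans (sym (oo a b)) e) h′ l′ (λ w → d (old w))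
           (subst₂ (Star (Within G (Off a b))) (sym r) (sym r′) (offOld (subst₂ (Star (Within G⁺ (Off (old a) (old b)))) (sym p) (sym q) s)))

  addPath-twoTreeLike : TwoTreeLike (addPath G u v k)
  addPath-twoTreeLike = record { symmetric = G⁺-sym ; loopless = G⁺-loopless ; theta = G⁺-theta ; noCross = G⁺-noCross }

polygonal-twoTreeLike : ∀ {n} {G : Graph n} → Polygonal2Tree G → TwoTreeLike G
polygonal-twoTreeLike (cycle k) = cycle-twoTreeLike k
polygonal-twoTreeLike (addP p u v e k) = addPath-twoTreeLike _ (polygonal-twoTreeLike p) u v e k
polygonal-twoTreeLike (relabel p σ eq) = relabel-twoTreeLike (polygonal-twoTreeLike p) σ eq

-- Lists without repetition

module _ {A : Set} where

  unique-++⁻ : ∀ (xs : List A) {ys} → Unique (xs ++ ys) →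
    Unique xs × Unique ys × (∀ {w} → w ∈ xs → w ∈ ys → ⊥)
  unique-++⁻ [] u = [] , u , λ ()
  unique-++⁻ (x ∷ xs) (a ∷ u) with unique-++⁻ xs u
  ... | p , q , d = (All.tabulate (λ m → All.lookup a (∈-++⁺ˡ m)) ∷ p) , q ,
        λ { (here refl) m → All.lookup a (∈-++⁺ʳ xs m) refl ; (there l) m → d l m }

  unique-++⁺ : ∀ {xs ys : List A} → Unique xs → Unique ys → (∀ {w} → w ∈ xs → w ∈ ys → ⊥) → Unique (xs ++ ys)
  unique-++⁺ p q d = Uniqueₚ.++⁺ p q (λ (a , b) → d a b)

  unique-reverse : ∀ {xs : List A} → Unique xs → Unique (reverse xs)
  unique-reverse [] = []
  unique-reverse {x ∷ xs} (a ∷ u) = subst Unique (sym (unfold-reverse x xs))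
    (unique-++⁺ (unique-reverse u) ([] ∷ []) λ { m (here refl) → All.lookup a (reverse⁻ m) refl })

  unique-⊆-length : ∀ {xs ys : List A} → Unique xs → (∀ {w} → w ∈ xs → w ∈ ys) → length xs ≤ length ys
  unique-⊆-length [] _ = z≤n
  unique-⊆-length {x ∷ xs} {ys} (a ∷ u) s with ∈-∃++ (s (here refl))
  ... | ps , qs , refl = subst (suc (length xs) ≤_) eq (s≤s (unique-⊆-length u sub))
    where
    eq : suc (length (ps ++ qs)) ≡ length (ps ++ x ∷ qs)
    eq = trans (cong suc (length-++ ps)) (trans (sym (ℕₚ.+-suc (length ps) (length qs))) (sym (length-++ ps)))
    sub : ∀ {w} → w ∈ xs → w ∈ ps ++ qs
    sub m with ∈-++⁻ ps (s (there m))
    ... | inj₁ q = ∈-++⁺ˡ q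
    ... | inj₂ (here refl) = ⊥-elim (All.lookup a m refl)
    ... | inj₂ (there q) = ∈-++⁺ʳ ps q

  ∈-last : ∀ (l : List A) {v} → v ∈ l ++ [ v ]
  ∈-last l = ∈-++⁺ʳ l (here refl)

  ∈-snoc⁻ : ∀ (l : List A) {v w} → w ∈ l ++ [ v ] → w ∈ l ⊎ w ≡ v
  ∈-snoc⁻ l m with ∈-++⁻ l m
  ... | inj₁ p = inj₁ p
  ... | inj₂ (here e) = inj₂ e

unique-length≤n : ∀ {n} {xs : List (Fin n)} → Unique xs → length xs ≤ n
unique-length≤n {n} {xs} u = subst (length xs ≤_) (length-tabulate {n = n} (λ i → i)) (unique-⊆-length u (λ {w} _ → ∈-allFin w))

-- Walks

-- The list holds every vertex of the walk but the last one, so it has one entry per edge.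
data Walk {A : Set} (R : A → A → Set) : A → A → List A → Set where
  [] : ∀ {u} → Walk R u u []
  _∷_ : ∀ {u w v l} → R u w → Walk R w v l → Walk R u v (u ∷ l)

module _ {A : Set} {R : A → A → Set} where

  infixr 5 _++ʷ_
  _++ʷ_ : ∀ {u v w l m} → Walk R u v l → Walk R v w m → Walk R u w (l ++ m)
  [] ++ʷ q = q
  (r ∷ p) ++ʷ q = r ∷ (p ++ʷ q)

  start∈ : ∀ {u v l} → Walk R u v l → u ∈ l ++ [ v ]
  start∈ [] = here refl
  start∈ (_ ∷ _) = here refl

  fromStar : ∀ {u v} → Star R u v → ∃ λ l → Walk R u v l
  fromStar ε = _ , []
  fromStar (r ◅ s) = _ , r ∷ proj₂ (fromStar s)

  toStar : ∀ {u v l} → Walk R u v l → Star R u v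
  toStar [] = ε
  toStar (r ∷ p) = r ◅ toStar p

  toLinked : ∀ {u v l} → Walk R u v l → Linked R (l ++ [ v ])
  toLinked [] = [-]
  toLinked (r ∷ []) = r ∷ [-]
  toLinked (r ∷ p@(_ ∷ _)) = r ∷ toLinked p

  fromLinked : ∀ {u v} l → Linked R (u ∷ l ++ [ v ]) → Walk R u v (u ∷ l)
  fromLinked [] (r ∷ [-]) = r ∷ []
  fromLinked (w ∷ l) (r ∷ s) = r ∷ fromLinked l s

  split : ∀ {u v l w} → Walk R u v l → w ∈ l ++ [ v ] →
    ∃₂ λ l₁ l₂ → Walk R u w l₁ × Walk R w v l₂ × l ≡ l₁ ++ l₂
  split [] (here refl) = [] , [] , [] , [] , refl
  split (r ∷ p) (here refl) = [] , _ , [] , r ∷ p , refl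
  split (r ∷ p) (there m) with split p m
  ... | l₁ , l₂ , p₁ , p₂ , refl = _ , l₂ , r ∷ p₁ , p₂ , refl

  firstHit : ∀ {P : A → Set} → Decidable P → ∀ {u v l} → Walk R u v l → P v →
    ∃ λ p → ∃₂ λ l₁ l₂ → Walk R u p l₁ × Walk R p v l₂ × l ≡ l₁ ++ l₂ × P p × (∀ {w} → w ∈ l₁ → ¬ P w)
  firstHit P? [] Pv = _ , [] , [] , [] , [] , refl , Pv , λ ()
  firstHit P? {u} (r ∷ p) Pv with P? u
  ... | yes Pu = _ , [] , _ , [] , r ∷ p , refl , Pu , λ ()
  ... | no ¬Pu with firstHit P? p Pv
  ...   | q , l₁ , l₂ , p₁ , p₂ , refl , Pq , o =
          q , _ , l₂ , r ∷ p₁ , p₂ , refl , Pq , λ { (here refl) → ¬Pu ; (there m) → o m }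

  firstExit : ∀ {P : A → Set} → Decidable P → ∀ {u v l} → Walk R u v l → P u → ¬ P v →
    ∃₂ λ a b → ∃₂ λ l₁ l₂ → Walk R u a l₁ × R a b × Walk R b v l₂ × l ≡ l₁ ++ a ∷ l₂ × P a × ¬ P b
  firstExit P? [] Pu ¬Pv = ⊥-elim (¬Pv Pu)
  firstExit P? (_∷_ {w = w} r p) Pu ¬Pv with P? w
  ... | no ¬Pw = _ , _ , [] , _ , [] , r , p , refl , Pu , ¬Pw
  ... | yes Pw with firstExit P? p Pw ¬Pv
  ...   | a , b , l₁ , l₂ , p₁ , e , p₂ , refl , Pa , ¬Pb = a , b , _ , l₂ , r ∷ p₁ , e , p₂ , refl , Pa , ¬Pb

  unsnoc : ∀ {u v l} → Walk R u v l → u ≢ v → ∃₂ λ t l′ → Walk R u t l′ × R t v × l ≡ l′ ++ [ t ]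
  unsnoc [] ne = ⊥-elim (ne refl)
  unsnoc (r ∷ []) ne = _ , [] , [] , r , refl
  unsnoc (r ∷ p@(_∷_ {u = w} {v = v} r′ p′)) ne = lemma p′ r r′
    where
    lemma : ∀ {a b c v l} → Walk R c v l → R a b → R b c → ∃₂ λ t l′ → Walk R a t l′ × R t v × a ∷ b ∷ l ≡ l′ ++ [ t ]
    lemma [] r s = _ , _ , r ∷ [] , s , refl
    lemma (q ∷ p) r s with lemma p s q
    ... | t , l′ , p′ , e , eq = t , _ , r ∷ p′ , e , cong (_ ∷_) eq

  simplify : (∀ (a b : A) → Dec (a ≡ b)) → ∀ {u v l} → Walk R u v l →
    ∃ λ l′ → Walk R u v l′ × Unique (l′ ++ [ v ]) × length l′ ≤ length l × (∀ {w} → w ∈ l′ → w ∈ l)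
  simplify _≟′_ [] = [] , [] , ([] ∷ []) , z≤n , λ ()
  simplify _≟′_ {u} {v} (r ∷ p) with simplify _≟′_ p
  ... | l′ , p′ , un , le , sub with _∈?_ _≟′_ u (l′ ++ [ v ])
  ...   | no u∉ = u ∷ l′ , r ∷ p′ , (All.tabulate (λ m e → u∉ (subst (_∈ _) (sym e) m)) ∷ un) , s≤s le ,
            λ { (here e) → here e ; (there m) → there (sub m) }
  ...   | yes u∈ with split p′ u∈
  ...     | l₁ , l₂ , _ , p₂ , refl = l₂ , p₂ ,
            proj₁ (proj₂ (unique-++⁻ l₁ (subst Unique (++-assoc l₁ l₂ [ v ]) un))) ,
            ℕₚ.≤-trans (ℕₚ.≤-trans (ℕₚ.m≤n+m (length l₂) (length l₁)) (ℕₚ.≤-reflexive (sym (length-++ l₁)))) (ℕₚ.m≤n⇒m≤1+n le) ,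
            λ m → there (sub (∈-++⁺ʳ l₁ m))

  reverseʷ : (∀ {a b} → R a b → R b a) → ∀ {u v l} → Walk R u v l →
    ∃ λ l′ → Walk R v u l′ × l′ ++ [ u ] ≡ reverse (l ++ [ v ])
  reverseʷ s [] = [] , [] , refl
  reverseʷ s {u} {v} (_∷_ {w = w} {l = l} r p) with reverseʷ s p
  ... | l′ , p′ , eq = l′ ++ [ w ] , p′ ++ʷ (s r ∷ []) ,
        trans (cong (_++ [ u ]) eq) (sym (unfold-reverse u (l ++ [ v ])))

module _ {A : Set} where

  mapʷ : ∀ {R R′ : A → A → Set} → (∀ {a b} → R a b → R′ a b) → ∀ {u v l} → Walk R u v l → Walk R′ u v l
  mapʷ f [] = []
  mapʷ f (r ∷ p) = f r ∷ mapʷ f p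

  mapWith : ∀ {R R′ : A → A → Set} {u v l} → Walk R u v l →
    (∀ {a b} → a ∈ l ++ [ v ] → b ∈ l ++ [ v ] → R a b → R′ a b) → Walk R′ u v l
  mapWith [] f = []
  mapWith (r ∷ p) f = f (here refl) (there (start∈ p)) r ∷ mapWith p (λ a b → f (there a) (there b))

  snoc-length : ∀ (l : List A) {v} → length (l ++ [ v ]) ≡ suc (length l)
  snoc-length l = trans (length-++ l) (ℕₚ.+-comm (length l) 1)

  reverse-walk-length : ∀ {l′ l : List A} {u v} → l′ ++ [ u ] ≡ reverse (l ++ [ v ]) → length l′ ≡ length l
  reverse-walk-length {l′} {l} {u} {v} eq = ℕₚ.suc-injective (trans (sym (snoc-length l′)) (trans (cong length eq)
    (trans (length-reverse (l ++ [ v ])) (snoc-length l))))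

  reverse-walk-∈ : ∀ {l′ l : List A} {u v w} → l′ ++ [ u ] ≡ reverse (l ++ [ v ]) → w ∈ l′ ++ [ u ] → w ∈ l ++ [ v ]
  reverse-walk-∈ eq m = reverse⁻ (subst (_ ∈_) eq m)

  reverse-walk-∈′ : ∀ {l′ l : List A} {u v w} → l′ ++ [ u ] ≡ reverse (l ++ [ v ]) → w ∈ l ++ [ v ] → w ∈ l′ ++ [ u ]
  reverse-walk-∈′ eq m = subst (_ ∈_) (sym eq) (reverse⁺ m)

-- Distances

module _ {n : ℕ} (H : Graph n) where

  any-sound : ∀ (f : Fin n → Bool) xs → any f xs ≡ true → ∃ λ w → f w ≡ true
  any-sound f (x ∷ xs) p = [ (λ q → x , q) , any-sound f xs ]′ (∨-split {f x} p)

  any-complete : ∀ (f : Fin n → Bool) {xs w} → w ∈ xs → f w ≡ true → any f xs ≡ true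
  any-complete f (here refl) p = ∨-left p
  any-complete f {x ∷ _} (there m) p = ∨-right {f x} (any-complete f m p)

  reach-sound : ∀ k {u v} → reach H k u v ≡ true → ∃ λ l → Walk (E H) u v l × length l ≤ k
  reach-sound zero p with refl ← ≟-true p = [] , [] , z≤n
  reach-sound (suc k) {u} {v} p with ∨-split {reach H k u v} p
  ... | inj₁ q = let l , w , le = reach-sound k q in l , w , ℕₚ.m≤n⇒m≤1+n le
  ... | inj₂ q with any-sound _ (allFin n) q
  ...   | w , r with ∧-split {H u w} r
  ...     | a , b = let l , p′ , le = reach-sound k b in u ∷ l , a ∷ p′ , s≤s le

  reach-complete : ∀ {k u v l} → Walk (E H) u v l → length l ≤ k → reach H k u v ≡ true
  reach-complete {zero} {u} [] _ = ≟-refl u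
  reach-complete {suc k} [] _ = ∨-left (reach-complete {k} [] z≤n)
  reach-complete {suc k} {u} {v} (_∷_ {w = w} e p) (s≤s le) =
    ∨-right {reach H k u v} (any-complete (λ w → H u w ∧ reach H k w v) (∈-allFin w) (∧-join e (reach-complete p le)))

  distFrom-≤ : ∀ k fuel {u v} j → reach H j u v ≡ true → k ≤ j → distFrom H k fuel u v ≤ j
  distFrom-≤ k zero j r le = le
  distFrom-≤ k (suc fuel) {u} {v} j r le with reach H k u v in eq
  ... | true = le
  ... | false with ℕₚ.m≤n⇒m<n∨m≡n le
  ...   | inj₁ lt = distFrom-≤ (suc k) fuel j r lt
  ...   | inj₂ refl = case trans (sym eq) r of λ ()

  distFrom-bound : ∀ k fuel {u v} → distFrom H k fuel u v ≤ k + fuel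
  distFrom-bound k zero = ℕₚ.m≤m+n k 0
  distFrom-bound k (suc fuel) {u} {v} with reach H k u v
  ... | true = ℕₚ.m≤m+n k _
  ... | false = subst (distFrom H (suc k) fuel u v ≤_) (sym (ℕₚ.+-suc k fuel)) (distFrom-bound (suc k) fuel)

  distFrom-reach : ∀ k fuel {u v} → reach H (k + fuel) u v ≡ true → reach H (distFrom H k fuel u v) u v ≡ true
  distFrom-reach k zero {u} {v} r = subst (λ z → reach H z u v ≡ true) (ℕₚ.+-identityʳ k) r
  distFrom-reach k (suc fuel) {u} {v} r with reach H k u v in eq
  ... | true = eq
  ... | false = distFrom-reach (suc k) fuel (subst (λ z → reach H z u v ≡ true) (ℕₚ.+-suc k fuel) r)

  dist≤n : ∀ u v → dist H u v ≤ n
  dist≤n u v = distFrom-bound 0 n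

  dist-≤ : ∀ {u v l} → Walk (E H) u v l → dist H u v ≤ length l
  dist-≤ {l = l} p = distFrom-≤ 0 n (length l) (reach-complete p ℕₚ.≤-refl) z≤n

  -- `dist` searches with fuel `n`. A simple walk has fewer than `n` edges, so the search succeeds,
  -- and simplifying the walk it finds cannot make it longer.
  geodesic : ∀ {u v} → Connected H u v →
    ∃ λ l → Walk (E H) u v l × Unique (l ++ [ v ]) × length l ≡ dist H u v
  geodesic {u} {v} c with simplify _≟_ (proj₂ (fromStar c))
  ... | l₀ , p₀ , un₀ , _ , _ with reach-sound (dist H u v) (distFrom-reach 0 n (reach-complete p₀ l₀≤n))
    where
    l₀≤n : length l₀ ≤ n
    l₀≤n = ℕₚ.≤-trans (ℕₚ.n≤1+n _) (subst (_≤ n) (snoc-length l₀) (unique-length≤n un₀))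
  ...   | l₁ , p₁ , le₁ with simplify _≟_ p₁
  ...     | l , p , un , le , _ = l , p , un , ℕₚ.≤-antisym (ℕₚ.≤-trans le le₁) (dist-≤ p)

  dist-sym : SymG H → ∀ {u v} → Connected H u v → dist H v u ≤ dist H u v
  dist-sym s c with geodesic c
  ... | l , p , _ , eq with reverseʷ (λ {a} {b} → s a b) p
  ...   | l′ , p′ , r = subst (dist H _ _ ≤_) (trans (reverse-walk-length {l = l} r) eq) (dist-≤ p′)

-- Deleting edges

module _ {n : ℕ} where

  mem? : ∀ (X : ESet n) u v → Dec (Mem X u v)
  mem? X u v = (X u v ∨ X v u) Bool.≟ true

  mem-sym : ∀ (X : ESet n) {u v} → Mem X u v → Mem X v u
  mem-sym X {u} {v} = ∨-swap {X u v}

  ─⁻ : ∀ (H : Graph n) X {u v} → E (H ─ X) u v → E H u v × ¬ Mem X u v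
  ─⁻ H X {u} {v} p with ∧-split {H u v} p
  ... | q , r = q , λ m → case trans (sym r) (cong not m) of λ ()

  ─⁺ : ∀ (H : Graph n) X {u v} → E H u v → ¬ Mem X u v → E (H ─ X) u v
  ─⁺ H X {u} {v} p m with X u v ∨ X v u
  ... | true = ⊥-elim (m refl)
  ... | false = ∧-join p refl

  ─-sym : ∀ {H : Graph n} X → SymG H → SymG (H ─ X)
  ─-sym {H} X s a b e with ─⁻ H X e
  ... | p , q = ─⁺ H X (s _ _ p) (λ m → q (mem-sym X m))

  SamePair : (x y u v : Fin n) → Set
  SamePair x y u v = (u ≡ x × v ≡ y) ⊎ (u ≡ y × v ≡ x)

  mem-single⁻ : ∀ (x y u v : Fin n) → Mem (single x y) u v → SamePair x y u v
  mem-single⁻ x y u v m with ∨-split {single x y u v} m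
  ... | inj₁ p = let a , b = ∧-split {⌊ u ≟ x ⌋} p in inj₁ (≟-true a , ≟-true b)
  ... | inj₂ p = let a , b = ∧-split {⌊ v ≟ x ⌋} p in inj₂ (≟-true b , ≟-true a)

  single-self : ∀ (x y : Fin n) → single x y x y ≡ true
  single-self x y = ∧-join (≟-refl x) (≟-refl y)

  mem-single⁺ : ∀ (x y : Fin n) {u v} → SamePair x y u v → Mem (single x y) u v
  mem-single⁺ x y (inj₁ (refl , refl)) = ∨-left (single-self x y)
  mem-single⁺ x y (inj₂ (refl , refl)) = ∨-right {single x y y x} (single-self x y)

module _ {n : ℕ} where

  consec-++ʳ : ∀ xs {ys : List (Fin n)} {a b} → Consec ys a b → Consec (xs ++ ys) a b
  consec-++ʳ [] c = c
  consec-++ʳ (x ∷ xs) c = there (consec-++ʳ xs c)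

  consec-++ˡ : ∀ {xs ys : List (Fin n)} {a b} → Consec xs a b → Consec (xs ++ ys) a b
  consec-++ˡ here = here
  consec-++ˡ (there c) = there (consec-++ˡ c)

  consec-∈ : ∀ {xs : List (Fin n)} {a b} → Consec xs a b → a ∈ xs × b ∈ xs
  consec-∈ here = here refl , there (here refl)
  consec-∈ (there c) = there (proj₁ (consec-∈ c)) , there (proj₂ (consec-∈ c))

  module _ {R : Fin n → Fin n → Set} where

    consec-start : ∀ {a b v l} → Walk R b v l → Consec (a ∷ l ++ [ v ]) a b
    consec-start [] = here
    consec-start (_ ∷ _) = here

    consec-split⁺ : ∀ {a b v l₂} l₁ → Walk R b v l₂ → Consec ((l₁ ++ a ∷ l₂) ++ [ v ]) a b
    consec-split⁺ {a} {v = v} {l₂} l₁ p = subst (λ z → Consec z _ _) (sym (++-assoc l₁ (a ∷ l₂) [ v ])) (consec-++ʳ l₁ (consec-start p))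

    consec-split⁻ : ∀ {u v l a b} → Walk R u v l → Consec (l ++ [ v ]) a b →
      ∃₂ λ l₁ l₂ → Walk R u a l₁ × R a b × Walk R b v l₂ × l ≡ l₁ ++ a ∷ l₂
    consec-split⁻ [] (there ())
    consec-split⁻ (r ∷ []) here = [] , [] , [] , r , [] , refl
    consec-split⁻ (r ∷ (q ∷ p)) here = [] , _ , [] , r , q ∷ p , refl
    consec-split⁻ (r ∷ p) (there c) with consec-split⁻ p c
    ... | l₁ , l₂ , p₁ , e , p₂ , refl = _ , l₂ , r ∷ p₁ , e , p₂ , refl

    consec-walk⁻ : ∀ {u v w l m a b} → Walk R u v l → Walk R v w m → Consec ((l ++ m) ++ [ w ]) a b →
      Consec (l ++ [ v ]) a b ⊎ Consec (m ++ [ w ]) a b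
    consec-walk⁻ [] q c = inj₂ c
    consec-walk⁻ (r ∷ []) [] here = inj₁ here
    consec-walk⁻ (r ∷ []) (_ ∷ _) here = inj₁ here
    consec-walk⁻ (r ∷ (_ ∷ _)) q here = inj₁ here
    consec-walk⁻ (r ∷ p) q (there c) with consec-walk⁻ p q c
    ... | inj₁ d = inj₁ (there d)
    ... | inj₂ d = inj₂ d

    consec-walkˡ : ∀ {v w m a b} (l : List (Fin n)) → Walk R v w m → Consec (l ++ [ v ]) a b → Consec ((l ++ m) ++ [ w ]) a b
    consec-walkˡ [] q (there ())
    consec-walkˡ (x ∷ []) q here = consec-start q
    consec-walkˡ (x ∷ y ∷ l) q here = here
    consec-walkˡ (x ∷ l) q (there c) = there (consec-walkˡ l q c)

    out-edge : ∀ {u v l w} → Walk R u v l → w ∈ l → ∃ λ z → R w z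
    out-edge (r ∷ p) (here refl) = _ , r
    out-edge (r ∷ p) (there m) = out-edge p m

    -- If the middle piece had two or more edges, replacing it by the single edge ab would shorten a
    -- shortest walk.
    shortcut : ∀ {u a b v} l₁ {l₂ l₃} → (∀ l′ → Walk R u v l′ → length (l₁ ++ l₂ ++ l₃) ≤ length l′) →
      Walk R u a l₁ → Walk R a b l₂ → Walk R b v l₃ → R a b → a ≡ b ⊎ Consec ((l₁ ++ l₂ ++ l₃) ++ [ v ]) a b
    shortcut l₁ min p₁ [] p₃ r = inj₁ refl
    shortcut l₁ min p₁ (_ ∷ []) p₃ r = inj₂ (consec-split⁺ l₁ p₃)
    shortcut {a = a} l₁ {_} {l₃} min p₁ (_∷_ {l = l} _ (_∷_ {l = l′} _ _)) p₃ r = ⊥-elim (ℕₚ.<-irrefl refl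
      (ℕₚ.<-≤-trans lt (ℕₚ.+-cancelˡ-≤ (length l₁) _ _ (ℕₚ.≤-trans (ℕₚ.≤-reflexive (sym (length-++ l₁)))
        (ℕₚ.≤-trans (min _ (p₁ ++ʷ (r ∷ p₃))) (ℕₚ.≤-reflexive (length-++ l₁)))))))
      where
      lt : suc (length l₃) < length (a ∷ l ++ l₃)
      lt = s≤s (s≤s (ℕₚ.≤-trans (ℕₚ.m≤n+m (length l₃) (length l′)) (ℕₚ.≤-reflexive (sym (length-++ l′)))))

    geodesic-chordless : (∀ {a b} → R a b → R b a) → ∀ {u v l} → Walk R u v l →
      (∀ l′ → Walk R u v l′ → length l ≤ length l′) →
      ∀ {a b} → a ∈ l ++ [ v ] → b ∈ l ++ [ v ] → R a b → a ≡ b ⊎ PathEdge (l ++ [ v ]) a b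
    geodesic-chordless s {u} {v} p min {a} {b} a∈ b∈ r with split p a∈
    ... | l₁ , l₂ , p₁ , p₂ , refl with ∈-++⁻ l₁ (subst (b ∈_) (++-assoc l₁ l₂ [ v ]) b∈)
    ...   | inj₂ m with split p₂ m
    ...     | l₃ , l₄ , p₃ , p₄ , refl with shortcut l₁ min p₁ p₃ p₄ r
    ...       | inj₁ e = inj₁ e
    ...       | inj₂ c = inj₂ (inj₁ c)
    geodesic-chordless s {u} {v} p min {a} {b} a∈ b∈ r | l₁ , l₂ , p₁ , p₂ , refl | inj₁ m with split p₁ (∈-++⁺ˡ m)
    ...     | l₃ , l₄ , p₃ , p₄ , refl
      with shortcut l₃ (λ l′ q → subst (_≤ length l′) (cong length (++-assoc l₃ l₄ l₂)) (min l′ q)) p₃ p₄ p₂ (s r)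
    ...       | inj₁ e = inj₁ (sym e)
    ...       | inj₂ c = inj₂ (inj₂ (subst (λ z → Consec (z ++ [ v ]) b a) (sym (++-assoc l₃ l₄ l₂)) c))

-- Disjoint walks and induced cycles

⌊⌋-true : ∀ {P : Set} {d : Dec P} → ⌊ d ⌋ ≡ true → P
⌊⌋-true {d = yes p} _ = p

true-⌊⌋ : ∀ {P : Set} {d : Dec P} → P → ⌊ d ⌋ ≡ true
true-⌊⌋ {d = yes p} _ = refl
true-⌊⌋ {d = no ¬p} p = ⊥-elim (¬p p)

module _ {n : ℕ} where

  MeetOnly : Fin n → Fin n → List (Fin n) → List (Fin n) → Set
  MeetOnly p q l m = ∀ {w} → w ∈ l → w ∈ m → w ≡ p ⊎ w ≡ q

  -- A shortest p-q walk that uses only vertices of the given walk and not the edge pq is chordless,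
  -- and pq closes it. The restriction `R` is itself a Boolean graph, so that `geodesic` applies to
  -- it. Staying on the given vertices is what keeps the cycles obtained from two disjoint walks
  -- distinct.
  induced-cycle : ∀ {K : Graph n} {p q l} → SymG K → Loopless K → E K p q → Walk (E (K ─ single p q)) p q l →
    ∃ λ C → IsInducedCycle K C × CycEdge C p q × (∀ {w} → w ∈ C → w ∈ l ++ [ q ]) × p ∈ C × q ∈ C ×
      ∃ λ w → w ∈ C × w ≢ p × w ≢ q
  induced-cycle {K} {p} {q} {l} s irr pq walk = result
    where
    K⁻ : Graph n
    K⁻ = K ─ single p q
    mem : Fin n → Bool
    mem a = ⌊ _∈?_ _≟_ a (l ++ [ q ]) ⌋
    R : Graph n
    R a b = K⁻ a b ∧ (mem a ∧ mem b)
    R⁻ : ∀ {a b} → E R a b → E K⁻ a b × a ∈ l ++ [ q ] × b ∈ l ++ [ q ]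
    R⁻ {a} {b} e = let x , y = ∧-split {K⁻ a b} e ; z , w = ∧-split {mem a} y in x , ⌊⌋-true z , ⌊⌋-true w
    R⁺ : ∀ {a b} → E K⁻ a b → a ∈ l ++ [ q ] → b ∈ l ++ [ q ] → E R a b
    R⁺ {a} {b} x y z = ∧-join x (∧-join {mem a} (true-⌊⌋ y) (true-⌊⌋ z))
    R-sym : ∀ {a b} → E R a b → E R b a
    R-sym e = let x , y , z = R⁻ e in R⁺ (─-sym (single p q) s _ _ x) z y
    p≢q : p ≢ q
    p≢q refl = irr _ pq
    toK : ∀ {a b} → E R a b → E K a b
    toK e = proj₁ (─⁻ K (single p q) (proj₁ (R⁻ e)))
    Goal : Set
    Goal = ∃ λ C → IsInducedCycle K C × CycEdge C p q × (∀ {w} → w ∈ C → w ∈ l ++ [ q ]) × p ∈ C × q ∈ C ×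
      ∃ λ w → w ∈ C × w ≢ p × w ≢ q
    build : ∀ {l′} → Walk (E R) p q l′ → Unique (l′ ++ [ q ]) → (∀ m → Walk (E R) p q m → length l′ ≤ length m) → Goal
    build [] un min = ⊥-elim (p≢q refl)
    build (r ∷ []) un min = ⊥-elim (proj₂ (─⁻ K (single p q) (proj₁ (R⁻ r))) (mem-single⁺ p q (inj₁ (refl , refl))))
    build g@(_∷_ r g′@(_∷_ {u = w} {l = l″} r′ g″)) un@((a₁ ∷ _) ∷ _) min =
      p ∷ w ∷ l″ ++ [ q ] ,
      ((s≤s (ℕₚ.≤-trans (s≤s z≤n) (ℕₚ.≤-reflexive (sym (snoc-length l″)))) , un ,
        toLinked (mapʷ toK g ++ʷ (s _ _ pq ∷ []))) , chordless) ,
      inj₂ (closing) ,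
      inL , here refl , there (there (∈-last l″)) , w , there (here refl) , ≢-sym a₁ ,
      λ w≡q → proj₂ (proj₂ (unique-++⁻ (p ∷ w ∷ l″) un)) (there (here refl)) (here w≡q)
      where
      closing : Consec (p ∷ w ∷ (l″ ++ [ q ]) ++ [ p ]) q p
      closing = there (there (consec-split⁺ {R = E R} l″ []))
      inL : ∀ {z} → z ∈ p ∷ w ∷ l″ ++ [ q ] → z ∈ l ++ [ q ]
      inL m with ∈-snoc⁻ (p ∷ w ∷ l″) m
      ... | inj₁ m′ = proj₁ (proj₂ (R⁻ (proj₂ (out-edge g m′))))
      ... | inj₂ refl = ∈-last l
      chordless : ∀ a b → a ∈ p ∷ w ∷ l″ ++ [ q ] → b ∈ p ∷ w ∷ l″ ++ [ q ] → E K a b → CycEdge (p ∷ w ∷ l″ ++ [ q ]) a b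
      chordless a b a∈ b∈ e with mem? (single p q) a b
      ... | yes m with mem-single⁻ p q a b m
      ...   | inj₁ (refl , refl) = inj₂ closing
      ...   | inj₂ (refl , refl) = inj₁ closing
      chordless a b a∈ b∈ e | no ¬m with geodesic-chordless R-sym g min a∈ b∈ (R⁺ (─⁺ K (single p q) e ¬m) (inL a∈) (inL b∈))
      ...   | inj₁ refl = ⊥-elim (irr _ e)
      ...   | inj₂ (inj₁ c) = inj₁ (consec-++ˡ c)
      ...   | inj₂ (inj₂ c) = inj₂ (consec-++ˡ c)
    result : Goal
    result with geodesic R (toStar (mapWith {R′ = E R} walk (λ a b e → R⁺ e a b)))
    ... | l′ , g , un , eq = build g un (λ m q → subst (_≤ length m) (sym eq) (dist-≤ R q))

  -- Each of the two induced cycles has a vertex besides p and q and stays on its own walk, so that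
  -- vertex is missing from the other cycle.
  disjoint-walks⇒internal : ∀ {K : Graph n} {p q l m} → SymG K → Loopless K → E K p q →
    Walk (E (K ─ single p q)) p q l → Walk (E (K ─ single p q)) p q m → MeetOnly p q l m → Internal K p q
  disjoint-walks⇒internal {K} {p} {q} {l} {m} s irr pq wl wm d with induced-cycle s irr pq wl | induced-cycle s irr pq wm
  ... | C₁ , i₁ , c₁ , s₁ , _ , _ , w , w∈ , w≢p , w≢q | C₂ , i₂ , c₂ , s₂ , _ =
    C₁ , C₂ , i₁ , i₂ , c₁ , c₂ , w , inj₁ (w∈ , λ w∈′ → off (∈-snoc⁻ l (s₁ w∈)) (∈-snoc⁻ m (s₂ w∈′)))
    where
    off : w ∈ l ⊎ w ≡ q → w ∈ m ⊎ w ≡ q → ⊥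
    off (inj₂ e) _ = w≢q e
    off _ (inj₂ e) = w≢q e
    off (inj₁ a) (inj₁ b) = [ w≢p , w≢q ]′ (d a b)

  meetOnly-reverse : ∀ {p q : Fin n} {l m l′ m′} → l′ ++ [ p ] ≡ reverse (l ++ [ q ]) → m′ ++ [ p ] ≡ reverse (m ++ [ q ]) →
    MeetOnly p q l m → MeetOnly q p l′ m′
  meetOnly-reverse {l = l} {m} e₁ e₂ d a b
    with ∈-snoc⁻ l (reverse-walk-∈ {l = l} e₁ (∈-++⁺ˡ a)) | ∈-snoc⁻ m (reverse-walk-∈ {l = m} e₂ (∈-++⁺ˡ b))
  ... | inj₂ e | _ = inj₁ e
  ... | inj₁ _ | inj₂ e = inj₁ e
  ... | inj₁ x | inj₁ y = [ inj₂ , inj₁ ]′ (d x y)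

  Deleted : List (Fin n × Fin n) → Fin n → Fin n → Set
  Deleted es a b = (a , b) ∈ es ⊎ (b , a) ∈ es

  single-cons : ∀ {u v a b : Fin n} {es} → Mem (single u v) a b → Deleted ((u , v) ∷ es) a b
  single-cons {u} {v} {a} {b} m with mem-single⁻ u v a b m
  ... | inj₁ (refl , refl) = inj₁ (here refl)
  ... | inj₂ (refl , refl) = inj₂ (here refl)

  -- `H` is only assumed to lie in `K` and to miss every edge of the sequence. This is preserved by
  -- passing to the tail, and at the moment pq comes up both walks avoid pq.
  deleted-no-disjoint-walks′ : ∀ {K H : Graph n} es {p q l m} → SymG K → Loopless K → ValidSeq K es →
    (∀ {a b} → E H a b → E K a b × ¬ Deleted es a b) → (p , q) ∈ es →
    Walk (E H) p q l → Walk (E H) p q m → MeetOnly p q l m → ⊥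
  deleted-no-disjoint-walks′ {K} {H} ((u , v) ∷ es) s irr ((e , ¬int) , _ , _) sub (here refl) wl wm d =
    ¬int (disjoint-walks⇒internal s irr e (mapʷ f wl) (mapʷ f wm) d)
    where
    f : ∀ {a b} → E H a b → E (K ─ single u v) a b
    f {a} {b} h = ─⁺ K (single u v) (proj₁ (sub h)) (λ m → proj₂ (sub h) (single-cons {u} {v} m))
  deleted-no-disjoint-walks′ {K} {H} ((u , v) ∷ es) s irr (_ , _ , val) sub (there i) =
    deleted-no-disjoint-walks′ es (─-sym (single u v) s) (λ a e → irr a (proj₁ (─⁻ K (single u v) e))) val
      (λ h → ─⁺ K (single u v) (proj₁ (sub h)) (λ m → proj₂ (sub h) (single-cons {u} {v} m)) ,
             λ d → proj₂ (sub h) ([ (λ z → inj₁ (there z)) , (λ z → inj₂ (there z)) ]′ d)) i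

  deleted-no-disjoint-walks : ∀ {G : Graph n} {A p q l m} → SymG G → Loopless G → Iterative G A → Mem A p q →
    Walk (E (G ─ A)) p q l → Walk (E (G ─ A)) p q m → MeetOnly p q l m → ⊥
  deleted-no-disjoint-walks {G} {A} {p} {q} {l} {m} s irr (es , val , iff) mem wl wm d with Equivalence.to (iff p q) mem
  ... | inj₁ i = deleted-no-disjoint-walks′ es s irr val sub i wl wm d
    where
    sub : ∀ {a b} → E (G ─ A) a b → E G a b × ¬ Deleted es a b
    sub h = proj₁ (─⁻ G A h) , λ z → proj₂ (─⁻ G A h) (Equivalence.from (iff _ _) z)
  ... | inj₂ i with reverseʷ (λ {a} {b} → ─-sym A s a b) wl | reverseʷ (λ {a} {b} → ─-sym A s a b) wm
  ...   | l′ , wl′ , e₁ | m′ , wm′ , e₂ =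
    deleted-no-disjoint-walks′ es s irr val sub i wl′ wm′ (meetOnly-reverse {l = l} {m} e₁ e₂ d)
    where
    sub : ∀ {a b} → E (G ─ A) a b → E G a b × ¬ Deleted es a b
    sub h = proj₁ (─⁻ G A h) , λ z → proj₂ (─⁻ G A h) (Equivalence.from (iff _ _) z)

  within-walk : ∀ {G : Graph n} {X : Fin n → Set} {u v l} → Walk (E G) u v l → (∀ {w} → w ∈ l ++ [ v ] → X w) → Star (Within G X) u v
  within-walk p f = toStar (mapWith p (λ a b e → e , f a , f b))

  theta-walks : ∀ {G : Graph n} {p q l₁ l₂ l₃} → TwoTreeLike G → p ≢ q →
    Walk (E G) p q l₁ → Walk (E G) p q l₂ → Walk (E G) p q l₃ →
    MeetOnly p q l₁ l₂ → MeetOnly p q l₂ l₃ → MeetOnly p q l₁ l₃ → E G p q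
  theta-walks {G} {p} {q} {l₁} {l₂} {l₃} t ne w₁ w₂ w₃ d₁₂ d₂₃ d₁₃ =
    TwoTreeLike.theta t p q (_∈ l₁ ++ [ q ]) (_∈ l₂ ++ [ q ]) (_∈ l₃ ++ [ q ]) ne (off l₁ l₂ d₁₂) (off l₂ l₃ d₂₃) (off l₁ l₃ d₁₃)
      (within-walk w₁ (λ x → x)) (within-walk w₂ (λ x → x)) (within-walk w₃ (λ x → x))
    where
    off : ∀ l m → MeetOnly p q l m → DisjointOff p q (_∈ l ++ [ q ]) (_∈ m ++ [ q ])
    off l m d w a b with ∈-snoc⁻ l a | ∈-snoc⁻ m b
    ... | inj₂ e | _ = inj₂ e
    ... | _ | inj₂ e = inj₂ e
    ... | inj₁ x | inj₁ y = d x y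

  -- The edge xy closes the walk to a cycle; the second arc runs back from p to x, across xy, and
  -- back from y to q.
  other-arc : ∀ {R : Fin n → Fin n → Set} → (∀ {a b} → R a b → R b a) → ∀ {x y p q l m r} →
    Walk R x p l → Walk R p q m → Walk R q y r → R x y → Unique ((l ++ m ++ r) ++ [ y ]) →
    ∃ λ k → Walk R p q k × MeetOnly p q m k × (∀ {w} → w ∈ k → w ≡ p ⊎ w ∈ (l ++ m ++ r) ++ [ y ])
  other-arc s {x} {y} {p} {q} {l} {m} {r} wl wm wr xy un with reverseʷ s wl | reverseʷ s wr
  ... | l′ , wl′ , e₁ | r′ , wr′ , e₂ = l′ ++ x ∷ r′ , wl′ ++ʷ (xy ∷ wr′) , meet , inside
    where
    eq : (l ++ m ++ r) ++ [ y ] ≡ l ++ (m ++ (r ++ [ y ]))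
    eq = trans (++-assoc l (m ++ r) [ y ]) (cong (l ++_) (++-assoc m r [ y ]))
    un₁ = unique-++⁻ l (subst Unique eq un)
    un₂ = unique-++⁻ m (proj₁ (proj₂ un₁))
    where′ : ∀ {w} → w ∈ l′ ++ x ∷ r′ → w ∈ l ++ [ p ] ⊎ w ∈ r ++ [ y ]
    where′ i with ∈-++⁻ l′ i
    ... | inj₁ a = inj₁ (reverse-walk-∈ {l = l} e₁ (∈-++⁺ˡ a))
    ... | inj₂ (here refl) = inj₁ (start∈ wl)
    ... | inj₂ (there a) = inj₂ (reverse-walk-∈ {l = r} e₂ (∈-++⁺ˡ a))
    meet : MeetOnly p q m (l′ ++ x ∷ r′)
    meet a b with where′ b
    ... | inj₂ c = ⊥-elim (proj₂ (proj₂ un₂) a c)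
    ... | inj₁ c with ∈-snoc⁻ l c
    ...   | inj₁ c′ = ⊥-elim (proj₂ (proj₂ un₁) c′ (∈-++⁺ˡ a))
    ...   | inj₂ e = inj₁ e
    inside : ∀ {w} → w ∈ l′ ++ x ∷ r′ → w ≡ p ⊎ w ∈ (l ++ m ++ r) ++ [ y ]
    inside b with where′ b
    ... | inj₂ c = inj₂ (subst (_ ∈_) (sym eq) (∈-++⁺ʳ l (∈-++⁺ʳ m c)))
    ... | inj₁ c with ∈-snoc⁻ l c
    ...   | inj₁ c′ = inj₂ (∈-++⁺ˡ (∈-++⁺ˡ c′))
    ...   | inj₂ e = inj₁ e

  -- An ear of G attached to a cycle of G ─ A at p and q forces the chord pq, and the chord cannot have been deleted.
  ear⇒chord : ∀ {G : Graph n} {A} → TwoTreeLike G → Iterative G A → ∀ {x y p q l m r k} → p ≢ q →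
    Walk (E (G ─ A)) x p l → Walk (E (G ─ A)) p q m → Walk (E (G ─ A)) q y r → E (G ─ A) x y → Unique ((l ++ m ++ r) ++ [ y ]) →
    Walk (E G) p q k → (∀ {w} → w ∈ k → w ∈ (l ++ m ++ r) ++ [ y ] → w ≡ p ⊎ w ≡ q) → E (G ─ A) p q
  ear⇒chord {G} {A} t it {p = p} {q} {l} {m} {r} ne wl wm wr xy un wk off
    with other-arc (λ {a} {b} → ─-sym A (TwoTreeLike.symmetric t) a b) wl wm wr xy un
  ... | l₂ , w₂ , meet , inside = ─⁺ G A
      (theta-walks t ne (mapʷ toG wm) (mapʷ toG w₂) wk meet
        (λ a b → [ inj₁ , off b ]′ (inside a))
        (λ a b → off b (∈-++⁺ˡ (∈-++⁺ʳ l (∈-++⁺ˡ a)))))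
      (λ mem → deleted-no-disjoint-walks {G} {A} (TwoTreeLike.symmetric t) (TwoTreeLike.loopless t) it mem wm w₂ meet)
    where
    toG : ∀ {a b} → E (G ─ A) a b → E G a b
    toG e = proj₁ (─⁻ G A e)

-- Ears

  -- The list holds exactly the inner vertices, and `proper` makes it nonempty: an ear is never the
  -- bare edge xy.
  record Ear (K : Graph n) (x y : Fin n) (l : List (Fin n)) : Set where
    constructor ear
    field
      {next} : Fin n
      step : E K x next
      walk : Walk (E K) next y l
      proper : next ≢ y
      simple : Unique (x ∷ l ++ [ y ])

  ear-∉ˡ : ∀ {K x y l} → Ear K x y l → ¬ x ∈ l
  ear-∉ˡ (ear _ _ _ (a ∷ _)) m = All.lookup a (∈-++⁺ˡ m) refl

  ear-∉ʳ : ∀ {K x y l} → Ear K x y l → ¬ y ∈ l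
  ear-∉ʳ {l = l} (ear _ _ _ (_ ∷ u)) m = proj₂ (proj₂ (unique-++⁻ l u)) m (here refl)

  mapEar : ∀ {K K′ : Graph n} {x y l} → (∀ {a b} → E K a b → E K′ a b) → Ear K x y l → Ear K′ x y l
  mapEar f (ear s w p u) = ear (f s) (mapʷ f w) p u

  flipEar : ∀ {K : Graph n} {x y l} → SymG K → Ear K x y l → Ear K y x (reverse l)
  flipEar {K} {x} {y} {l} s e@(ear {z} st w p un@(a ∷ u)) with unsnoc w p
  ... | t , l′ , w′ , ty , refl with reverseʷ (λ {a} {b} → s a b) w′
  ...   | l″ , w″ , eq = ear (s _ _ ty) (subst (Walk (E K) t x) eq (w″ ++ʷ (s _ _ st ∷ []))) t≢x un′
    where
    t≢x : t ≢ x
    t≢x refl = ear-∉ˡ e (∈-last l′)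
    un′ : Unique (y ∷ reverse (l′ ++ [ t ]) ++ [ x ])
    un′ = All.tabulate (λ {w} m e₁ → case ∈-snoc⁻ (reverse (l′ ++ [ t ])) m of λ
            { (inj₁ m′) → ear-∉ʳ e (reverse⁻ (subst (_∈ reverse (l′ ++ [ t ])) (sym e₁) m′))
            ; (inj₂ e₂) → All.lookup a (∈-last (l′ ++ [ t ])) (trans (sym e₂) (sym e₁)) })
          ∷ unique-++⁺ (unique-reverse (proj₁ (unique-++⁻ (l′ ++ [ t ]) u))) ([] ∷ [])
            λ { m (here refl) → ear-∉ˡ e (reverse⁻ m) }

  OffPair : Fin n → Fin n → Fin n → Set
  OffPair x y w = w ≢ x × w ≢ y

  ear-off : ∀ {K x y l w} → Ear K x y l → w ∈ l → OffPair x y w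
  ear-off e m = (λ { refl → ear-∉ˡ e m }) , λ { refl → ear-∉ʳ e m }

  ear-handle : ∀ {G : Graph n} {x y l} → SymG G → (e : Ear G x y l) → Σ (Handle G x y (_∈ l)) λ h → Handle.first h ≡ Ear.next e
  ear-handle s e@(ear {z} st w p _) with unsnoc w p
  ... | t , l′ , w′ , ty , refl = handle z t st (s _ _ ty) (ear-∉ˡ e) (ear-∉ʳ e) (start∈ w′) (∈-last l′) (within-walk w′ (λ x → x)) , refl

  ear-connected : ∀ {G : Graph n} {x y l c} → SymG G → (e : Ear G x y l) → c ∈ l → Star (Within G (OffPair x y)) (Ear.next e) c
  ear-connected s e@(ear {z} st w p _) m with split w (∈-++⁺ˡ m)
  ... | l₁ , l₂ , w₁ , [] , refl = ⊥-elim (ear-∉ʳ e m)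
  ... | l₁ , c ∷ l₂ , w₁ , _ ∷ _ , refl = within-walk w₁ λ a → ear-off e (case ∈-snoc⁻ l₁ a of λ
          { (inj₁ b) → ∈-++⁺ˡ b ; (inj₂ refl) → ∈-++⁺ʳ l₁ (here refl) })

  -- The link may start and end anywhere on the two ears; running along them to their first vertices
  -- stays off x and y and brings it into the form of `noCross`.
  crossing-ears : ∀ {G : Graph n} {x y l m c d} → TwoTreeLike G → E G x y → Ear G x y l → Ear G x y m →
    (∀ {w} → w ∈ l → w ∈ m → ⊥) → c ∈ l → d ∈ m → Star (Within G (OffPair x y)) c d → ⊥
  crossing-ears {G} {x} {y} {l} {m} t xy el em disj c∈ d∈ star =
    TwoTreeLike.noCross t x y (_∈ l) (_∈ m) xy (proj₁ hl) (proj₁ hm) (λ w → disj)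
      (subst₂ (Star (Within G (OffPair x y))) (sym (proj₂ hl)) (sym (proj₂ hm)) (ear-connected s el c∈ ◅◅ star ◅◅ reverse⋆ (within-sym s) (ear-connected s em d∈)))
    where
    s = TwoTreeLike.symmetric t
    hl = ear-handle s el
    hm = ear-handle s em

  closed : List (Fin n) → List (Fin n)
  closed [] = []
  closed (x ∷ r) = x ∷ r ++ [ x ]

  open-cycle : ∀ {K : Graph n} C {u v} → IsCycle K C → Consec (closed C) u v →
    ∃ λ l → Walk (E K) v u l × Unique (l ++ [ u ]) × (∀ {w} → w ∈ l ++ [ u ] → w ∈ C) × (∀ {w} → w ∈ C → w ∈ l ++ [ u ]) × 2 ≤ length l ×
      E K u v × (∀ {a b} → Consec (closed C) a b → (a ≡ u × b ≡ v) ⊎ Consec (l ++ [ u ]) a b)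
  open-cycle {K} (x ∷ r) {u} {v} (le , un , lk) c with consec-split⁻ (fromLinked r lk) c
  ... | l₁ , l₂ , w₁ , uv , w₂ , eq = l₂ ++ l₁ , w₂ ++ʷ w₁ , un′ , to , from , len , uv , con
    where
    un₁ = unique-++⁻ l₁ (subst Unique eq un)
    u∉l₂ : ∀ {w} → w ∈ l₂ → w ≡ u → ⊥
    u∉l₂ m refl with proj₁ (proj₂ un₁)
    ... | a ∷ _ = All.lookup a m refl
    un₂ : Unique l₂
    un₂ with proj₁ (proj₂ un₁)
    ... | _ ∷ b = b
    un′ : Unique ((l₂ ++ l₁) ++ [ u ])
    un′ = unique-++⁺ (unique-++⁺ un₂ (proj₁ un₁) (λ a b → proj₂ (proj₂ un₁) b (there a))) ([] ∷ [])
      λ { a (here refl) → [ (λ b → u∉l₂ b refl) , (λ b → proj₂ (proj₂ un₁) b (here refl)) ]′ (∈-++⁻ l₂ a) }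
    to : ∀ {w} → w ∈ (l₂ ++ l₁) ++ [ u ] → w ∈ x ∷ r
    to m with ∈-snoc⁻ (l₂ ++ l₁) m
    ... | inj₂ refl = subst (_ ∈_) (sym eq) (∈-++⁺ʳ l₁ (here refl))
    ... | inj₁ m′ with ∈-++⁻ l₂ m′
    ...   | inj₁ a = subst (_ ∈_) (sym eq) (∈-++⁺ʳ l₁ (there a))
    ...   | inj₂ a = subst (_ ∈_) (sym eq) (∈-++⁺ˡ a)
    from : ∀ {w} → w ∈ x ∷ r → w ∈ (l₂ ++ l₁) ++ [ u ]
    from m with ∈-++⁻ l₁ (subst (_ ∈_) eq m)
    ... | inj₁ a = ∈-++⁺ˡ (∈-++⁺ʳ l₂ a)
    ... | inj₂ (here refl) = ∈-last (l₂ ++ l₁)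
    ... | inj₂ (there a) = ∈-++⁺ˡ (∈-++⁺ˡ a)
    len : 2 ≤ length (l₂ ++ l₁)
    len = ℕₚ.≤-trans le (ℕₚ.≤-reflexive (ℕₚ.suc-injective (trans (cong length eq) (trans (length-++ l₁)
      (trans (ℕₚ.+-suc (length l₁) (length l₂)) (cong suc (trans (ℕₚ.+-comm (length l₁) (length l₂)) (sym (length-++ l₂)))))))))
    con : ∀ {a b} → Consec (x ∷ r ++ [ x ]) a b → (a ≡ u × b ≡ v) ⊎ Consec ((l₂ ++ l₁) ++ [ u ]) a b
    con {a} {b} d with consec-walk⁻ w₁ (uv ∷ w₂) (subst (λ z → Consec (z ++ [ x ]) a b) eq d)
    ... | inj₁ e = inj₂ (subst (λ z → Consec z a b) (sym (++-assoc l₂ l₁ [ u ])) (consec-++ʳ l₂ e))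
    ... | inj₂ e with consec-walk⁻ (uv ∷ []) w₂ e
    ...   | inj₁ here = inj₁ (refl , refl)
    ...   | inj₁ (there (there ()))
    ...   | inj₂ f = inj₂ (consec-walkˡ l₂ w₁ f)

-- Extremal elements

module _ {A : Set} (P : A → Set) (f : A → ℕ) where

  -- Descent on an upper bound for the value, asking at each stage, under the double negation,
  -- whether a smaller value is attained.
  ¬¬-minimum : ∃ P → ¬ ¬ ∃ λ a → P a × ∀ b → P b → f a ≤ f b
  ¬¬-minimum (a , Pa) = go (f a) a Pa ℕₚ.≤-refl
    where
    go : ∀ k a → P a → f a ≤ k → ¬ ¬ ∃ λ a → P a × ∀ b → P b → f a ≤ f b
    go k a Pa le c = ¬¬-excluded-middle {A = ∃ λ b → P b × f b < f a} λ
      { (no ¬b) → c (a , Pa , λ b Pb → ℕₚ.≮⇒≥ (λ lt → ¬b (b , Pb , lt)))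
      ; (yes (b , Pb , lt)) → down k le b Pb lt }
      where
      down : ∀ k → f a ≤ k → ∀ b → P b → f b < f a → ⊥
      down zero le b Pb lt = ℕₚ.n≮0 (ℕₚ.<-≤-trans lt le)
      down (suc k) le b Pb lt = go k b Pb (ℕₚ.≤-pred (ℕₚ.<-≤-trans lt le)) c

¬¬-maximum : ∀ {A : Set} (P : A → Set) (f : A → ℕ) N → (∀ a → f a ≤ N) → ∃ P → ¬ ¬ ∃ λ a → P a × ∀ b → P b → f b ≤ f a
¬¬-maximum P f N bound ex c = ¬¬-minimum P (λ a → N ∸ f a) ex λ (a , Pa , min) →
  c (a , Pa , λ b Pb → ℕₚ.≮⇒≥ (λ lt → ℕₚ.<-irrefl refl (ℕₚ.<-≤-trans (ℕₚ.∸-monoʳ-< lt (bound b)) (min b Pb))))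

⊆-length⇒⊇ : ∀ {A : Set} → (∀ (a b : A) → Dec (a ≡ b)) → ∀ {xs ys : List A} → Unique xs → (∀ {w} → w ∈ xs → w ∈ ys) →
  length ys ≤ length xs → ∀ {w} → w ∈ ys → w ∈ xs
⊆-length⇒⊇ _≟′_ {xs} {ys} un sub le {w} m with _∈?_ _≟′_ w xs
... | yes p = p
... | no ¬p = ⊥-elim (ℕₚ.<-irrefl refl (ℕₚ.<-≤-trans
      (unique-⊆-length {xs = w ∷ xs} {ys} (All.tabulate (λ i e → ¬p (subst (_∈ xs) (sym e) i)) ∷ un)
        λ { (here refl) → m ; (there i) → sub i }) le))

-- Blocks

module _ {n : ℕ} where

  inE-sym : ∀ (B : Subgraph {n}) {a b} → InE B a b → InE B b a
  inE-sym B {a} {b} = ∨-swap {es B a b}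

  AvoidingIn : Subgraph {n} → Fin n → Fin n → Fin n → Set
  AvoidingIn B x p q = InE B p q × p ≢ x × q ≢ x

  -- `TwoConnected` without the demand for three vertices: a single edge qualifies, and blocks can
  -- be grown from it by adding ears.
  Biconnected : Subgraph {n} → Set
  Biconnected B = (∀ a b → InV B a → InV B b → Star (InE B) a b)
    × (∀ x a b → InV B x → InV B a → InV B b → a ≢ x → b ≢ x → Star (AvoidingIn B x) a b)

  module AddEar {H : Graph n} (sy : SymG H) (B : Subgraph {n}) (sub : IsSubgraphOf B H) (bi : Biconnected B)
    {z₁ z₂ l} (V₁ : InV B z₁) (V₂ : InV B z₂) (e : Ear H z₁ z₂ l) where

    private
      L : List (Fin n)
      L = z₁ ∷ l ++ [ z₂ ]

      onL : Fin n → Bool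
      onL a = ⌊ _∈?_ _≟_ a L ⌋

      W : Walk (E H) z₁ z₂ (z₁ ∷ l)
      W = Ear.step e ∷ Ear.walk e

      next∈ : Ear.next e ∈ l
      next∈ with Ear.walk e | Ear.proper e
      ... | [] | p = ⊥-elim (p refl)
      ... | _ ∷ _ | _ = here refl

    -- All edges of `H` between vertices of the ear are added, not just those of the path. The extra
    -- edges cannot hurt connectivity, and membership needs no record of which vertices are
    -- consecutive.
    B⁺ : Subgraph {n}
    B⁺ = record { vs = λ w → vs B w ∨ onL w ; es = λ a b → es B a b ∨ (H a b ∧ (onL a ∧ onL b)) }

    private
      V-old : ∀ {w} → InV B w → InV B⁺ w
      V-old = ∨-left

      V-new : ∀ {w} → w ∈ L → InV B⁺ w
      V-new {w} m = ∨-right {vs B w} (true-⌊⌋ m)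

      E-old : ∀ {a b} → InE B a b → InE B⁺ a b
      E-old {a} {b} i with ∨-split {es B a b} i
      ... | inj₁ p = ∨-left (∨-left p)
      ... | inj₂ p = ∨-right {es B⁺ a b} (∨-left p)

      E-new : ∀ {a b} → a ∈ L → b ∈ L → E H a b → InE B⁺ a b
      E-new {a} {b} a∈ b∈ h = ∨-left (∨-right {es B a b} (∧-join h (∧-join {onL a} (true-⌊⌋ a∈) (true-⌊⌋ b∈))))

      half : ∀ {a b} → es B⁺ a b ≡ true → E H a b × InV B⁺ a × InV B⁺ b
      half {a} {b} i with ∨-split {es B a b} i
      ... | inj₁ p = let h , va , vb = sub a b (∨-left p) in h , V-old va , V-old vb
      ... | inj₂ p = let h , q = ∧-split {H a b} p ; r , s = ∧-split {onL a} q in h , V-new (⌊⌋-true r) , V-new (⌊⌋-true s)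

      L-split : ∀ {w} → w ∈ L → ∃₂ λ l₁ l₂ → Walk (E H) z₁ w l₁ × Walk (E H) w z₂ l₂ × L ≡ l₁ ++ l₂ ++ [ z₂ ]
      L-split m with split W m
      ... | l₁ , l₂ , w₁ , w₂ , eq = l₁ , l₂ , w₁ , w₂ , trans (cong (_++ [ z₂ ]) eq) (++-assoc l₁ l₂ [ z₂ ])

      prefix∈ : ∀ {w l₁ l₂} → Walk (E H) w z₂ l₂ → L ≡ l₁ ++ l₂ ++ [ z₂ ] → ∀ {a} → a ∈ l₁ ++ [ w ] → a ∈ L
      prefix∈ {l₁ = l₁} w₂ eq a∈ with ∈-snoc⁻ l₁ a∈
      ... | inj₁ p = subst (_ ∈_) (sym eq) (∈-++⁺ˡ p)
      ... | inj₂ refl = subst (_ ∈_) (sym eq) (∈-++⁺ʳ l₁ (start∈ w₂))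

      toZ₁ : ∀ {w} → w ∈ L → Star (InE B⁺) w z₁
      toZ₁ m with L-split m
      ... | l₁ , l₂ , w₁ , w₂ , eq = reverse⋆ (inE-sym B⁺) (toStar (mapWith w₁ λ a b h →
              E-new (prefix∈ {l₁ = l₁} w₂ eq a) (prefix∈ {l₁ = l₁} w₂ eq b) h))

      anchor : ∀ {w} → InV B⁺ w → ∃ λ z → InV B z × Star (InE B⁺) w z
      anchor {w} i with ∨-split {vs B w} i
      ... | inj₁ p = w , p , ε
      ... | inj₂ p = z₁ , V₁ , toZ₁ (⌊⌋-true p)

      avoiding-sym : ∀ {x a b} → AvoidingIn B⁺ x a b → AvoidingIn B⁺ x b a
      avoiding-sym (p , q , r) = inE-sym B⁺ p , r , q

      -- The ear is simple, so x misses one of the two parts into which w divides it, and that part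
      -- leads to an end of the ear in `B`.
      anchorOff : ∀ {x w} → InV B⁺ w → w ≢ x → ∃ λ z → InV B z × z ≢ x × Star (AvoidingIn B⁺ x) w z
      anchorOff {x} {w} i w≢x with ∨-split {vs B w} i
      ... | inj₁ p = w , p , w≢x , ε
      ... | inj₂ p with L-split (⌊⌋-true p)
      ...   | l₁ , l₂ , w₁ , w₂ , eq with _∈?_ _≟_ x l₁
      ...     | yes x∈ = z₂ , V₂ , off (∈-last l₂) , toStar (mapWith w₂ λ a b h →
                  E-new (in₂ a) (in₂ b) h , off a , off b)
        where
        in₂ : ∀ {a} → a ∈ l₂ ++ [ z₂ ] → a ∈ L
        in₂ m = subst (_ ∈_) (sym eq) (∈-++⁺ʳ l₁ m)
        off : ∀ {a} → a ∈ l₂ ++ [ z₂ ] → a ≢ x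
        off m refl = proj₂ (proj₂ (unique-++⁻ l₁ (subst Unique eq (Ear.simple e)))) x∈ m
      ...     | no x∉ = z₁ , V₁ , off (start∈ w₁) , reverse⋆ avoiding-sym (toStar (mapWith w₁ λ a b h →
                  E-new (prefix∈ {l₁ = l₁} w₂ eq a) (prefix∈ {l₁ = l₁} w₂ eq b) h , off a , off b))
        where
        off : ∀ {a} → a ∈ l₁ ++ [ w ] → a ≢ x
        off m refl = [ x∉ , (λ { refl → w≢x refl }) ]′ (∈-snoc⁻ l₁ m)

      -- The removed vertex may lie on the new ear outside `B`; plain connectedness of `B` is then
      -- the right tool.
      coreOff : ∀ {x a b} → InV B a → InV B b → a ≢ x → b ≢ x → Star (AvoidingIn B⁺ x) a b
      coreOff {x} {a} {b} va vb a≢x b≢x with vs B x in eq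
      ... | true = gmap (λ z → z) (λ (p , q , r) → E-old p , q , r) (proj₂ bi x a b eq va vb a≢x b≢x)
      ... | false = gmap (λ z → z) (λ {p} {q} i → E-old i , off (proj₁ (proj₂ (sub p q i))) , off (proj₂ (proj₂ (sub p q i)))) (proj₁ bi a b va vb)
        where
        off : ∀ {p} → InV B p → p ≢ x
        off i refl = case trans (sym eq) i of λ ()

    B⁺-sub : IsSubgraphOf B⁺ H
    B⁺-sub a b i with ∨-split {es B⁺ a b} i
    ... | inj₁ p = half p
    ... | inj₂ p = let h , vb , va = half p in sy _ _ h , va , vb

    B⁺-twoConnected : TwoConnected B⁺
    B⁺-twoConnected = (z₁ , Ear.next e , z₂ , V-old V₁ , V-new (there (∈-++⁺ˡ next∈)) , V-old V₂ ,
        ≢-sym (proj₁ (ear-off e next∈)) , proj₂ (ear-off e next∈) , z₁≢z₂ (Ear.simple e)) , conn , connOff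
      where
      z₁≢z₂ : Unique (z₁ ∷ l ++ [ z₂ ]) → z₁ ≢ z₂
      z₁≢z₂ (a ∷ _) = All.lookup a (∈-last l)
      conn : ∀ a b → InV B⁺ a → InV B⁺ b → Star (InE B⁺) a b
      conn a b va vb with anchor va | anchor vb
      ... | c , vc , s | d , vd , s′ = s ◅◅ gmap (λ z → z) E-old (proj₁ bi c d vc vd) ◅◅ reverse⋆ (inE-sym B⁺) s′
      connOff : ∀ x a b → InV B⁺ x → InV B⁺ a → InV B⁺ b → a ≢ x → b ≢ x → Star (AvoidingIn B⁺ x) a b
      connOff x a b _ va vb ax bx with anchorOff va ax | anchorOff vb bx
      ... | c , vc , cx , s | d , vd , dx , s′ = s ◅◅ coreOff vc vd cx dx ◅◅ reverse⋆ avoiding-sym s′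

    B⊑B⁺ : B ⊑ B⁺
    B⊑B⁺ = (λ w → V-old) , λ a b → E-old

    next∈B⁺ : InV B⁺ (Ear.next e)
    next∈B⁺ = V-new (there (∈-++⁺ˡ next∈))

  module _ {H : Graph n} (sy : SymG H) {B : Subgraph {n}} (comp : TwoConnComp H B) where

    -- Made simple, such a walk gives an ear of the block, and adding it contradicts maximality.
    no-outside-walk : ∀ {z₁ z₂ s t l} → z₁ ≢ z₂ → InV B z₁ → InV B z₂ → E H z₁ s → Walk (E H) s t l → E H t z₂ →
      (∀ {w} → w ∈ l ++ [ t ] → ¬ InV B w) → ⊥
    no-outside-walk {z₁} {z₂} {s} {t} {l} ne V₁ V₂ e₁ w e₂ out with simplify _≟_ w
    ... | l′ , w′ , un , _ , sub = out (start∈ w) (proj₁ (proj₂ (proj₂ comp) B⁺ B⁺-sub B⁺-twoConnected B⊑B⁺) s next∈B⁺)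
      where
      out′ : ∀ {w} → w ∈ l′ ++ [ t ] → ¬ InV B w
      out′ m with ∈-snoc⁻ l′ m
      ... | inj₁ m′ = out (∈-++⁺ˡ (sub m′))
      ... | inj₂ refl = out (∈-last l)
      simple′ : Unique (z₁ ∷ (l′ ++ [ t ]) ++ [ z₂ ])
      simple′ = All.tabulate (λ m e → case ∈-snoc⁻ (l′ ++ [ t ]) m of λ
                  { (inj₁ m′) → out′ m′ (subst (InV B) e V₁) ; (inj₂ e′) → ne (trans e e′) })
                ∷ unique-++⁺ un ([] ∷ []) λ { m (here refl) → out′ m V₂ }
      ear′ : Ear H z₁ z₂ (l′ ++ [ t ])
      ear′ = ear e₁ (w′ ++ʷ (e₂ ∷ [])) (λ { refl → out (start∈ w) V₂ }) simple′
      open AddEar {H = H} sy B (proj₁ comp) (proj₂ (proj₁ (proj₂ comp))) V₁ V₂ ear′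

    inV? : ∀ w → Dec (InV B w)
    inV? w = vs B w Bool.≟ true

    -- Going back along one walk and forth along the other would join two different points of entry
    -- outside the block.
    gate-unique : ∀ {s u z l m} → Walk (E H) s u l → (∀ {w} → w ∈ l → ¬ InV B w) → InV B u →
      Walk (E H) s z m → (∀ {w} → w ∈ m → ¬ InV B w) → InV B z → z ≡ u
    gate-unique {s} {u} {z} {l} {m} wl ol Vu wm om Vz with z ≟ u | s ≟ u | s ≟ z
    ... | yes e | _ | _ = e
    ... | no ne | yes refl | _ with wm
    ...   | [] = refl
    ...   | _ ∷ _ = ⊥-elim (om (here refl) Vu)
    gate-unique {s} {u} {z} {l} {m} wl ol Vu wm om Vz | no ne | no _ | yes refl with wl
    ...   | [] = refl
    ...   | _ ∷ _ = ⊥-elim (ol (here refl) Vz)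
    gate-unique {s} {u} {z} {l} {m} wl ol Vu wm om Vz | no ne | no su | no sz with unsnoc wl su | unsnoc wm sz
    ... | t₁ , l′ , w₁ , e₁ , refl | t₂ , m′ , w₂ , e₂ , refl with reverseʷ (λ {a} {b} → sy a b) w₁
    ...   | r , wr , eq = ⊥-elim (no-outside-walk (≢-sym ne) Vu Vz (sy _ _ e₁) (wr ++ʷ w₂) e₂ out)
      where
      out : ∀ {w} → w ∈ (r ++ m′) ++ [ t₂ ] → ¬ InV B w
      out i with ∈-++⁻ r (subst (_ ∈_) (++-assoc r m′ [ t₂ ]) i)
      ... | inj₁ j = ol (reverse-walk-∈ {l = l′} eq (∈-++⁺ˡ j))
      ... | inj₂ j = om j

    -- From a vertex of the ear outside the block, both directions would enter the block at the same
    -- vertex, which a simple ear cannot visit twice.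
    ear⊆block : ∀ {u v l} → InV B u → InV B v → Ear H u v l → ∀ {w} → w ∈ l → InV B w
    ear⊆block {u} {v} {l} Vu Vv e {w} w∈ with inV? w
    ... | yes p = p
    ... | no w∉ with split (Ear.step e ∷ Ear.walk e) (there (∈-++⁺ˡ w∈))
    ...   | l₁ , l₂ , w₁ , w₂ , eq with reverseʷ (λ {a} {b} → sy a b) w₁
    ...     | r , wr , eqr with firstHit inV? wr Vu | firstHit inV? w₂ Vv
    ...       | p , r₁ , r₂ , wr₁ , wr₂ , refl , Vp , or | q , m₁ , m₂ , wm₁ , wm₂ , refl , Vq , om =
              ⊥-elim (proj₂ (proj₂ (unique-++⁻ l₁ (subst Unique eq′ (Ear.simple e)))) p∈ q∈)
      where
      eq′ : u ∷ l ++ [ v ] ≡ l₁ ++ ((m₁ ++ m₂) ++ [ v ])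
      eq′ = trans (cong (_++ [ v ]) eq) (++-assoc l₁ (m₁ ++ m₂) [ v ])
      q∈ : q ∈ (m₁ ++ m₂) ++ [ v ]
      q∈ = subst (q ∈_) (sym (++-assoc m₁ m₂ [ v ])) (∈-++⁺ʳ m₁ (start∈ wm₂))
      p∈ : q ∈ l₁
      p∈ with ∈-snoc⁻ l₁ (reverse-walk-∈ {l = l₁} eqr (subst (p ∈_) (sym (++-assoc r₁ r₂ [ u ])) (∈-++⁺ʳ r₁ (start∈ wr₂))))
      ... | inj₁ i = subst (_∈ l₁) (sym (gate-unique wr₁ or Vp wm₁ om Vq)) i
      ... | inj₂ refl = ⊥-elim (w∉ Vp)

  private
    allPairs : List (Fin n × Fin n)
    allPairs = cartesianProduct (allFin n) (allFin n)

    V? : (B : Subgraph {n}) (w : Fin n) → Dec (InV B w)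
    V? B w = vs B w Bool.≟ true

    E? : (B : Subgraph {n}) (p : Fin n × Fin n) → Dec (InE B (proj₁ p) (proj₂ p))
    E? B (a , b) = (es B a b ∨ es B b a) Bool.≟ true

    sizeV sizeE : Subgraph {n} → ℕ
    sizeV B = length (filter (V? B) (allFin n))
    sizeE B = length (filter (E? B) allPairs)

    ⊑-size : ∀ {B B′} → B ⊑ B′ → sizeV B′ + sizeE B′ ≤ sizeV B + sizeE B → B′ ⊑ B
    ⊑-size {B} {B′} (sv , se) le =
      (λ w i → proj₂ (∈-filter⁻ (V? B) {xs = allFin n} (⊆-length⇒⊇ _≟_ unV subV leV (∈-filter⁺ (V? B′) (∈-allFin w) i)))) ,
      λ a b i → proj₂ (∈-filter⁻ (E? B) {xs = allPairs} (⊆-length⇒⊇ _≟²_ unE subE leE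
        (∈-filter⁺ (E? B′) (∈-cartesianProduct⁺ (∈-allFin a) (∈-allFin b)) i)))
      where
      _≟²_ : ∀ (a b : Fin n × Fin n) → Dec (a ≡ b)
      _≟²_ = ≡-dec _≟_ _≟_
      unV : Unique (filter (V? B) (allFin n))
      unV = Uniqueₚ.filter⁺ (V? B) (Uniqueₚ.allFin⁺ n)
      unE : Unique (filter (E? B) allPairs)
      unE = Uniqueₚ.filter⁺ (E? B) (Uniqueₚ.cartesianProduct⁺ (Uniqueₚ.allFin⁺ n) (Uniqueₚ.allFin⁺ n))
      subV : ∀ {w} → w ∈ filter (V? B) (allFin n) → w ∈ filter (V? B′) (allFin n)
      subV m = let i , v = ∈-filter⁻ (V? B) {xs = allFin n} m in ∈-filter⁺ (V? B′) i (sv _ v)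
      subE : ∀ {w} → w ∈ filter (E? B) allPairs → w ∈ filter (E? B′) allPairs
      subE m = let i , v = ∈-filter⁻ (E? B) {xs = allPairs} m in ∈-filter⁺ (E? B′) i (se _ _ v)
      geV : sizeV B ≤ sizeV B′
      geV = unique-⊆-length unV subV
      geE : sizeE B ≤ sizeE B′
      geE = unique-⊆-length unE subE
      leV : sizeV B′ ≤ sizeV B
      leV = ℕₚ.+-cancelʳ-≤ (sizeE B) _ _ (ℕₚ.≤-trans (ℕₚ.+-monoʳ-≤ (sizeV B′) geE) le)
      leE : sizeE B′ ≤ sizeE B
      leE = ℕₚ.+-cancelˡ-≤ (sizeV B) _ _ (ℕₚ.≤-trans (ℕₚ.+-monoˡ-≤ (sizeE B′) geV) le)

  -- Maximality under inclusion is obtained from a maximum of the number of vertices plus edges. The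
  -- given ear, added to the bare edge xy, supplies a 2-connected subgraph to start from.
  block-exists : ∀ {H : Graph n} {x y l} → SymG H → E H x y → Ear H x y l →
    ¬ ¬ ∃ λ B → TwoConnComp H B × InE B x y
  block-exists {H} {x} {y} sy xy e c = ¬¬-maximum Good (λ B → sizeV B + sizeE B) (length (allFin n) + length allPairs)
      (λ B → ℕₚ.+-mono-≤ (length-filter (V? B) (allFin n)) (length-filter (E? B) allPairs)) (B⁺ , B⁺-sub , B⁺-twoConnected , proj₂ B⊑B⁺ x y xy₀)
      λ (B , (s , t , i) , max) → c (B , (s , t , λ B′ s′ t′ le → ⊑-size {B} {B′} le (max B′ (s′ , t′ , proj₂ le x y i))) , i)
    where
    Good : Subgraph {n} → Set
    Good B = IsSubgraphOf B H × TwoConnected B × InE B x y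
    B₀ : Subgraph {n}
    B₀ = record { vs = λ w → ⌊ w ≟ x ⌋ ∨ ⌊ w ≟ y ⌋ ; es = single x y }
    Vx : InV B₀ x
    Vx = ∨-left (≟-refl x)
    Vy : InV B₀ y
    Vy = ∨-right {⌊ y ≟ x ⌋} (≟-refl y)
    xy₀ : InE B₀ x y
    xy₀ = mem-single⁺ x y (inj₁ (refl , refl))
    ends : ∀ w → InV B₀ w → w ≡ x ⊎ w ≡ y
    ends w v with ∨-split {⌊ w ≟ x ⌋} v
    ... | inj₁ p = inj₁ (≟-true p)
    ... | inj₂ p = inj₂ (≟-true p)
    sub₀ : IsSubgraphOf B₀ H
    sub₀ a b i with mem-single⁻ x y a b i
    ... | inj₁ (refl , refl) = xy , Vx , Vy
    ... | inj₂ (refl , refl) = sy _ _ xy , Vy , Vx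
    bi₀ : Biconnected B₀
    bi₀ = conn , connOff
      where
      conn : ∀ a b → InV B₀ a → InV B₀ b → Star (InE B₀) a b
      conn a b va vb with ends a va | ends b vb
      ... | inj₁ refl | inj₁ refl = ε
      ... | inj₁ refl | inj₂ refl = xy₀ ◅ ε
      ... | inj₂ refl | inj₁ refl = inE-sym B₀ {x} {y} xy₀ ◅ ε
      ... | inj₂ refl | inj₂ refl = ε
      connOff : ∀ z a b → InV B₀ z → InV B₀ a → InV B₀ b → a ≢ z → b ≢ z → Star (AvoidingIn B₀ z) a b
      connOff z a b vz va vb az bz with ends z vz | ends a va | ends b vb
      ... | _ | inj₁ refl | inj₁ refl = ε
      ... | _ | inj₂ refl | inj₂ refl = ε
      ... | inj₁ refl | inj₁ refl | _ = ⊥-elim (az refl)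
      ... | inj₂ refl | inj₂ refl | _ = ⊥-elim (az refl)
      ... | inj₁ refl | _ | inj₁ refl = ⊥-elim (bz refl)
      ... | inj₂ refl | _ | inj₂ refl = ⊥-elim (bz refl)
    open AddEar {H = H} sy B₀ sub₀ bi₀ Vx Vy e

-- Iterative sets

module _ {n : ℕ} where

  private
    Sub : Graph n → Graph n → Set
    Sub K K′ = ∀ {a b} → E K a b → E K′ a b

  cycle-map : ∀ {K K′ : Graph n} → Sub K K′ → ∀ C → IsCycle K C → IsCycle K′ C
  cycle-map f (x ∷ r) (le , un , lk) = le , un , Linked.map f lk

  internal-transport : ∀ {K K′ : Graph n} {x y} → Sub K K′ → Sub K′ K → Internal K x y → Internal K′ x y
  internal-transport {K} {K′} f g (C₁ , C₂ , (c₁ , i₁) , (c₂ , i₂) , e₁ , e₂ , w) =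
    C₁ , C₂ , (cycle-map {K} {K′} f C₁ c₁ , λ a b p q e → i₁ a b p q (g e)) ,
    (cycle-map {K} {K′} f C₂ c₂ , λ a b p q e → i₂ a b p q (g e)) , e₁ , e₂ , w

  bridge-transport : ∀ {K K′ : Graph n} {x y} → Sub K K′ → Sub K′ K → Bridge K x y → Bridge K′ x y
  bridge-transport {K} {K′} {x} {y} f g (e , ¬c) = f e , λ c → ¬c (gmap (λ z → z) (λ h →
    let p , q = ─⁻ K′ (single x y) h in ─⁺ K (single x y) (g p) q) c)

  -- `K*` is kept abstract because removing a whole set and removing its edges one by one give
  -- graphs that agree edge by edge but are not the same function.
  validSeq-snoc : ∀ es {K K* : Graph n} {x y} → ValidSeq K es →
    (∀ {a b} → E K* a b → E K a b × ¬ Deleted es a b) → (∀ {a b} → E K a b → ¬ Deleted es a b → E K* a b) →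
    External K* x y → ¬ Bridge K* x y → ValidSeq K (es ++ [ (x , y) ])
  validSeq-snoc [] {K} {K*} _ f g (e , ¬int) ¬br = (f′ e , λ i → ¬int (internal-transport {K} {K*} g′ f′ i)) ,
      (λ b → ¬br (bridge-transport {K} {K*} g′ f′ b)) , tt
    where
    f′ : Sub K* K
    f′ h = proj₁ (f h)
    g′ : Sub K K*
    g′ h = g h λ { (inj₁ ()) ; (inj₂ ()) }
  validSeq-snoc ((u , v) ∷ es) {K} (ex , nb , val) f g ext ¬br = ex , nb ,
    validSeq-snoc es val
      (λ h → ─⁺ K (single u v) (proj₁ (f h)) (λ m → proj₂ (f h) (single-cons {u = u} {v} m)) ,
             λ d → proj₂ (f h) ([ (λ z → inj₁ (there z)) , (λ z → inj₂ (there z)) ]′ d))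
      (λ h ¬d → let p , q = ─⁻ K (single u v) h in g p λ
        { (inj₁ (here refl)) → q (mem-single⁺ u v (inj₁ (refl , refl)))
        ; (inj₂ (here refl)) → q (mem-single⁺ u v (inj₂ (refl , refl)))
        ; (inj₁ (there i)) → ¬d (inj₁ i) ; (inj₂ (there i)) → ¬d (inj₂ i) })
      ext ¬br

  mem-∪⁻ : ∀ (A X : ESet n) {u v} → Mem (A ∪ X) u v → Mem A u v ⊎ Mem X u v
  mem-∪⁻ A X {u} {v} m with ∨-split {(A ∪ X) u v} m
  ... | inj₁ p = [ (λ q → inj₁ (∨-left q)) , (λ q → inj₂ (∨-left q)) ]′ (∨-split {A u v} p)
  ... | inj₂ p = [ (λ q → inj₁ (∨-right {A u v} q)) , (λ q → inj₂ (∨-right {X u v} q)) ]′ (∨-split {A v u} p)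

  mem-∪ˡ : ∀ (A X : ESet n) {u v} → Mem A u v → Mem (A ∪ X) u v
  mem-∪ˡ A X {u} {v} m with ∨-split {A u v} m
  ... | inj₁ p = ∨-left (∨-left p)
  ... | inj₂ p = ∨-right {(A ∪ X) u v} (∨-left p)

  mem-∪ʳ : ∀ (A X : ESet n) {u v} → Mem X u v → Mem (A ∪ X) u v
  mem-∪ʳ A X {u} {v} m with ∨-split {X u v} m
  ... | inj₁ p = ∨-left (∨-right {A u v} p)
  ... | inj₂ p = ∨-right {(A ∪ X) u v} (∨-right {A v u} p)

  iterative-snoc : ∀ {G : Graph n} {A x y} → Iterative G A → Bound A G x y → Iterative G (A ∪ single x y)
  iterative-snoc {G} {A} {x} {y} (L , val , iff) (ext , ¬br) = L ++ [ (x , y) ] ,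
    validSeq-snoc L {G} {G ─ A} val
      (λ h → let p , q = ─⁻ G A h in p , λ d → q (Equivalence.from (iff _ _) d))
      (λ h ¬d → ─⁺ G A h (λ m → ¬d (Equivalence.to (iff _ _) m))) ext ¬br ,
    λ u v → mk⇔ (to u v) (from u v)
    where
    to : ∀ u v → Mem (A ∪ single x y) u v → Deleted (L ++ [ (x , y) ]) u v
    to u v m with mem-∪⁻ A (single x y) m
    ... | inj₁ p = [ (λ z → inj₁ (∈-++⁺ˡ z)) , (λ z → inj₂ (∈-++⁺ˡ z)) ]′ (Equivalence.to (iff u v) p)
    ... | inj₂ p with mem-single⁻ x y u v p
    ...   | inj₁ (refl , refl) = inj₁ (∈-last L)
    ...   | inj₂ (refl , refl) = inj₂ (∈-last L)
    from : ∀ u v → Deleted (L ++ [ (x , y) ]) u v → Mem (A ∪ single x y) u v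
    from u v (inj₁ m) with ∈-snoc⁻ L m
    ... | inj₁ i = mem-∪ˡ A (single x y) (Equivalence.from (iff u v) (inj₁ i))
    ... | inj₂ refl = mem-∪ʳ A (single x y) (mem-single⁺ x y (inj₁ (refl , refl)))
    from u v (inj₂ m) with ∈-snoc⁻ L m
    ... | inj₁ i = mem-∪ˡ A (single x y) (Equivalence.from (iff u v) (inj₂ i))
    ... | inj₂ refl = mem-∪ʳ A (single x y) (mem-single⁺ x y (inj₂ (refl , refl)))

-- Supports

  consec-reverse : ∀ {xs : List (Fin n)} {a b} → Consec xs a b → Consec (reverse xs) b a
  consec-reverse {a ∷ b ∷ l} here = subst (λ z → Consec z b a)
    (sym (trans (unfold-reverse a (b ∷ l)) (trans (cong (_++ [ a ]) (unfold-reverse b l)) (++-assoc (reverse l) [ b ] [ a ]))))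
    (consec-++ʳ (reverse l) here)
  consec-reverse {c ∷ l} (there p) = subst (λ z → Consec z _ _) (sym (unfold-reverse c l)) (consec-++ˡ (consec-reverse p))

  pathEdge-reverse : ∀ {xs : List (Fin n)} {a b} → PathEdge xs a b → PathEdge (reverse xs) a b
  pathEdge-reverse (inj₁ c) = inj₂ (consec-reverse c)
  pathEdge-reverse (inj₂ c) = inj₁ (consec-reverse c)

  path-reverse : ∀ {H : Graph n} {u v P} → SymG H → IsPath H u v P → IsPath H v u (reverse P)
  path-reverse {H} {u} {v} s ((mid , refl) , lk , un) with reverseʷ (λ {a} {b} → s a b) (fromLinked mid lk)
  ... | l′ , w , eq = (reverse mid , eq′) , subst (Linked (E H)) eq (toLinked w) , unique-reverse un
    where
    eq′ : reverse (u ∷ mid ++ [ v ]) ≡ v ∷ reverse mid ++ [ u ]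
    eq′ = trans (unfold-reverse u (mid ++ [ v ])) (cong (_++ [ u ]) (reverse-++ mid [ v ]))

  sup-sym : ∀ {A} {G : Graph n} {x y a b} → SymG G → Sup A G x y a b → Sup A G x y b a
  sup-sym {A} {G} s (m , B , c , i , P , path , vs⇔ , es⇔) = mem-sym A m , B , c , i , reverse P ,
    path-reverse {H = G ─ A} (─-sym A s) path ,
    (λ w → mk⇔ (λ (p , q) → Equivalence.to (vs⇔ w) (reverse⁻ p , q)) (λ e → let p , q = Equivalence.from (vs⇔ w) e in reverse⁺ p , q)) ,
    (λ p q → mk⇔ (λ (e , f) → Equivalence.to (es⇔ p q) (subst (λ z → PathEdge z p q) (reverse-involutive P) (pathEdge-reverse e) , f))
      (λ e → let f , g = Equivalence.from (es⇔ p q) e in pathEdge-reverse f , g))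

  sup-irrefl : ∀ {A} {G : Graph n} {x y a} → ¬ Sup A G x y a a
  sup-irrefl (_ , _ , _ , _ , _ , ((mid , refl) , _ , (un ∷ _)) , _) = All.lookup un (∈-last mid) refl

  ¬¬-all : ∀ {m} {P : Fin m → Set} → (∀ i → ¬ ¬ P i) → ¬ ¬ (∀ i → P i)
  ¬¬-all {zero} f c = c λ ()
  ¬¬-all {suc m} f c = f Fin.zero λ p → ¬¬-all (λ i → f (Fin.suc i)) λ q → c λ { Fin.zero → p ; (Fin.suc i) → q i }

  ∈-pairs⁺ : ∀ {a b : Fin n} → toℕ a < toℕ b → (a , b) ∈ pairs
  ∈-pairs⁺ {a} {b} = ∈-filter⁺ (λ p → toℕ (proj₁ p) ℕ.<? toℕ (proj₂ p)) (∈-cartesianProduct⁺ (∈-allFin a) (∈-allFin b))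

  ∈-pairs⁻ : ∀ {p : Fin n × Fin n} → p ∈ pairs → toℕ (proj₁ p) < toℕ (proj₂ p)
  ∈-pairs⁻ m = proj₂ (∈-filter⁻ (λ p → toℕ (proj₁ p) ℕ.<? toℕ (proj₂ p)) {xs = cartesianProduct (allFin n) (allFin n)} m)

  pairs-unique : Unique (pairs {n})
  pairs-unique = Uniqueₚ.filter⁺ (λ p → toℕ (proj₁ p) ℕ.<? toℕ (proj₂ p)) (Uniqueₚ.cartesianProduct⁺ (Uniqueₚ.allFin⁺ n) (Uniqueₚ.allFin⁺ n))

  -- Under the double negation membership in S may be taken as decided for all pairs at once, and
  -- the list is then a filter of `pairs`.
  ¬¬-hasSize : (S : Fin n → Fin n → Set) → (∀ {a b} → S a b → S b a) → (∀ {a} → ¬ S a a) → ¬ ¬ ∃ (HasSize S)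
  ¬¬-hasSize S s irr c = ¬¬-all (λ a → ¬¬-all λ b → ¬¬-excluded-middle {A = S a b}) λ S? →
    let L = filter (λ p → S? (proj₁ p) (proj₂ p)) pairs
        to : ∀ a b → S a b → (a , b) ∈ L ⊎ (b , a) ∈ L
        to a b h = case ℕₚ.<-cmp (toℕ a) (toℕ b) of λ
          { (tri< lt _ _) → inj₁ (∈-filter⁺ (λ p → S? (proj₁ p) (proj₂ p)) (∈-pairs⁺ lt) h)
          ; (tri≈ _ eq _) → ⊥-elim (irr (subst (S a) (sym (toℕ-injective eq)) h))
          ; (tri> _ _ gt) → inj₂ (∈-filter⁺ (λ p → S? (proj₁ p) (proj₂ p)) (∈-pairs⁺ gt) (s h)) }
        out : ∀ {p} → p ∈ L → p ∈ pairs × S (proj₁ p) (proj₂ p)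
        out = ∈-filter⁻ (λ p → S? (proj₁ p) (proj₂ p)) {xs = pairs}
    in c (length L , L , refl , Uniqueₚ.filter⁺ (λ p → S? (proj₁ p) (proj₂ p)) pairs-unique ,
          (λ a b m → ∈-pairs⁻ (proj₁ (out m))) ,
          λ a b → mk⇔ (to a b) [ (λ m → proj₂ (out m)) , (λ m → s (proj₂ (out m))) ]′)

-- Comparing sums

module _ {P : Set} {Gain Loss : P → Set} (gain? : Decidable Gain) (loss? : Decidable Loss) (t t′ : P → ℕ) (m : ℕ)
  (worst : ∀ p → t′ p ≤ t p + m) (even : ∀ p → ¬ Loss p → t′ p ≤ t p) (gains : ∀ p → Gain p → t′ p + m ≤ t p) where

  open ℕₚ.≤-Reasoning
  open +-*-Solver

  private
    step : ∀ g l {u u′ s s′ a b} → u′ + m * g ≤ u + m * l → s′ + m * a ≤ s + m * b →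
      (u′ + s′) + m * (g + a) ≤ (u + s) + m * (l + b)
    step g l {u} {u′} {s} {s′} {a} {b} p q = begin
      (u′ + s′) + m * (g + a)       ≡⟨ regroup u′ s′ g a ⟩
      (u′ + m * g) + (s′ + m * a)   ≤⟨ ℕₚ.+-mono-≤ p q ⟩
      (u + m * l) + (s + m * b)     ≡⟨ regroup u s l b ⟨
      (u + s) + m * (l + b)         ∎
      where
      regroup : ∀ u s g a → (u + s) + m * (g + a) ≡ (u + m * g) + (s + m * a)
      regroup u s g a = solve 5 (λ m u s g a → (u :+ s) :+ m :* (g :+ a) := (u :+ m :* g) :+ (s :+ m :* a)) refl m u s g a

    +m*0 : ∀ z → z ≡ z + m * 0
    +m*0 z = sym (trans (cong (z +_) (ℕₚ.*-zeroʳ m)) (ℕₚ.+-identityʳ z))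

    +m*1 : ∀ z → z + m ≡ z + m * 1
    +m*1 z = cong (z +_) (sym (ℕₚ.*-identityʳ m))

  -- Both counts are weighted by m and put on the side where they are added, so that the induction
  -- never subtracts.
  sum-gain-loss : ∀ ps → sum (map t′ ps) + m * length (filter gain? ps) ≤ sum (map t ps) + m * length (filter loss? ps)
  sum-gain-loss [] = ℕₚ.≤-refl
  sum-gain-loss (p ∷ ps) with gain? p | loss? p | sum-gain-loss ps
  ... | yes g | yes _ | ih = step 1 1 (ℕₚ.+-monoˡ-≤ (m * 1) (ℕₚ.m+n≤o⇒m≤o (t′ p) (gains p g))) ih
  ... | yes g | no _ | ih = step 1 0 (subst₂ _≤_ (+m*1 (t′ p)) (+m*0 (t p)) (gains p g)) ih
  ... | no _ | yes _ | ih = step 0 1 (subst₂ _≤_ (+m*0 (t′ p)) (+m*1 (t p)) (worst p)) ih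
  ... | no _ | no l | ih = step 0 0 (ℕₚ.+-monoˡ-≤ (m * 0) (even p l)) ih

  sum-≤ : ∀ ps → length (filter loss? ps) ≤ length (filter gain? ps) → sum (map t′ ps) ≤ sum (map t ps)
  sum-≤ ps le = ℕₚ.+-cancelʳ-≤ (m * length (filter gain? ps)) _ _
    (ℕₚ.≤-trans (sum-gain-loss ps) (ℕₚ.+-monoʳ-≤ (sum (map t ps)) (ℕₚ.*-monoʳ-≤ m le)))

module _ {n : ℕ} where

  ratio-mono : ∀ {a b} d → a ≤ b → ratio {n} a d ℚ.≤ ratio {n} b d
  ratio-mono zero le = ℚₚ.≤-refl
  ratio-mono {a} {b} (suc d) le = ℚₚ.toℚᵘ-cancel-≤ (ℚᵘₚ.≤-respˡ-≃ (ℚᵘₚ.≃-sym (ℚₚ.toℚᵘ-fromℚᵘ (ℚᵘ.mkℚᵘ (ℤ.+ a) d)))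
    (ℚᵘₚ.≤-respʳ-≃ (ℚᵘₚ.≃-sym (ℚₚ.toℚᵘ-fromℚᵘ (ℚᵘ.mkℚᵘ (ℤ.+ b) d)))
      (ℚᵘ.*≤* (ℤₚ.*-monoʳ-≤-nonNeg (ℤ.+ suc d) (ℤ.+≤+ le)))))

-- Cycles opened at an edge, and the ears of an internal edge

start∈list : ∀ {A : Set} {R : A → A → Set} {a b z l} → Walk R a b l → z ∈ l → a ∈ l
start∈list (_ ∷ _) _ = here refl

module _ {n : ℕ} where

  -- The second vertex c on the list shows that the walk is more than the edge xy.
  toEar : ∀ {K : Graph n} {x y L c} → Walk (E K) x y L → Unique (L ++ [ y ]) → c ∈ L → c ≢ x →
    ∃ λ l → L ≡ x ∷ l × Ear K x y l
  toEar {K} {x} {y} (_∷_ {w = w} {l = l} r p) un c∈ c≢x = l , refl , ear r p (proper p un c∈) un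
    where
    proper : ∀ {w l} → Walk (E K) w y l → Unique (x ∷ l ++ [ y ]) → _ ∈ x ∷ l → w ≢ y
    proper [] _ (here e) _ = c≢x e
    proper {l = l} (_ ∷ _) (_ ∷ u) _ refl = proj₂ (proj₂ (unique-++⁻ l u)) (here refl) (here refl)

  ear-walk : ∀ {K : Graph n} {x y l} → Ear K x y l → Walk (E K) x y (x ∷ l)
  ear-walk e = Ear.step e ∷ Ear.walk e

  ear-verts⁻ : ∀ {x y w : Fin n} l → w ∈ x ∷ l ++ [ y ] → w ≡ x ⊎ w ≡ y ⊎ w ∈ l
  ear-verts⁻ l (here e) = inj₁ e
  ear-verts⁻ l (there m) = [ (λ i → inj₂ (inj₂ i)) , (λ e → inj₂ (inj₁ e)) ]′ (∈-snoc⁻ l m)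

  reverse-ear-verts : ∀ (u v : Fin n) l → reverse (v ∷ l ++ [ u ]) ≡ u ∷ reverse l ++ [ v ]
  reverse-ear-verts u v l = trans (unfold-reverse v (l ++ [ u ])) (cong (_++ [ v ]) (reverse-++ l [ u ]))

  -- A cycle seen from one of its edges. The field `edges` turns a chordlessness statement about the
  -- cycle into one about consecutive vertices of the ear.
  record OpenedCycle (K : Graph n) (C : List (Fin n)) (u v : Fin n) : Set where
    constructor opened
    field
      {inner} : List (Fin n)
      theEar : Ear K u v inner
      closing : E K u v
      ⊆C : ∀ {w} → w ∈ u ∷ inner ++ [ v ] → w ∈ C
      C⊆ : ∀ {w} → w ∈ C → w ∈ u ∷ inner ++ [ v ]
      edges : ∀ {a b} → CycEdge C a b → SamePair u v a b ⊎ PathEdge (u ∷ inner ++ [ v ]) a b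

  open-directed : ∀ {K : Graph n} C {u v} → SymG K → IsCycle K C → Consec (closed C) v u → OpenedCycle K C u v
  open-directed {K} (x ∷ r) {u} {v} s cyc c with open-cycle (x ∷ r) cyc c
  ... | _ ∷ [] , _ , _ , _ , _ , s≤s () , _
  ... | _ ∷ z ∷ l , walk@(_ ∷ _) , un , to , from , len , vu , con with toEar walk un (there (here refl)) (z≢u un)
    where
    z≢u : Unique (u ∷ z ∷ l ++ [ v ]) → z ≢ u
    z≢u ((a ∷ _) ∷ _) e = a (sym e)
  ...   | l′ , refl , e = opened e (s _ _ vu) to from λ
          { (inj₁ d) → [ (λ (p , q) → inj₁ (inj₂ (p , q))) , (λ z → inj₂ (inj₁ z)) ]′ (con d)
          ; (inj₂ d) → [ (λ (p , q) → inj₁ (inj₁ (q , p))) , (λ z → inj₂ (inj₂ z)) ]′ (con d) }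

  flip-opened : ∀ {K : Graph n} {C u v} → SymG K → OpenedCycle K C u v → OpenedCycle K C v u
  flip-opened {K} {C} {u} {v} s (opened {l} e c to from ed) = opened (flipEar s e) (s _ _ c)
    (λ m → to (reverse⁻ (subst (_ ∈_) (sym eq) m))) (λ m → subst (_ ∈_) eq (reverse⁺ (from m)))
    (λ d → [ (λ z → inj₁ (swap z)) , (λ z → inj₂ (subst (λ k → PathEdge k _ _) eq (pathEdge-reverse z))) ]′ (ed d))
    where
    eq : reverse (u ∷ l ++ [ v ]) ≡ v ∷ reverse l ++ [ u ]
    eq = reverse-ear-verts v u l

  open-at : ∀ {K : Graph n} C {u v} → SymG K → IsCycle K C → CycEdge C u v → OpenedCycle K C u v
  open-at C@(x ∷ r) s cyc (inj₁ c) = flip-opened s (open-directed C s cyc c)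
  open-at C@(x ∷ r) s cyc (inj₂ c) = open-directed C s cyc c

  successor-unique : ∀ {xs : List (Fin n)} {p a b} → Unique xs → Consec xs p a → Consec xs p b → a ≡ b
  successor-unique un here here = refl
  successor-unique (a ∷ _) here (there c) = ⊥-elim (All.lookup a (proj₁ (consec-∈ c)) refl)
  successor-unique (a ∷ _) (there c) here = ⊥-elim (All.lookup a (proj₁ (consec-∈ c)) refl)
  successor-unique (_ ∷ un) (there c) (there d) = successor-unique un c d

  consec-order : ∀ (xs : List (Fin n)) {ys p q} → Unique (xs ++ p ∷ ys) → q ∈ ys → ¬ Consec (xs ++ p ∷ ys) q p
  consec-order [] (a ∷ _) q∈ here = All.lookup a q∈ refl
  consec-order [] (a ∷ _) q∈ (there c) = All.lookup a (proj₂ (consec-∈ c)) refl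
  consec-order (x ∷ []) (a ∷ un) q∈ here = All.lookup a (there q∈) refl
  consec-order (x ∷ []) (a ∷ un) q∈ (there c) = consec-order [] un q∈ c
  consec-order (x ∷ y ∷ xs) (a ∷ un) q∈ here = All.lookup a (there (∈-++⁺ʳ xs (there q∈))) refl
  consec-order (x ∷ y ∷ xs) (a ∷ un) q∈ (there c) = consec-order (y ∷ xs) un q∈ c

  module _ {G : Graph n} {A : ESet n} (tl : TwoTreeLike G) (it : Iterative G A) where

    private
      H : Graph n
      H = G ─ A

      H-sym : SymG H
      H-sym = ─-sym A (TwoTreeLike.symmetric tl)

      H→G : ∀ {a b} → E H a b → E G a b
      H→G e = proj₁ (─⁻ G A e)

    -- `ear⇒chord` expects p before q along the cycle; for the opposite order the connecting walk is
    -- reversed.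
    cycle-chord : ∀ {u v l p q k} → Ear H u v l → E H u v → p ≢ q → p ∈ u ∷ l ++ [ v ] → q ∈ u ∷ l ++ [ v ] →
      Walk (E H) p q k → (∀ {w} → w ∈ k → w ∈ u ∷ l ++ [ v ] → w ≡ p ⊎ w ≡ q) → E H p q
    cycle-chord {u} {v} {l} {p} {q} {k} e uv p≢q p∈ q∈ wk off with split (ear-walk e) p∈
    ... | a₁ , a₂ , w₁ , w₂ , eq with ∈-++⁻ a₁ (subst (q ∈_) (trans (cong (_++ [ v ]) eq) (++-assoc a₁ a₂ [ v ])) q∈)
    ...   | inj₂ q∈₂ with split w₂ q∈₂
    ...     | b₁ , b₂ , w₃ , w₄ , refl = ear⇒chord {G = G} {A} tl it p≢q w₁ w₃ w₄ uv
                (subst (λ z → Unique (z ++ [ v ])) eq (Ear.simple e)) (mapʷ H→G wk)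
                λ i j → off i (subst (λ z → _ ∈ z ++ [ v ]) (sym eq) j)
    cycle-chord {u} {v} {l} {p} {q} {k} e uv p≢q p∈ q∈ wk off | a₁ , a₂ , w₁ , w₂ , eq | inj₁ q∈₁ with split w₁ (∈-++⁺ˡ q∈₁)
    ...     | b₁ , b₂ , w₃ , w₄ , refl with reverseʷ (λ {a} {b} → H-sym a b) wk
    ...       | k′ , wk′ , eqk = H-sym _ _ (ear⇒chord {G = G} {A} tl it (≢-sym p≢q) w₃ w₄ w₂ uv
                (subst (λ z → Unique (z ++ [ v ])) eq′ (Ear.simple e)) (mapʷ H→G wk′) off′)
      where
      eq′ : u ∷ l ≡ b₁ ++ b₂ ++ a₂
      eq′ = trans eq (++-assoc b₁ b₂ a₂)
      off′ : ∀ {w} → w ∈ k′ → w ∈ (b₁ ++ b₂ ++ a₂) ++ [ v ] → w ≡ q ⊎ w ≡ p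
      off′ i j with ∈-snoc⁻ k (reverse-walk-∈ {l = k} eqk (∈-++⁺ˡ i))
      ... | inj₂ e = inj₁ e
      ... | inj₁ i′ = swap (off i′ (subst (λ z → _ ∈ z ++ [ v ]) (sym eq′) j))

    -- If the induced cycle C₁ leaves C₂, then the stretch of C₁ outside C₂ is an ear of C₂; its ends are joined by a
    -- chord, so C₁ being induced leaves room for nothing else.
    distinct-induced-cycles : ∀ {u v C₁ C₂ w} → IsInducedCycle H C₁ → IsCycle H C₂ → CycEdge C₁ u v → CycEdge C₂ u v →
      w ∈ C₁ → ¬ w ∈ C₂ → ∃₂ λ l₁ l₂ → Ear H u v l₁ × Ear H u v l₂ × (∀ {z} → z ∈ l₁ → z ∈ l₂ → ⊥)
    distinct-induced-cycles {u} {v} {C₁} {C₂} {w} (cyc₁ , ind) cyc₂ e₁ e₂ w∈ w∉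
      with open-at C₁ H-sym cyc₁ e₁ | open-at C₂ H-sym cyc₂ e₂
    ... | opened {l₁} ear₁ uv to₁ from₁ ed₁ | opened {l₂} ear₂ _ to₂ from₂ _ = l₁ , l₂ , ear₁ , ear₂ , disj
      where
      in₂? : ∀ z → Dec (z ∈ C₂)
      in₂? z = _∈?_ _≟_ z C₂
      u∈₂ : u ∈ C₂
      u∈₂ = to₂ (here refl)
      v∈₂ : v ∈ C₂
      v∈₂ = to₂ (there (∈-last l₂))
      disj : ∀ {z} → z ∈ l₁ → z ∈ l₂ → ⊥
      disj {z} z∈₁ z∈₂ with split (ear-walk ear₁) (from₁ w∈)
      ... | α′ , β′ , wα′ , wβ′ , eq with firstExit in₂? wα′ u∈₂ w∉
      ...   | p , w₁ , α , ω , wα , pw , wω , refl , p∈ , w₁∉ with firstHit in₂? (wω ++ʷ wβ′) v∈₂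
      ...     | q , γ , δ , wγ , wδ , eq′ , q∈ , off = finish (ed₁ (ind p q (to₁ p∈V) (to₁ q∈V) pq))
        where
        eqL : u ∷ l₁ ≡ α ++ p ∷ γ ++ δ
        eqL = trans eq (trans (++-assoc α (p ∷ ω) β′) (cong (λ k → α ++ p ∷ k) eq′))
        eqV : u ∷ l₁ ++ [ v ] ≡ α ++ p ∷ (γ ++ δ) ++ [ v ]
        eqV = trans (cong (_++ [ v ]) eqL) (++-assoc α (p ∷ γ ++ δ) [ v ])
        unV : Unique (α ++ p ∷ (γ ++ δ) ++ [ v ])
        unV = subst Unique eqV (Ear.simple ear₁)
        unα = unique-++⁻ α unV
        q∈R : q ∈ (γ ++ δ) ++ [ v ]
        q∈R = subst (q ∈_) (sym (++-assoc γ δ [ v ])) (∈-++⁺ʳ γ (start∈ wδ))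
        p∉R : ¬ p ∈ (γ ++ δ) ++ [ v ]
        p∉R m with proj₁ (proj₂ unα)
        ... | a ∷ _ = All.lookup a m refl
        p≢q : p ≢ q
        p≢q e = p∉R (subst (_∈ (γ ++ δ) ++ [ v ]) (sym e) q∈R)
        p∈V : p ∈ u ∷ l₁ ++ [ v ]
        p∈V = subst (p ∈_) (sym eqV) (∈-++⁺ʳ α (here refl))
        q∈V : q ∈ u ∷ l₁ ++ [ v ]
        q∈V = subst (q ∈_) (sym eqV) (∈-++⁺ʳ α (there q∈R))
        pq : E H p q
        pq = cycle-chord ear₂ uv p≢q (from₂ p∈) (from₂ q∈) (pw ∷ wγ) λ
          { (here e) _ → inj₁ e ; (there i) j → ⊥-elim (off i (to₂ j)) }
        finish : SamePair u v p q ⊎ PathEdge (u ∷ l₁ ++ [ v ]) p q → ⊥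
        finish (inj₂ (inj₁ c)) = w₁∉ (subst (_∈ C₂) (successor-unique (Ear.simple ear₁) c
          (subst (λ k → Consec (k ++ [ v ]) p w₁) (sym eqL) (consec-split⁺ α (wγ ++ʷ wδ)))) q∈)
        finish (inj₂ (inj₂ c)) = consec-order α unV q∈R (subst (λ k → Consec k q p) eqV c)
        finish (inj₁ (inj₂ (refl , _))) = p∉R (∈-last (γ ++ δ))
        -- The chord is uv itself, so all inner vertices of the first ear lie outside C₂, and z
        -- cannot be among them.
        finish (inj₁ (inj₁ (refl , refl))) with ∈-++⁻ α (subst (z ∈_) eqL (there z∈₁))
        ... | inj₁ i = proj₂ (proj₂ unα) (start∈list wα i) (here refl)
        ... | inj₂ (here refl) = ear-∉ˡ ear₁ z∈₁
        ... | inj₂ (there i) with ∈-++⁻ γ i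
        ...   | inj₁ j = off j (to₂ (there (∈-++⁺ˡ z∈₂)))
        ...   | inj₂ j = proj₂ (proj₂ (unique-++⁻ (u ∷ l₁) (Ear.simple ear₁)))
                  (subst (q ∈_) (sym eqL) (∈-++⁺ʳ α (there (∈-++⁺ʳ γ (start∈list wδ j))))) (here refl)

    internal⇒ears : ∀ {u v} → Internal H u v → ∃₂ λ l₁ l₂ → Ear H u v l₁ × Ear H u v l₂ × (∀ {z} → z ∈ l₁ → z ∈ l₂ → ⊥)
    internal⇒ears (C₁ , C₂ , i₁ , i₂ , e₁ , e₂ , w , inj₁ (w∈ , w∉)) = distinct-induced-cycles i₁ (proj₁ i₂) e₁ e₂ w∈ w∉
    internal⇒ears (C₁ , C₂ , i₁ , i₂ , e₁ , e₂ , w , inj₂ (w∉ , w∈)) = distinct-induced-cycles i₂ (proj₁ i₁) e₂ e₁ w∈ w∉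

    -- Either a second x–y walk in H⁻ disjoint from the first one appears, or the two x–y walks are linked off {x, y}.
    off-block : ∀ {x y B L Q lw w} {H⁻ : Graph n} → (∀ {a b} → E H⁻ a b → E H a b) →
      (∀ {a b} → E H a b → a ≢ x → b ≢ x → E H⁻ a b) → E G x y →
      (∀ {l m} → Walk (E H⁻) x y l → Walk (E H⁻) x y m → MeetOnly x y l m → ⊥) →
      TwoConnected B → IsSubgraphOf B H → InV B x → InV B y →
      Walk (E H⁻) x y L → Unique (L ++ [ y ]) → Walk (E G) x y Q → Unique (Q ++ [ y ]) → MeetOnly x y L Q →
      w ∈ Q → w ≢ x → w ≢ y → Walk (E H⁻) x w lw → (∀ {z} → z ∈ lw → z ∈ L ++ [ y ] → z ≡ x) → ¬ InV B w
    off-block {x} {y} {B} {L} {Q} {lw} {w} {H⁻} toH toH⁻ xy no-two (_ , _ , conn) sub Vx Vy wL unL wQ unQ meet w∈ w≢x w≢y ww offw Vw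
      with fromStar (conn x w y Vx Vw Vy w≢x (λ { refl → TwoTreeLike.loopless tl _ xy }))
    -- 2-connectedness of `B` provides a walk from w to y that avoids x and hence stays in `H⁻`; c
    -- is its first vertex on L. For c = y it completes a second detour, otherwise it is a link.
    ... | r , wr with firstHit (λ z → _∈?_ _≟_ z (L ++ [ y ])) wr (∈-last L)
    ...   | c , r₁ , r₂ , wr₁ , wr₂ , _ , c∈ , off = finish (c ≟ y)
      where
      avoid-x : ∀ {a b} {k : List (Fin n)} → Walk (AvoidingIn B x) a b k → a ≢ x → ∀ {z} → z ∈ k ++ [ b ] → z ≢ x
      avoid-x [] ne (here refl) = ne
      avoid-x (_ ∷ _) ne (here refl) = ne
      avoid-x ((_ , _ , q) ∷ p) ne (there i) = avoid-x p q i
      c≢x : c ≢ x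
      c≢x = avoid-x wr₁ w≢x (∈-last r₁)
      wr₁⁻ : Walk (E H⁻) w c r₁
      wr₁⁻ = mapʷ (λ {a} {b} (i , p , q) → toH⁻ (proj₁ (sub a b i)) p q) wr₁
      finish : Dec (c ≡ y) → ⊥
      finish (yes refl) = no-two wL (ww ++ʷ wr₁⁻) λ i j → inj₁ (case ∈-++⁻ lw j of λ
        { (inj₁ j′) → offw j′ (∈-++⁺ˡ i) ; (inj₂ j′) → ⊥-elim (off j′ (∈-++⁺ˡ i)) })
      finish (no c≢y) with toEar wL unL c∈L c≢x | toEar wQ unQ w∈ w≢x
        where
        c∈L : c ∈ L
        c∈L = [ (λ i → i) , (λ e → ⊥-elim (c≢y e)) ]′ (∈-snoc⁻ L c∈)
      ... | l , refl , el | m , refl , em = crossing-ears tl xy (mapEar (λ e → H→G (toH e)) el) em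
             (λ i j → [ (λ { refl → ear-∉ˡ el i }) , (λ { refl → ear-∉ʳ el i }) ]′ (meet (there i) (there j)))
             (strip c∈L c≢x) (strip w∈ w≢x) (reverse⋆ (within-sym (TwoTreeLike.symmetric tl))
               (within-walk (mapʷ (λ e → H→G (toH e)) wr₁⁻) λ i → avoid-x wr₁ w≢x i , ≢y i))
        where
        c∈L : c ∈ x ∷ l
        c∈L = [ (λ i → i) , (λ e → ⊥-elim (c≢y e)) ]′ (∈-snoc⁻ (x ∷ l) c∈)
        strip : ∀ {z k} → z ∈ x ∷ k → z ≢ x → z ∈ k
        strip (here e) ne = ⊥-elim (ne e)
        strip (there i) _ = i
        ≢y : ∀ {z} → z ∈ r₁ ++ [ c ] → z ≢ y
        ≢y i refl with ∈-snoc⁻ r₁ i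
        ... | inj₁ j = off j (∈-last (x ∷ l))
        ... | inj₂ refl = c≢y refl

consec-first∈ : ∀ {n} (l : List (Fin n)) {v p q} → Consec (l ++ [ v ]) p q → p ∈ l
consec-first∈ [] (there ())
consec-first∈ (a ∷ []) here = here refl
consec-first∈ (a ∷ b ∷ l) here = here refl
consec-first∈ (a ∷ l) (there c) = there (consec-first∈ l c)

validSeq-edge : ∀ {n} {K : Graph n} es {a b} → ValidSeq K es → (a , b) ∈ es → E K a b
validSeq-edge (_ ∷ es) ((e , _) , _) (here refl) = e
validSeq-edge {K = K} ((u , v) ∷ es) (_ , _ , val) (there i) = proj₁ (─⁻ K (single u v) (validSeq-edge es val i))

iterative-⊆ : ∀ {n} {G : Graph n} {A a b} → SymG G → Iterative G A → Mem A a b → E G a b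
iterative-⊆ s (es , val , iff) m with Equivalence.to (iff _ _) m
... | inj₁ i = validSeq-edge es val i
... | inj₂ i = s _ _ (validSeq-edge es val i)

walk-cons : ∀ {A : Set} {R : A → A → Set} {u v l} → Walk R u v l → u ≢ v → ∃ λ mid → l ≡ u ∷ mid
walk-cons [] ne = ⊥-elim (ne refl)
walk-cons (_∷_ {l = l} _ _) _ = l , refl

empty-walk : ∀ {A : Set} {R : A → A → Set} {u v l} → Walk R u v l → length l ≡ 0 → u ≡ v
empty-walk [] _ = refl

empty-loop : ∀ {A : Set} {R : A → A → Set} {u l} → Walk R u u l → ¬ u ∈ l → l ≡ []
empty-loop [] _ = refl
empty-loop (_ ∷ _) n = ⊥-elim (n (here refl))

hit-start : ∀ {A : Set} {R : A → A → Set} {u p l} → Walk R u p l → ¬ u ∈ l → u ≡ p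
hit-start [] _ = refl
hit-start (_ ∷ _) n = ⊥-elim (n (here refl))

meets? : ∀ {n} (l m : List (Fin n)) → (∃ λ w → w ∈ l × w ∈ m) ⊎ (∀ {w} → w ∈ l → w ∈ m → ⊥)
meets? l m with Any.any? (λ w → _∈?_ _≟_ w m) l
... | yes a = let w , i , j = find a in inj₁ (w , i , j)
... | no ¬a = inj₂ λ i j → ¬a (lose i j)

module _ {n : ℕ} where

  -- `pairs` and the lists in `HasSize` hold each edge once, smaller endpoint first; this picks that
  -- representative.
  order : Fin n → Fin n → Fin n × Fin n
  order a b with toℕ a ℕ.<? toℕ b
  ... | yes _ = a , b
  ... | no _ = b , a

  order-cases : ∀ a b → order a b ≡ (a , b) ⊎ order a b ≡ (b , a)
  order-cases a b with toℕ a ℕ.<? toℕ b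
  ... | yes _ = inj₁ refl
  ... | no _ = inj₂ refl

  order-∈pairs : ∀ {a b} → a ≢ b → order a b ∈ pairs
  order-∈pairs {a} {b} ne with toℕ a ℕ.<? toℕ b
  ... | yes lt = ∈-pairs⁺ lt
  ... | no nlt = ∈-pairs⁺ (ℕₚ.≤∧≢⇒< (ℕₚ.≮⇒≥ nlt) (λ e → ne (sym (toℕ-injective e))))

  order-unique : ∀ {a b i j} → toℕ i < toℕ j → SamePair a b i j → (i , j) ≡ order a b
  order-unique {a} {b} lt (inj₁ (refl , refl)) with toℕ a ℕ.<? toℕ b
  ... | yes _ = refl
  ... | no nlt = ⊥-elim (nlt lt)
  order-unique {a} {b} lt (inj₂ (refl , refl)) with toℕ a ℕ.<? toℕ b
  ... | yes lt′ = ⊥-elim (ℕₚ.<-asym lt lt′)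
  ... | no _ = refl

-- The two sides of the tree and the edges crossing between them

module Exchange {n : ℕ} (G : Graph n) (tl : TwoTreeLike G) (A : ESet n) (it : Iterative G A) (T : ESet n) (sp : SpanningTree G T)
  (T⊆H : ∀ a b → Mem T a b → E (G ─ A) a b) (x y : Fin n) (bd : Bound A G x y) (Txy : Mem T x y) where

  H : Graph n
  H = G ─ A

  H-sym : SymG H
  H-sym = ─-sym A (TwoTreeLike.symmetric tl)

  H→G : ∀ {a b} → E H a b → E G a b
  H→G e = proj₁ (─⁻ G A e)

  H-loopless : Loopless H
  H-loopless a e = TwoTreeLike.loopless tl a (H→G e)

  xy∈H : E H x y
  xy∈H = T⊆H x y Txy

  x≢y : x ≢ y
  x≢y e = H-loopless x (subst (E H x) (sym e) xy∈H)

  H⁻ : Graph n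
  H⁻ = H ─ single x y

  H⁻→H : ∀ {a b} → E H⁻ a b → E H a b
  H⁻→H e = proj₁ (─⁻ H (single x y) e)

  H⁻-sym : SymG H⁻
  H⁻-sym = ─-sym (single x y) H-sym

  τ T₀ : Graph n
  τ = symm T
  T₀ = τ ─ single x y

  τ-sym : SymG τ
  τ-sym a b = mem-sym T

  T₀-sym : SymG T₀
  T₀-sym = ─-sym (single x y) τ-sym

  T₀-symʷ : ∀ {a b} → E T₀ a b → E T₀ b a
  T₀-symʷ {a} {b} = T₀-sym a b

  T₀→τ : ∀ {a b} → E T₀ a b → E τ a b
  T₀→τ e = proj₁ (─⁻ τ (single x y) e)

  T₀→H⁻ : ∀ {a b} → E T₀ a b → E H⁻ a b
  T₀→H⁻ {a} {b} e = let p , q = ─⁻ τ (single x y) e in ─⁺ H (single x y) (T⊆H a b p) q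

  T₀→H : ∀ {a b} → E T₀ a b → E H a b
  T₀→H {a} {b} e = T⊆H a b (T₀→τ e)

  Side : Fin n → Fin n → Set
  Side r w = Connected T₀ w r

  side : ∀ w → Side x w ⊎ Side y w
  side w = go (proj₁ (proj₂ sp) w x)
    where
    go : ∀ {w} → Star (E τ) w x → Side x w ⊎ Side y w
    go ε = inj₁ ε
    go {w} (_◅_ {j = z} e s) with mem? (single x y) w z
    ... | yes m with mem-single⁻ x y w z m
    ...   | inj₁ (refl , _) = inj₁ ε
    ...   | inj₂ (refl , _) = inj₂ ε
    go (e ◅ s) | no ¬m with go s
    ...   | inj₁ c = inj₁ (─⁺ τ (single x y) e ¬m ◅ c)
    ...   | inj₂ c = inj₂ (─⁺ τ (single x y) e ¬m ◅ c)

  ¬T₀xy : ¬ E T₀ x y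
  ¬T₀xy e = proj₂ (─⁻ τ (single x y) e) (mem-single⁺ x y (inj₁ (refl , refl)))

  -- A simple x-y walk in `T₀` together with xy would be a cycle of the tree.
  separated : ∀ {w} → Side x w → Side y w → ⊥
  separated cx cy with simplify _≟_ (proj₂ (fromStar (reverse⋆ T₀-symʷ cx ◅◅ cy)))
  ... | l , p , un , _ = no-cycle p un
    where
    no-cycle : ∀ {l} → Walk (E T₀) x y l → Unique (l ++ [ y ]) → ⊥
    no-cycle [] _ = x≢y refl
    no-cycle (r ∷ []) _ = ¬T₀xy r
    no-cycle p@(_ ∷ _∷_ {u = w} {l = l} _ _) un = proj₂ (proj₂ sp) (x ∷ w ∷ l ++ [ y ])
      (s≤s (ℕₚ.≤-trans (s≤s z≤n) (ℕₚ.≤-reflexive (sym (snoc-length l)))) , un , toLinked (mapʷ T₀→τ p ++ʷ (τ-sym x y Txy ∷ [])))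

  sideX? : ∀ w → Dec (Side x w)
  sideX? w with side w
  ... | inj₁ c = yes c
  ... | inj₂ c = no λ c′ → separated c′ c

  toSideY : ∀ {w} → ¬ Side x w → Side y w
  toSideY {w} ¬c = [ (λ c → ⊥-elim (¬c c)) , (λ c → c) ]′ (side w)

  walk-side : ∀ {u r l w} → Walk (E T₀) u r l → w ∈ l ++ [ r ] → Side r w
  walk-side p m with split p m
  ... | _ , _ , _ , q , _ = toStar q

  same-side : ∀ {r u v l} → Walk (E T₀) u v l → Side r u → Side r v
  same-side p c = reverse⋆ T₀-symʷ (toStar p) ◅◅ c

  dx dy : Fin n → ℕ
  dx w = dist T₀ w x
  dy w = dist T₀ w y

  -- What is left of a walk in the tree once opposite passages of xy cancel: no passage, one from x
  -- to y, or one from y to x. Cancelling only shortens the walk.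
  TreeWalk : Fin n → Fin n → ℕ → Set
  TreeWalk u v k = (∃ λ m → Walk (E T₀) u v m × length m ≤ k)
    ⊎ (∃₂ λ m₁ m₂ → Walk (E T₀) u x m₁ × Walk (E T₀) y v m₂ × length m₁ + suc (length m₂) ≤ k)
    ⊎ (∃₂ λ m₁ m₂ → Walk (E T₀) u y m₁ × Walk (E T₀) x v m₂ × length m₁ + suc (length m₂) ≤ k)

  tree-walk : ∀ {u v l} → Walk (E τ) u v l → TreeWalk u v (length l)
  tree-walk [] = inj₁ ([] , [] , z≤n)
  tree-walk {u} (_∷_ {w = w} e p) with mem? (single x y) u w | tree-walk p
  ... | no ¬m | inj₁ (m , q , le) = inj₁ (_ , ─⁺ τ (single x y) e ¬m ∷ q , s≤s le)
  ... | no ¬m | inj₂ (inj₁ (m₁ , m₂ , q₁ , q₂ , le)) = inj₂ (inj₁ (_ , m₂ , ─⁺ τ (single x y) e ¬m ∷ q₁ , q₂ , s≤s le))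
  ... | no ¬m | inj₂ (inj₂ (m₁ , m₂ , q₁ , q₂ , le)) = inj₂ (inj₂ (_ , m₂ , ─⁺ τ (single x y) e ¬m ∷ q₁ , q₂ , s≤s le))
  ... | yes mm | ih with mem-single⁻ x y u w mm
  ...   | inj₁ (refl , refl) = case ih of λ
    { (inj₁ (m , q , le)) → inj₂ (inj₁ ([] , m , [] , q , s≤s le))
    ; (inj₂ (inj₁ (_ , _ , q , _))) → ⊥-elim (separated (toStar q) ε)
    ; (inj₂ (inj₂ (m₁ , m₂ , _ , q , le))) → inj₁ (m₂ , q , ℕₚ.m≤n⇒m≤1+n (ℕₚ.≤-trans (ℕₚ.n≤1+n _) (ℕₚ.≤-trans (ℕₚ.m≤n+m _ (length m₁)) le))) }
  ...   | inj₂ (refl , refl) = case ih of λ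
    { (inj₁ (m , q , le)) → inj₂ (inj₂ ([] , m , [] , q , s≤s le))
    ; (inj₂ (inj₂ (_ , _ , q , _))) → ⊥-elim (separated ε (toStar q))
    ; (inj₂ (inj₁ (m₁ , m₂ , _ , q , le))) → inj₁ (m₂ , q , ℕₚ.m≤n⇒m≤1+n (ℕₚ.≤-trans (ℕₚ.n≤1+n _) (ℕₚ.≤-trans (ℕₚ.m≤n+m _ (length m₁)) le))) }

  dist-rev : ∀ {u v l} → Walk (E T₀) u v l → dist T₀ v u ≤ length l
  dist-rev {l = l} p with reverseʷ T₀-symʷ p
  ... | l′ , p′ , eq = subst (dist T₀ _ _ ≤_) (reverse-walk-length {l = l} eq) (dist-≤ T₀ p′)

  -- One half of d(u,v) = d(u,x) + 1 + d(y,v). Losses and gains are both measured against this lower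
  -- bound.
  cross-lower : ∀ {u v} → Side x u → Side y v → dx u + suc (dy v) ≤ dist τ u v
  cross-lower {u} {v} cu cv with geodesic τ (proj₁ (proj₂ sp) u v)
  ... | l , p , _ , eq with tree-walk p
  ...   | inj₁ (_ , q , _) = ⊥-elim (separated (same-side q cu) cv)
  ...   | inj₂ (inj₁ (m₁ , m₂ , q₁ , q₂ , le)) = ℕₚ.≤-trans (ℕₚ.+-mono-≤ (dist-≤ T₀ q₁) (s≤s (dist-rev q₂))) (subst (_ ≤_) eq le)
  ...   | inj₂ (inj₂ (_ , _ , q , _)) = ⊥-elim (separated cu (toStar q))

  noncross-walk : ∀ {r u v} → r ≡ x ⊎ r ≡ y → Side r u → Side r v → ∃ λ m → Walk (E T₀) u v m × length m ≤ dist τ u v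
  noncross-walk {r} {u} {v} r∈ cu cv with geodesic τ (proj₁ (proj₂ sp) u v)
  ... | l , p , _ , eq with tree-walk p | r∈
  ...   | inj₁ (m , q , le) | _ = m , q , subst (_ ≤_) eq le
  ...   | inj₂ (inj₁ (_ , _ , _ , q , _)) | inj₁ refl = ⊥-elim (separated cv (reverse⋆ T₀-symʷ (toStar q)))
  ...   | inj₂ (inj₁ (_ , _ , q , _)) | inj₂ refl = ⊥-elim (separated (toStar q) cu)
  ...   | inj₂ (inj₂ (_ , _ , q , _)) | inj₁ refl = ⊥-elim (separated cu (toStar q))
  ...   | inj₂ (inj₂ (_ , _ , _ , q , _)) | inj₂ refl = ⊥-elim (separated (reverse⋆ T₀-symʷ (toStar q)) cv)

  Candidate : Fin n × Fin n → Set
  Candidate (a , b) = Side x a × Side y b × E H a b × ¬ (a ≡ x × b ≡ y)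

  cross-edge : ∀ {a b} → Side x a → Side y b → ¬ (a ≡ x × b ≡ y) → ¬ Mem (single x y) a b
  cross-edge {a} {b} ca cb ne m with mem-single⁻ x y a b m
  ... | inj₁ p = ne p
  ... | inj₂ (refl , _) = separated ca ε

  -- As xy is not a bridge, x and y are joined in `H⁻`, and a joining walk has to change sides.
  -- Negating `Bridge` yields the connection only under a double negation.
  ¬¬-candidate : ¬ ¬ ∃ Candidate
  ¬¬-candidate c = proj₂ bd (xy∈H , λ conn → found (proj₂ (fromStar conn)))
    where
    found : ∀ {l} → Walk (E H⁻) x y l → ⊥
    found p with firstExit sideX? p ε (λ s → separated s ε)
    ... | a , b , _ , _ , _ , e , _ , _ , sa , ¬sb = c ((a , b) , sa , toSideY ¬sb , H⁻→H e ,
          λ { (refl , refl) → proj₂ (─⁻ H (single x y) e) (mem-single⁺ x y (inj₁ (refl , refl))) })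

  no-two : ∀ {l m} → Walk (E H⁻) x y l → Walk (E H⁻) x y m → MeetOnly x y l m → ⊥
  no-two p q d = proj₂ (proj₁ bd) (disjoint-walks⇒internal {K = H} H-sym H-loopless xy∈H p q d)

  exchange : Fin n → Fin n → ESet n
  exchange a b u v = T₀ u v ∨ single a b u v

  -- Replacing xy by a crossing edge ab

  module Swap (a b : Fin n) (cand : Candidate (a , b)) where

    sa : Side x a
    sa = proj₁ cand

    sb : Side y b
    sb = proj₁ (proj₂ cand)

    T′ : ESet n
    T′ = exchange a b

    τ′ : Graph n
    τ′ = symm T′

    τ′-sym : SymG τ′
    τ′-sym u v = mem-sym T′

    T₀→τ′ : ∀ {u v} → E T₀ u v → E τ′ u v
    T₀→τ′ e = ∨-left (∨-left e)

    ab∈τ′ : E τ′ a b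
    ab∈τ′ = ∨-left (∨-right {T₀ a b} (single-self a b))

    τ′⁻ : ∀ {u v} → E τ′ u v → E T₀ u v ⊎ SamePair a b u v
    τ′⁻ {u} {v} e with ∨-split {T′ u v} e
    ... | inj₁ p = [ inj₁ , (λ q → inj₂ (mem-single⁻ a b u v (∨-left q))) ]′ (∨-split {T₀ u v} p)
    ... | inj₂ p = [ (λ q → inj₁ (T₀-symʷ q)) , (λ q → inj₂ (mem-single⁻ a b u v (∨-right {single a b u v} q))) ]′ (∨-split {T₀ v u} p)

    ab⁻ : E H⁻ a b
    ab⁻ = ─⁺ H (single x y) (proj₁ (proj₂ (proj₂ cand))) (cross-edge sa sb (proj₂ (proj₂ (proj₂ cand))))

    T′⊆ : ∀ u v → Mem T′ u v → E (G ─ (A ∪ single x y)) u v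
    T′⊆ u v m = ─⁺ G (A ∪ single x y) (H→G (H⁻→H h)) λ z → [ proj₂ (─⁻ G A (H⁻→H h)) , proj₂ (─⁻ H (single x y) h) ]′ (mem-∪⁻ A (single x y) z)
      where
      h : E H⁻ u v
      h with τ′⁻ {u} {v} m
      ... | inj₁ e = T₀→H⁻ e
      ... | inj₂ (inj₁ (refl , refl)) = ab⁻
      ... | inj₂ (inj₂ (refl , refl)) = H⁻-sym _ _ ab⁻

    connected′ : ∀ u v → Connected τ′ u v
    connected′ u v = toX u ◅◅ reverse⋆ (λ {c} {d} → τ′-sym c d) (toX v)
      where
      up : ∀ {c d} → Star (E T₀) c d → Star (E τ′) c d
      up = gmap (λ z → z) T₀→τ′
      toX : ∀ w → Connected τ′ w x
      toX w with side w
      ... | inj₁ c = up c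
      ... | inj₂ c = up (c ◅◅ reverse⋆ T₀-symʷ sb) ◅◅ (τ′-sym _ _ ab∈τ′ ◅ up sa)

    uses-ab : ∀ {u v l} → Walk (E τ′) u v l → Walk (E T₀) u v l ⊎ PathEdge (l ++ [ v ]) a b
    uses-ab [] = inj₁ []
    uses-ab (e ∷ p) with τ′⁻ e | uses-ab p
    ... | _ | inj₂ (inj₁ c) = inj₂ (inj₁ (there c))
    ... | _ | inj₂ (inj₂ c) = inj₂ (inj₂ (there c))
    ... | inj₁ e₀ | inj₁ q = inj₁ (e₀ ∷ q)
    ... | inj₂ (inj₁ (refl , refl)) | inj₁ q = inj₂ (inj₁ (consec-start q))
    ... | inj₂ (inj₂ (refl , refl)) | inj₁ q = inj₂ (inj₂ (consec-start q))

    ¬T₀ab : ¬ Connected T₀ a b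
    ¬T₀ab c = separated sa (c ◅◅ sb)

    -- A cycle through ab opens to an ear from a to b. Either the ear lies in `T₀` and connects the
    -- two sides, or it contains ab once more, which a simple ear cannot.
    acyclic : ∀ C → ¬ IsCycle τ′ C
    acyclic C@(z ∷ r) cyc@(le , un , lk) with uses-ab (fromLinked r lk)
    ... | inj₁ p = proj₂ (proj₂ sp) C (le , un , toLinked (mapʷ T₀→τ p))
    ... | inj₂ pe = closed-off (open-at C (λ c d → τ′-sym c d) cyc pe)
      where
      closed-off : OpenedCycle τ′ C a b → ⊥
      closed-off (opened {l} e _ _ _ _) with uses-ab (ear-walk e)
      ... | inj₁ p = ¬T₀ab (toStar p)
      ... | inj₂ (inj₁ c) = Ear.proper e (successor-unique (Ear.simple e) (consec-start (Ear.walk e)) c)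
      ... | inj₂ (inj₂ c) = proj₂ (proj₂ (unique-++⁻ (a ∷ l) (Ear.simple e))) (consec-first∈ (a ∷ l) c) (here refl)

    spanning′ : SpanningTree G T′
    spanning′ = (λ u v m → proj₁ (─⁻ G (A ∪ single x y) (T′⊆ u v m))) , connected′ , acyclic

    -- The unit of account: the most that rerouting from xy to ab can add to a path, and what it
    -- saves on a path that ran through a and b.
    m : ℕ
    m = dx a + dy b

    cross-upper : ∀ {u v k k′} → Walk (E T₀) u a k → Walk (E T₀) v b k′ → dist τ′ u v ≤ length k + suc (length k′)
    cross-upper {k = k} {k′} p q with reverseʷ T₀-symʷ q
    ... | r , q′ , eq = ℕₚ.≤-trans (dist-≤ τ′ (mapʷ T₀→τ′ p ++ʷ (ab∈τ′ ∷ mapʷ T₀→τ′ q′)))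
      (ℕₚ.≤-reflexive (trans (length-++ k) (cong (λ z → length k + suc z) (reverse-walk-length {l = k′} eq))))

    noncross-upper : ∀ {r u v} → r ≡ x ⊎ r ≡ y → Side r u → Side r v → dist τ′ u v ≤ dist τ u v
    noncross-upper r∈ cu cv with noncross-walk r∈ cu cv
    ... | l , p , le = ℕₚ.≤-trans (dist-≤ τ′ (mapʷ T₀→τ′ p)) le

    dist′-sym : ∀ u v → dist τ′ u v ≤ dist τ′ v u
    dist′-sym u v = dist-sym τ′ τ′-sym (connected′ v u)

    τdist-sym : ∀ u v → dist τ u v ≤ dist τ v u
    τdist-sym u v = dist-sym τ τ-sym (proj₁ (proj₂ sp) v u)

    -- The route goes from u to x to a, across ab, and from b to y to v.
    cross-worst : ∀ {u v} → Side x u → Side y v → dist τ′ u v ≤ dist τ u v + m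
    cross-worst {u} {v} cu cv with geodesic T₀ cu | geodesic T₀ cv | geodesic T₀ sa | geodesic T₀ sb
    ... | lu , wu , _ , eu | lv , wv , _ , ev | la , wa , _ , ea | lb , wb , _ , eb with reverseʷ T₀-symʷ wa | reverseʷ T₀-symʷ wb
    ...   | ra , wa′ , ra≡ | rb , wb′ , rb≡ = begin
      dist τ′ u v                                        ≤⟨ cross-upper (wu ++ʷ wa′) (wv ++ʷ wb′) ⟩
      length (lu ++ ra) + suc (length (lv ++ rb))        ≡⟨ cong₂ (λ c d → c + suc d) (trans (length-++ lu) (cong₂ _+_ eu (trans (reverse-walk-length {l = la} ra≡) ea)))
                                                             (trans (length-++ lv) (cong₂ _+_ ev (trans (reverse-walk-length {l = lb} rb≡) eb))) ⟩
      (dx u + dx a) + suc (dy v + dy b)                  ≡⟨ solve 4 (λ p q r s → (p :+ q) :+ (con 1 :+ (r :+ s)) := (p :+ (con 1 :+ r)) :+ (q :+ s)) refl (dx u) (dx a) (dy v) (dy b) ⟩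
      (dx u + suc (dy v)) + m                            ≤⟨ ℕₚ.+-monoˡ-≤ m (cross-lower cu cv) ⟩
      dist τ u v + m ∎
      where
      open ℕₚ.≤-Reasoning
      open +-*-Solver

    worst : ∀ u v → dist τ′ u v ≤ dist τ u v + m
    worst u v with side u | side v
    ... | inj₁ cu | inj₁ cv = ℕₚ.≤-trans (noncross-upper (inj₁ refl) cu cv) (ℕₚ.m≤m+n _ m)
    ... | inj₂ cu | inj₂ cv = ℕₚ.≤-trans (noncross-upper (inj₂ refl) cu cv) (ℕₚ.m≤m+n _ m)
    ... | inj₁ cu | inj₂ cv = cross-worst cu cv
    ... | inj₂ cu | inj₁ cv = ℕₚ.≤-trans (dist′-sym u v) (ℕₚ.≤-trans (cross-worst cv cu) (ℕₚ.+-monoˡ-≤ m (τdist-sym v u)))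

    -- The inequalities say that a lies on the tree path from u to x, and b on the one from v to y.
    Through : Fin n → Fin n → Set
    Through u v = (∃ λ k → Walk (E T₀) u a k × length k + dx a ≤ dx u) × (∃ λ k → Walk (E T₀) v b k × length k + dy b ≤ dy v)

    through-gain : ∀ {u v} → Side x u → Side y v → Through u v → dist τ′ u v + m ≤ dist τ u v
    through-gain {u} {v} cu cv ((k , wk , le) , (k′ , wk′ , le′)) = begin
      dist τ′ u v + m                                   ≤⟨ ℕₚ.+-monoˡ-≤ m (cross-upper wk wk′) ⟩
      length k + suc (length k′) + (dx a + dy b)        ≡⟨ solve 4 (λ p q r s → (p :+ (con 1 :+ q)) :+ (r :+ s) := (p :+ r) :+ (con 1 :+ (q :+ s))) refl (length k) (length k′) (dx a) (dy b) ⟩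
      (length k + dx a) + suc (length k′ + dy b)        ≤⟨ ℕₚ.+-mono-≤ le (s≤s le′) ⟩
      dx u + suc (dy v)                                 ≤⟨ cross-lower cu cv ⟩
      dist τ u v ∎
      where
      open ℕₚ.≤-Reasoning
      open +-*-Solver

    through-gain′ : ∀ {u v} → Side x u → Side y v → Through u v → dist τ′ v u + m ≤ dist τ v u
    through-gain′ {u} {v} cu cv t = ℕₚ.≤-trans (ℕₚ.+-monoˡ-≤ m (dist′-sym v u)) (ℕₚ.≤-trans (through-gain cu cv t) (τdist-sym u v))

  reverse₀ : ∀ {u v l} → Walk (E T₀) u v l → ∃ λ l′ → Walk (E T₀) v u l′ × l′ ++ [ u ] ≡ reverse (l ++ [ v ])
  reverse₀ = reverseʷ T₀-symʷ

  sides-disjoint : ∀ {u v l m w} → Walk (E T₀) u x l → Walk (E T₀) v y m → w ∈ l ++ [ x ] → w ∈ m ++ [ y ] → ⊥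
  sides-disjoint p q i j = separated (walk-side p i) (walk-side q j)

  -- The nearest crossing edge: who can lose

  module Nearest (a b : Fin n) (cand : Candidate (a , b))
    (min : ∀ c → Candidate c → dx a + dy b ≤ dx (proj₁ c) + dy (proj₂ c))
    (ra lb : List (Fin n)) (wra : Walk (E T₀) x a ra) (wb : Walk (E T₀) b y lb)
    (una : Unique (ra ++ [ a ])) (unb : Unique (lb ++ [ y ])) (|ra| : length ra ≡ dx a) (|lb| : length lb ≡ dy b) where

    open Swap a b cand

    private
      -- The cycle that ab closes in the tree, with its edge xy left out.
      L : List (Fin n)
      L = ra ++ a ∷ lb

      wL : Walk (E H⁻) x y L
      wL = mapʷ T₀→H⁻ wra ++ʷ (ab⁻ ∷ mapʷ T₀→H⁻ wb)

      L≡ : L ++ [ y ] ≡ (ra ++ [ a ]) ++ (lb ++ [ y ])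
      L≡ = trans (++-assoc ra (a ∷ lb) [ y ]) (sym (++-assoc ra [ a ] (lb ++ [ y ])))

      ra-side : ∀ {w} → w ∈ ra ++ [ a ] → Side x w
      ra-side i with split wra i
      ... | _ , _ , w , _ = reverse⋆ T₀-symʷ (toStar w)

      L-cases : ∀ {w} → w ∈ L ++ [ y ] → w ∈ ra ++ [ a ] ⊎ w ∈ lb ++ [ y ]
      L-cases i = ∈-++⁻ (ra ++ [ a ]) (subst (_ ∈_) L≡ i)

      unL : Unique (L ++ [ y ])
      unL = subst Unique (sym L≡) (unique-++⁺ una unb (λ i j → separated (ra-side i) (walk-side wb j)))

    -- Since (a , b) is not (x , y), one of a and b is an inner vertex of `L`.
    earE : ∃ λ l → Ear H x y l
    earE with a ≟ x
    ... | no a≢x = let l , _ , e = toEar wL unL (∈-++⁺ʳ ra (here refl)) a≢x in l , mapEar H⁻→H e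
    ... | yes a≡x = let l , _ , e = toEar wL unL (∈-++⁺ʳ ra (there b∈)) (λ b≡x → separated (subst (Side x) (sym b≡x) ε) sb) in l , mapEar H⁻→H e
      where
      b∈ : b ∈ lb
      b∈ = [ (λ i → i) , (λ b≡y → ⊥-elim (proj₂ (proj₂ (proj₂ cand)) (a≡x , b≡y))) ]′ (∈-snoc⁻ lb (start∈ wb))

    -- The case in which the tree paths from u and v meet the cycle of ab at x and y only. The
    -- reversed path `ku` is stored for building the route from x over u and v to y.
    record AtE (u v : Fin n) : Set where
      constructor atE
      field
        {lu lv ku} : List (Fin n)
        wu : Walk (E T₀) u x lu
        wv : Walk (E T₀) v y lv
        wku : Walk (E T₀) x u ku
        ku≡ : ku ++ [ u ] ≡ reverse (lu ++ [ x ])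
        unu : Unique (lu ++ [ x ])
        unv : Unique (lv ++ [ y ])
        offu : ∀ {w} → w ∈ lu → ¬ w ∈ L ++ [ y ]
        offv : ∀ {w} → w ∈ lv → ¬ w ∈ L ++ [ y ]

    -- Let the tree paths from u and v first meet the cycle through xy and ab at p and q. An edge pq must be present by
    -- ear⇒chord, and it would be a nearer candidate unless pq is ab or xy.
    junction : ∀ {u v} → Side x u → Side y v → E G u v → Through u v ⊎ AtE u v
    junction {u} {v} cu cv uv with geodesic T₀ cu | geodesic T₀ cv
    ... | lu , wu , unu , eu | lv , wv , unv , ev
      with firstHit (λ w → _∈?_ _≟_ w (ra ++ [ a ])) wu (start∈ wra) | firstHit (λ w → _∈?_ _≟_ w (lb ++ [ y ])) wv (∈-last lb)
    ...   | p , lu₁ , lu₂ , wu₁ , wu₂ , refl , p∈ , offu | q , lv₁ , lv₂ , wv₁ , wv₂ , refl , q∈ , offv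
      with split wra p∈ | split wb q∈ | reverse₀ wu₁
    ...     | l₁ , l₂ , w₁ , w₂ , ra≡₁ | r₁ , r₂ , w₃ , w₄ , lb≡₁ | k₀ , wk₀ , k₀≡ = decide (p ≟ x) (q ≟ y)
      where
      sp′ : Side x p
      sp′ = toStar wu₂
      sq : Side y q
      sq = toStar wv₂
      p≢q : p ≢ q
      p≢q e = separated sp′ (subst (Side y) (sym e) sq)
      offU : ∀ {w} → w ∈ lu₁ → ¬ w ∈ L ++ [ y ]
      offU i j with L-cases j
      ... | inj₁ j′ = offu i j′
      ... | inj₂ j′ = sides-disjoint wu wb (∈-++⁺ˡ (∈-++⁺ˡ i)) j′
      offV : ∀ {w} → w ∈ lv₁ → ¬ w ∈ L ++ [ y ]
      offV i j with L-cases j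
      ... | inj₁ j′ = separated (ra-side j′) (walk-side wv (∈-++⁺ˡ (∈-++⁺ˡ i)))
      ... | inj₂ j′ = offv i j′
      L≡′ : L ≡ l₁ ++ (l₂ ++ a ∷ r₁) ++ r₂
      L≡′ = trans (cong₂ (λ c d → c ++ a ∷ d) ra≡₁ lb≡₁) (trans (++-assoc l₁ l₂ _) (cong (l₁ ++_) (sym (++-assoc l₂ (a ∷ r₁) r₂))))
      off-u : ∀ {w} → w ∈ lu₁ ++ [ p ] → w ∈ L ++ [ y ] → w ≡ p
      off-u i j = [ (λ i′ → ⊥-elim (offU i′ j)) , (λ e → e) ]′ (∈-snoc⁻ lu₁ i)
      off-k : ∀ {w} → w ∈ k₀ ++ u ∷ lv₁ → w ∈ L ++ [ y ] → w ≡ p ⊎ w ≡ q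
      off-k i j with ∈-++⁻ k₀ i
      ... | inj₁ i′ = inj₁ (off-u (reverse-walk-∈ {l = lu₁} k₀≡ (∈-++⁺ˡ i′)) j)
      ... | inj₂ (here refl) = inj₁ (off-u (start∈ wu₁) j)
      ... | inj₂ (there i′) = ⊥-elim (offV i′ j)
      chord : E H p q
      chord = ear⇒chord {G = G} {A} tl it p≢q (mapʷ T₀→H w₁) (mapʷ T₀→H w₂ ++ʷ (H⁻→H ab⁻ ∷ mapʷ T₀→H w₃)) (mapʷ T₀→H w₄) xy∈H
        (subst (λ z → Unique (z ++ [ y ])) L≡′ unL)
        (mapʷ (λ e → H→G (T₀→H e)) wk₀ ++ʷ (uv ∷ mapʷ (λ e → H→G (T₀→H e)) wv₁))
        (λ i j → off-k i (subst (λ z → _ ∈ z ++ [ y ]) (sym L≡′) j))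
      near : ¬ (p ≡ x × q ≡ y) → Through u v
      near ne = (lu₁ , subst (λ z → Walk (E T₀) u z lu₁) p≡a wu₁ , leu) , (lv₁ , subst (λ z → Walk (E T₀) v z lv₁) q≡b wv₁ , lev)
        where
        open +-*-Solver
        -- `l₂` runs from p to a and `r₁` from b to q. The chord pq is a candidate, so minimality of
        -- ab leaves them no length.
        le : length l₂ + length r₁ ≤ 0
        le = ℕₚ.+-cancelˡ-≤ (length l₁ + length r₂) _ _ (begin
          (length l₁ + length r₂) + (length l₂ + length r₁) ≡⟨ solve 4 (λ p q r s → (p :+ q) :+ (r :+ s) := (p :+ r) :+ (s :+ q)) refl (length l₁) (length r₂) (length l₂) (length r₁) ⟩
          (length l₁ + length l₂) + (length r₁ + length r₂) ≡⟨ cong₂ _+_ (sym (length-++ l₁)) (sym (length-++ r₁)) ⟩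
          length (l₁ ++ l₂) + length (r₁ ++ r₂)             ≡⟨ cong₂ _+_ (trans (cong length (sym ra≡₁)) |ra|) (trans (cong length (sym lb≡₁)) |lb|) ⟩
          dx a + dy b                                       ≤⟨ min (p , q) (sp′ , sq , chord , ne) ⟩
          dx p + dy q                                       ≤⟨ ℕₚ.+-mono-≤ (dist-rev w₁) (dist-≤ T₀ w₄) ⟩
          length l₁ + length r₂                             ≡⟨ ℕₚ.+-identityʳ _ ⟨
          length l₁ + length r₂ + 0 ∎)
          where open ℕₚ.≤-Reasoning
        p≡a : p ≡ a
        p≡a = empty-walk w₂ (ℕₚ.m+n≡0⇒m≡0 (length l₂) (ℕₚ.n≤0⇒n≡0 le))
        q≡b : q ≡ b
        q≡b = sym (empty-walk w₃ (ℕₚ.m+n≡0⇒n≡0 (length l₂) (ℕₚ.n≤0⇒n≡0 le)))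
        leu : length lu₁ + dx a ≤ dx u
        leu = ℕₚ.≤-trans (ℕₚ.+-monoʳ-≤ (length lu₁) (dist-≤ T₀ (subst (λ z → Walk (E T₀) z x lu₂) p≡a wu₂)))
          (ℕₚ.≤-reflexive (trans (sym (length-++ lu₁)) eu))
        lev : length lv₁ + dy b ≤ dy v
        lev = ℕₚ.≤-trans (ℕₚ.+-monoʳ-≤ (length lv₁) (dist-≤ T₀ (subst (λ z → Walk (E T₀) z y lv₂) q≡b wv₂)))
          (ℕₚ.≤-reflexive (trans (sym (length-++ lv₁)) ev))
      prefix-unique : ∀ {k₁ k₂ : List (Fin n)} {r} → Unique ((k₁ ++ k₂) ++ [ r ]) → ¬ r ∈ k₁ → Unique (k₁ ++ [ r ])
      prefix-unique {k₁} {k₂} {r} un r∉ = unique-++⁺ (proj₁ (unique-++⁻ k₁ (subst Unique (++-assoc k₁ k₂ [ r ]) un))) ([] ∷ []) λ { i (here refl) → r∉ i }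
      decide : Dec (p ≡ x) → Dec (q ≡ y) → Through u v ⊎ AtE u v
      decide (yes refl) (yes refl) = inj₂ (atE wu₁ wv₁ wk₀ k₀≡ (prefix-unique unu (λ i → offu i p∈)) (prefix-unique unv (λ i → offv i q∈)) offU offV)
      decide (no ne) _ = inj₁ (near (λ e → ne (proj₁ e)))
      decide _ (no ne) = inj₁ (near (λ e → ne (proj₂ e)))

    module _ {u v : Fin n} (j : AtE u v) where
      open AtE j

      private
        -- The route from x to u, across uv, and from v to y; uv may be a deleted edge, in which
        -- case this is a walk in `G` and not in `H`.
        Q : List (Fin n)
        Q = ku ++ u ∷ lv

        Q-cases : ∀ {w} → w ∈ Q → w ≡ x ⊎ w ∈ lu ⊎ w ∈ lv
        Q-cases i with ∈-++⁻ (ku ++ [ u ]) (subst (_ ∈_) (sym (++-assoc ku [ u ] lv)) i)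
        ... | inj₂ i′ = inj₂ (inj₂ i′)
        ... | inj₁ i′ = [ (λ z → inj₂ (inj₁ z)) , inj₁ ]′ (∈-snoc⁻ lu (reverse-walk-∈ {l = lu} ku≡ i′))

        meet : MeetOnly x y L Q
        meet i i′ with Q-cases i′
        ... | inj₁ e = inj₁ e
        ... | inj₂ (inj₁ k) = ⊥-elim (offu k (∈-++⁺ˡ i))
        ... | inj₂ (inj₂ k) = ⊥-elim (offv k (∈-++⁺ˡ i))

      -- With uv still in `H`, `L` and `Q` would be two disjoint detours of xy, and xy would be
      -- internal.
      atE-not-H : E H u v → ¬ (u ≡ x × v ≡ y) → ⊥
      atE-not-H uv ne = no-two wL (mapʷ T₀→H⁻ wku ++ʷ (─⁺ H (single x y) uv (cross-edge (toStar wu) (toStar wv) ne) ∷ mapʷ T₀→H⁻ wv)) meet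

      module _ (uv : E G u v) {B : Subgraph} (comp : TwoConnComp H B) (inB : InE B x y) where

        private
          sub : IsSubgraphOf B H
          sub = proj₁ comp
          Vx : InV B x
          Vx = proj₁ (proj₂ (sub x y inB))
          Vy : InV B y
          Vy = proj₂ (proj₂ (sub x y inB))

          T₀→G : ∀ {a b} → E T₀ a b → E G a b
          T₀→G e = H→G (T₀→H e)

          wQ : Walk (E G) x y Q
          wQ = mapʷ T₀→G wku ++ʷ (uv ∷ mapʷ T₀→G wv)

          unQ : Unique (Q ++ [ y ])
          unQ = subst Unique (trans (++-assoc ku [ u ] (lv ++ [ y ])) (sym (++-assoc ku (u ∷ lv) [ y ])))
            (unique-++⁺ (subst Unique (sym ku≡) (unique-reverse unu)) unv
              λ i k → sides-disjoint wu wv (reverse-walk-∈ {l = lu} ku≡ i) k)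

          lu∈Q : ∀ {w} → w ∈ lu → w ∈ Q
          lu∈Q i with ∈-++⁻ ku (reverse-walk-∈′ {l′ = ku} {l = lu} ku≡ (∈-++⁺ˡ i))
          ... | inj₁ k = ∈-++⁺ˡ k
          ... | inj₂ (here refl) = ∈-++⁺ʳ ku (here refl)

          -- The tree path from x out to w meets `L` at x only, which is the access to w that
          -- `off-block` asks for.
          offBx : ∀ {w} → w ∈ lu → ¬ InV B w
          offBx {w} i with split wu (∈-++⁺ˡ i)
          ... | _ , k₂ , _ , w₂ , lu≡ with reverse₀ w₂
          ...   | k , wk , k≡ = off-block {G = G} {A} tl it {B = B} {H⁻ = H⁻} H⁻→H
                    (λ {c} {d} e c≢x d≢x → ─⁺ H (single x y) e λ m → case mem-single⁻ x y c d m of λ { (inj₁ (p , _)) → c≢x p ; (inj₂ (_ , p)) → d≢x p })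
                    (H→G xy∈H) no-two (proj₁ (proj₂ comp)) sub Vx Vy wL unL wQ unQ meet (lu∈Q i) w≢x
                    (λ { refl → separated (walk-side wu (∈-++⁺ˡ i)) ε }) (mapʷ T₀→H⁻ wk) off
            where
            w≢x : w ≢ x
            w≢x refl = proj₂ (proj₂ (unique-++⁻ lu unu)) i (here refl)
            off : ∀ {z} → z ∈ k → z ∈ L ++ [ y ] → z ≡ x
            off m l with ∈-snoc⁻ k₂ (reverse-walk-∈ {l = k₂} k≡ (∈-++⁺ˡ m))
            ... | inj₁ m′ = ⊥-elim (offu (subst (_ ∈_) (sym lu≡) (∈-++⁺ʳ _ m′)) l)
            ... | inj₂ e = e

          no-two′ : ∀ {l m} → Walk (E H⁻) y x l → Walk (E H⁻) y x m → MeetOnly y x l m → ⊥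
          no-two′ {l} {m} p q d with reverseʷ (λ {c} {d} → H⁻-sym c d) p | reverseʷ (λ {c} {d} → H⁻-sym c d) q
          ... | l′ , p′ , e₁ | m′ , q′ , e₂ = no-two p′ q′ (meetOnly-reverse {l = l} {m} e₁ e₂ d)

          -- The mirror image: all walks are reversed, so that y takes the part of x.
          offBy : ∀ {w} → w ∈ lv → ¬ InV B w
          offBy {w} i with split wv (∈-++⁺ˡ i)
          ... | _ , k₂ , _ , w₂ , lv≡ with reverse₀ w₂ | reverseʷ (λ {c} {d} → H⁻-sym c d) wL | reverseʷ (λ {c} {d} → TwoTreeLike.symmetric tl c d) wQ
          ...   | k , wk , k≡ | L′ , wL′ , L′≡ | Q′ , wQ′ , Q′≡ = off-block {G = G} {A} tl it {B = B} {H⁻ = H⁻} H⁻→H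
                    (λ {c} {d} e c≢y d≢y → ─⁺ H (single x y) e λ m → case mem-single⁻ x y c d m of λ { (inj₁ (_ , p)) → d≢y p ; (inj₂ (p , _)) → c≢y p })
                    (TwoTreeLike.symmetric tl _ _ (H→G xy∈H)) no-two′ (proj₁ (proj₂ comp)) sub Vy Vx
                    wL′ (subst Unique (sym L′≡) (unique-reverse unL)) wQ′ (subst Unique (sym Q′≡) (unique-reverse unQ))
                    (meetOnly-reverse {l = L} {Q} L′≡ Q′≡ meet) w∈Q′ w≢y w≢x (mapʷ T₀→H⁻ wk) off
            where
            w≢y : w ≢ y
            w≢y refl = proj₂ (proj₂ (unique-++⁻ lv unv)) i (here refl)
            w≢x : w ≢ x
            w≢x refl = separated ε (walk-side wv (∈-++⁺ˡ i))
            w∈Q′ : w ∈ Q′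
            w∈Q′ = [ (λ z → z) , (λ e → ⊥-elim (w≢x e)) ]′ (∈-snoc⁻ Q′ (reverse-walk-∈′ {l′ = Q′} {l = Q} Q′≡ (∈-++⁺ˡ (∈-++⁺ʳ ku (there i)))))
            off : ∀ {z} → z ∈ k → z ∈ L′ ++ [ x ] → z ≡ y
            off m l with ∈-snoc⁻ k₂ (reverse-walk-∈ {l = k₂} k≡ (∈-++⁺ˡ m))
            ... | inj₁ m′ = ⊥-elim (offv (subst (_ ∈_) (sym lv≡) (∈-++⁺ʳ _ m′)) (reverse-walk-∈ {l = L} L′≡ l))
            ... | inj₂ e = e

        -- The witnessing path is the tree path of uv through xy. Its two arms stay outside the
        -- block, so it shares with the block nothing but xy.
        atE-sup : Mem A u v → Sup A G x y u v
        atE-sup mem with reverse₀ wv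
        ... | rv , wrv , rv≡ = mem , B , comp , inB , P , ((proj₁ P≡ , cong (_++ [ v ]) (proj₂ P≡)) , toLinked wP , unP) ,
              (λ w → mk⇔ (λ (i , V) → ends i V) (from w)) , λ p q → mk⇔ (λ (e , i) → edge p q e i) (unedge p q)
          where
          P : List (Fin n)
          P = (lu ++ x ∷ rv) ++ [ v ]
          wP : Walk (E H) u v (lu ++ x ∷ rv)
          wP = mapʷ T₀→H wu ++ʷ (xy∈H ∷ mapʷ T₀→H wrv)
          P≡ : ∃ λ mid → lu ++ x ∷ rv ≡ u ∷ mid
          P≡ = walk-cons wP (λ { refl → separated (toStar wu) (toStar wv) })
          P-split : P ≡ (lu ++ [ x ]) ++ (rv ++ [ v ])
          P-split = trans (++-assoc lu (x ∷ rv) [ v ]) (sym (++-assoc lu [ x ] (rv ++ [ v ])))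
          unP : Unique P
          unP = subst Unique (sym P-split) (unique-++⁺ unu (subst Unique (sym rv≡) (unique-reverse unv))
            λ i k → sides-disjoint wu wv i (reverse-walk-∈ {l = lv} rv≡ k))
          ends : ∀ {w} → w ∈ P → InV B w → w ≡ x ⊎ w ≡ y
          ends i V with ∈-++⁻ (lu ++ [ x ]) (subst (_ ∈_) P-split i)
          ... | inj₁ k = [ (λ z → ⊥-elim (offBx z V)) , inj₁ ]′ (∈-snoc⁻ lu k)
          ... | inj₂ k = [ (λ z → ⊥-elim (offBy z V)) , inj₂ ]′ (∈-snoc⁻ lv (reverse-walk-∈ {l = lv} rv≡ k))
          from : ∀ w → w ≡ x ⊎ w ≡ y → w ∈ P × InV B w
          from w (inj₁ refl) = subst (x ∈_) (sym P-split) (∈-++⁺ˡ (∈-last lu)) , Vx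
          from w (inj₂ refl) = subst (y ∈_) (sym P-split) (∈-++⁺ʳ (lu ++ [ x ]) (start∈ wrv)) , Vy
          pathEdge-∈ : ∀ {p q} → PathEdge P p q → p ∈ P × q ∈ P
          pathEdge-∈ (inj₁ c) = consec-∈ c
          pathEdge-∈ (inj₂ c) = Product.swap (consec-∈ c)
          edge : ∀ p q → PathEdge P p q → InE B p q → (p ≡ x × q ≡ y) ⊎ (p ≡ y × q ≡ x)
          edge p q e i with sub p q i | pathEdge-∈ e
          ... | h , Vp , Vq | p∈ , q∈ with ends p∈ Vp | ends q∈ Vq
          ...   | inj₁ c | inj₂ d = inj₁ (c , d)
          ...   | inj₂ c | inj₁ d = inj₂ (c , d)
          ...   | inj₁ refl | inj₁ refl = ⊥-elim (H-loopless _ h)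
          ...   | inj₂ refl | inj₂ refl = ⊥-elim (H-loopless _ h)
          unedge : ∀ p q → (p ≡ x × q ≡ y) ⊎ (p ≡ y × q ≡ x) → PathEdge P p q × InE B p q
          unedge p q (inj₁ (refl , refl)) = inj₁ (consec-split⁺ lu wrv) , inB
          unedge p q (inj₂ (refl , refl)) = inj₂ (consec-split⁺ lu wrv) , inE-sym B inB

  τ→H : ∀ {a b} → E τ a b → E H a b
  τ→H {a} {b} = T⊆H a b

  τ-cross : ∀ {a b} → E τ a b → Side x a → Side y b → a ≡ x × b ≡ y
  τ-cross {a} {b} e ca cb with mem? (single x y) a b
  ... | no ¬m = ⊥-elim (separated ca (─⁺ τ (single x y) e ¬m ◅ cb))
  ... | yes m with mem-single⁻ x y a b m
  ...   | inj₁ p = p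
  ...   | inj₂ (refl , _) = ⊥-elim (separated ca ε)

  source-side : ∀ {u v l w} → Side y u → Walk (E T₀) u v l → w ∈ l ++ [ v ] → Side y w
  source-side c p m with split p m
  ... | _ , _ , q , _ = same-side q c

  -- As (u , v) is not (x , y), the path has an inner vertex: x, or y in case u is x.
  tree-ear : ∀ {u v lu rv} → Candidate (u , v) → Walk (E T₀) u x lu → Walk (E T₀) y v rv →
    Unique (lu ++ [ x ]) → Unique (rv ++ [ v ]) → ∃ λ l → lu ++ x ∷ rv ≡ u ∷ l × Ear τ u v l
  tree-ear {u} {v} {lu} {rv} (_ , _ , _ , ne) wu wr unu unr = toEar walk un (proj₁ (proj₂ other)) (proj₂ (proj₂ other))
    where
    walk : Walk (E τ) u v (lu ++ x ∷ rv)
    walk = mapʷ T₀→τ wu ++ʷ (Txy ∷ mapʷ T₀→τ wr)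
    un : Unique ((lu ++ x ∷ rv) ++ [ v ])
    un = subst Unique (trans (++-assoc lu [ x ] (rv ++ [ v ])) (sym (++-assoc lu (x ∷ rv) [ v ])))
      (unique-++⁺ unu unr λ i j → separated (walk-side wu i) (source-side ε wr j))
    other : ∃ λ c → c ∈ lu ++ x ∷ rv × c ≢ u
    other with u ≟ x
    ... | no u≢x = x , ∈-++⁺ʳ lu (here refl) , ≢-sym u≢x
    ... | yes u≡x = y , ∈-++⁺ʳ lu (there ([ (λ i → i) , (λ e → ⊥-elim (ne (u≡x , sym e))) ]′ (∈-snoc⁻ rv (start∈ wr)))) ,
            λ y≡u → x≢y (sym (trans y≡u u≡x))

  -- The farthest crossing edge: who gains

  module Farthest (u v : Fin n) (cand : Candidate (u , v))
    (max : ∀ c → Candidate c → dx (proj₁ c) + dy (proj₂ c) ≤ dx u + dy v)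
    (lu rv ld : List (Fin n)) (wu : Walk (E T₀) u x lu) (wr : Walk (E T₀) y v rv)
    (earD : Ear τ u v ld) (D≡ : lu ++ x ∷ rv ≡ u ∷ ld) where

    private
      su : Side x u
      su = proj₁ cand
      sv : Side y v
      sv = proj₁ (proj₂ cand)
      uv∈H : E H u v
      uv∈H = proj₁ (proj₂ (proj₂ cand))
      D≡′ : u ∷ ld ++ [ v ] ≡ (lu ++ [ x ]) ++ (rv ++ [ v ])
      D≡′ = trans (cong (_++ [ v ]) (sym D≡)) (trans (++-assoc lu (x ∷ rv) [ v ]) (sym (++-assoc lu [ x ] (rv ++ [ v ]))))
      lu⊆ : ∀ {w} → w ∈ lu ++ [ x ] → w ∈ u ∷ ld ++ [ v ]
      lu⊆ i = subst (_ ∈_) (sym D≡′) (∈-++⁺ˡ i)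
      rv⊆ : ∀ {w} → w ∈ rv ++ [ v ] → w ∈ u ∷ ld ++ [ v ]
      rv⊆ i = subst (_ ∈_) (sym D≡′) (∈-++⁺ʳ (lu ++ [ x ]) i)
      earG : Ear G u v ld
      earG = mapEar (λ e → H→G (τ→H e)) earD
      T₀→G : ∀ {a b} → E T₀ a b → E G a b
      T₀→G e = H→G (T₀→H e)
      inner : ∀ {w} → w ∈ u ∷ ld ++ [ v ] → w ≢ u → w ≢ v → w ∈ ld
      inner i ≢u ≢v with ear-verts⁻ ld i
      ... | inj₁ e = ⊥-elim (≢u e)
      ... | inj₂ (inj₁ e) = ⊥-elim (≢v e)
      ... | inj₂ (inj₂ j) = j
      X≢Y : ∀ {a b} → Side x a → Side y b → a ≢ b
      X≢Y ca cb refl = separated ca cb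

    -- A crossing edge of an ear disjoint from the tree path of uv would be a candidate farther away than uv.
    no-far-ear : ∀ {l} → Ear H u v l → (∀ {w} → w ∈ l → w ∈ ld → ⊥) → ⊥
    no-far-ear {l} e disj with firstExit sideX? (ear-walk e) su (λ c → separated c sv)
    ... | u₂ , v₂ , l₁ , l₂ , w₁ , h , w₂ , eq , s₂ , ¬s₂ with geodesic T₀ s₂ | geodesic T₀ (toSideY ¬s₂)
    ...   | m , wm , _ , em | k , wk , _ , ek
      with firstHit (λ w → _∈?_ _≟_ w (lu ++ [ x ])) wm (∈-last lu) | firstHit (λ w → _∈?_ _≟_ w (rv ++ [ v ])) wk (start∈ wr)
    ...     | p , m₁ , m₂ , wm₁ , wm₂ , refl , p∈ , offm | q , k₁ , k₂ , wk₁ , wk₂ , refl , q∈ , offk = finish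
      where
      sv₂ : Side y v₂
      sv₂ = toSideY ¬s₂
      m-side : ∀ {w} → w ∈ m₁ → Side x w
      m-side i = walk-side wm (∈-++⁺ˡ (∈-++⁺ˡ i))
      k-side : ∀ {w} → w ∈ k₁ → Side y w
      k-side i = walk-side wk (∈-++⁺ˡ (∈-++⁺ˡ i))
      verts≡ : u ∷ l ++ [ v ] ≡ l₁ ++ u₂ ∷ l₂ ++ [ v ]
      verts≡ = trans (cong (_++ [ v ]) eq) (++-assoc l₁ (u₂ ∷ l₂) [ v ])
      eG : Ear G u v l
      eG = mapEar H→G e
      p≡u : p ≡ u
      p≡u with p ≟ u
      ... | yes z = z
      ... | no p≢u with ear-verts⁻ l (subst (u₂ ∈_) (sym verts≡) (∈-++⁺ʳ l₁ (here refl)))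
      ...   | inj₁ refl = ⊥-elim (p≢u (sym (hit-start wm₁ (λ i → offm i (start∈ wu)))))
      ...   | inj₂ (inj₁ refl) = ⊥-elim (separated s₂ sv)
      ...   | inj₂ (inj₂ u₂∈) = ⊥-elim (crossing-ears tl (H→G uv∈H) eG earG disj u₂∈
                (inner (lu⊆ p∈) p≢u (X≢Y (toStar wm₂) sv)) (within-walk (mapʷ T₀→G wm₁) off))
        where
        off : ∀ {w} → w ∈ m₁ ++ [ p ] → OffPair u v w
        off i with ∈-snoc⁻ m₁ i
        ... | inj₁ j = (λ { refl → offm j (start∈ wu) }) , X≢Y (m-side j) sv
        ... | inj₂ refl = p≢u , X≢Y (toStar wm₂) sv
      q≡v : q ≡ v
      q≡v with q ≟ v
      ... | yes z = z
      ... | no q≢v with ear-verts⁻ l (subst (v₂ ∈_) (sym verts≡) (∈-++⁺ʳ l₁ (there (start∈ w₂))))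
      ...   | inj₁ refl = ⊥-elim (separated su sv₂)
      ...   | inj₂ (inj₁ refl) = ⊥-elim (q≢v (sym (hit-start wk₁ (λ i → offk i (∈-last rv)))))
      ...   | inj₂ (inj₂ v₂∈) = ⊥-elim (crossing-ears tl (H→G uv∈H) eG earG disj v₂∈
                (inner (rv⊆ q∈) (≢-sym (X≢Y su (toStar wk₂))) q≢v) (within-walk (mapʷ T₀→G wk₁) off))
        where
        off : ∀ {w} → w ∈ k₁ ++ [ q ] → OffPair u v w
        off i with ∈-snoc⁻ k₁ i
        ... | inj₁ j = ≢-sym (X≢Y su (k-side j)) , (λ { refl → offk j (∈-last rv) })
        ... | inj₂ refl = ≢-sym (X≢Y su (toStar wk₂)) , q≢v
      same : u₂ ≡ u × v₂ ≡ v
      same with (u₂ ≟ x) ×-dec (v₂ ≟ y)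
      ... | yes (refl , refl) = trans (hit-start wm₁ (λ i → offm i (∈-last lu))) p≡u ,
                                trans (hit-start wk₁ (λ i → offk i (start∈ wr))) q≡v
      ... | no ne = trans (empty-walk wm₁ (ℕₚ.m+n≡0⇒m≡0 (length m₁) (ℕₚ.n≤0⇒n≡0 le))) p≡u ,
                    trans (empty-walk wk₁ (ℕₚ.m+n≡0⇒n≡0 (length m₁) (ℕₚ.n≤0⇒n≡0 le))) q≡v
        where
        open +-*-Solver
        le : length m₁ + length k₁ ≤ 0
        le = ℕₚ.+-cancelʳ-≤ (dx u + dy v) _ _ (begin
          (length m₁ + length k₁) + (dx u + dy v)   ≡⟨ solve 4 (λ p q r s → (p :+ q) :+ (r :+ s) := (p :+ r) :+ (q :+ s)) refl (length m₁) (length k₁) (dx u) (dy v) ⟩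
          (length m₁ + dx u) + (length k₁ + dy v)   ≤⟨ ℕₚ.+-mono-≤ (ℕₚ.+-monoʳ-≤ (length m₁) (dist-≤ T₀ (subst (λ z → Walk (E T₀) z x m₂) p≡u wm₂)))
                                                                   (ℕₚ.+-monoʳ-≤ (length k₁) (dist-≤ T₀ (subst (λ z → Walk (E T₀) z y k₂) q≡v wk₂))) ⟩
          (length m₁ + length m₂) + (length k₁ + length k₂) ≡⟨ cong₂ _+_ (trans (sym (length-++ m₁)) em) (trans (sym (length-++ k₁)) ek) ⟩
          dx u₂ + dy v₂                             ≤⟨ max (u₂ , v₂) (s₂ , sv₂ , h , ne) ⟩
          dx u + dy v ∎)
          where open ℕₚ.≤-Reasoning
      l₁≡[] : l₁ ≡ []
      l₁≡[] = empty-loop (subst (λ z → Walk (E H) u z l₁) (proj₁ same) w₁)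
        (λ i → proj₂ (proj₂ (unique-++⁻ l₁ (subst Unique verts≡ (Ear.simple e)))) i (here (sym (proj₁ same))))
      l₂≡[] : l₂ ≡ []
      l₂≡[] = empty-loop (subst (λ z → Walk (E H) z v l₂) (proj₂ same) w₂)
        (λ i → proj₂ (proj₂ (unique-++⁻ (u ∷ l) (Ear.simple e))) (subst (v ∈_) (sym eq) (∈-++⁺ʳ l₁ (there i))) (here refl))
      finish : ⊥
      finish = Ear.proper e (empty-walk (Ear.walk e) (cong length (∷-injectiveʳ (trans eq (cong₂ (λ c d → c ++ u₂ ∷ d) l₁≡[] l₂≡[])))))

    -- An internal uv would have two disjoint ears. If one of them misses the tree path of uv,
    -- `no-far-ear` applies; if both meet it, the tree path links them off u and v, against
    -- `crossing-ears`. The tree path also avoids uv, so uv is not a bridge.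
    farthest-bound : Bound A G u v
    farthest-bound = (uv∈H , external) , nonbridge
      where
      external : ¬ Internal H u v
      external int with internal⇒ears {G = G} {A} tl it int
      ... | l₁ , l₂ , e₁ , e₂ , disj with meets? l₁ ld | meets? l₂ ld
      ...   | inj₂ d | _ = no-far-ear e₁ d
      ...   | inj₁ _ | inj₂ d = no-far-ear e₂ d
      ...   | inj₁ (c , c∈ , c∈D) | inj₁ (d , d∈ , d∈D) = crossing-ears tl (H→G uv∈H) (mapEar H→G e₁) (mapEar H→G e₂) disj c∈ d∈
              (reverse⋆ (within-sym s) (ear-connected s earG c∈D) ◅◅ ear-connected s earG d∈D)
        where s = TwoTreeLike.symmetric tl
      nonbridge : ¬ Bridge H u v
      nonbridge (_ , ¬c) = ¬c (toStar (mapʷ f (ear-walk earD)))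
        where
        f : ∀ {a b} → E τ a b → E (H ─ single u v) a b
        f {a} {b} e = ─⁺ H (single u v) (τ→H e) λ m → proj₂ (proj₂ (proj₂ cand)) (case mem-single⁻ u v a b m of λ
          { (inj₁ (refl , refl)) → τ-cross e su sv
          ; (inj₂ (refl , refl)) → τ-cross (τ-sym a b e) su sv })

    module _ {B : Subgraph} (comp : TwoConnComp H B) (inB : InE B u v) where

      private
        Vu : InV B u
        Vu = proj₁ (proj₂ (proj₁ comp u v inB))
        Vv : InV B v
        Vv = proj₂ (proj₂ (proj₁ comp u v inB))
        D⊆B : ∀ {w} → w ∈ u ∷ ld ++ [ v ] → InV B w
        D⊆B i with ear-verts⁻ ld i
        ... | inj₁ refl = Vu
        ... | inj₂ (inj₁ refl) = Vv
        ... | inj₂ (inj₂ j) = ear⊆block H-sym {B} comp Vu Vv (mapEar τ→H earD) j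

        -- The tree path from s to r must enter the block somewhere, and z is the only entrance
        -- reachable from s, so the path runs through z.
        gate : ∀ {r s z l} → InV B r → Side r s → Walk (E H) s z l → (∀ {w} → w ∈ l → ¬ InV B w) → InV B z →
          ∃ λ k → Walk (E T₀) s z k × length k + dist T₀ z r ≤ dist T₀ s r
        gate {r} {s} {z} Vr cs wl off Vz with geodesic T₀ cs
        ... | m , wm , _ , em with firstHit (inV? H-sym {B} comp) wm Vr
        ...   | p , m₁ , m₂ , wm₁ , wm₂ , refl , Vp , offm with gate-unique H-sym {B} comp wl off Vz (mapʷ T₀→H wm₁) offm Vp
        ...     | refl = m₁ , wm₁ , ℕₚ.≤-trans (ℕₚ.+-monoʳ-≤ (length m₁) (dist-≤ T₀ wm₂)) (ℕₚ.≤-reflexive (trans (sym (length-++ m₁)) em))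

      -- The tree path of uv is an ear with both ends in the block, so x and y belong to the block.
      -- Were s on the side of y, its tree path to y would run through u, which is on the other
      -- side; likewise for t.
      gated : ∀ {s t l r} → Walk (E H) s u l → (∀ {w} → w ∈ l → ¬ InV B w) → Walk (E H) t v r → (∀ {w} → w ∈ r → ¬ InV B w) →
        (Side x s × ∃ λ k → Walk (E T₀) s u k × length k + dx u ≤ dx s) × (Side y t × ∃ λ k → Walk (E T₀) t v k × length k + dy v ≤ dy t)
      gated {s} {t} wl offl wr′ offr = left (side s) , right (side t)
        where
        Vx : InV B x
        Vx = D⊆B (lu⊆ (∈-last lu))
        Vy : InV B y
        Vy = D⊆B (rv⊆ (start∈ wr))
        left : Side x s ⊎ Side y s → Side x s × ∃ λ k → Walk (E T₀) s u k × length k + dx u ≤ dx s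
        left (inj₁ c) = c , gate Vx c wl offl Vu
        left (inj₂ c) = ⊥-elim (separated su (same-side (proj₁ (proj₂ (gate Vy c wl offl Vu))) c))
        right : Side x t ⊎ Side y t → Side y t × ∃ λ k → Walk (E T₀) t v k × length k + dy v ≤ dy t
        right (inj₂ c) = c , gate Vy c wr′ offr Vv
        right (inj₁ c) = ⊥-elim (separated (same-side (proj₁ (proj₂ (gate Vx c wr′ offr Vv))) c) sv)

    -- Cutting a supporting path at pq leaves two arms. They avoid `B`, because the path is simple
    -- and meets `B` in p and q only.
    arms : ∀ {B : Subgraph} {s t p q mid} → Walk (E H) s t (s ∷ mid) → Unique (s ∷ mid ++ [ t ]) → Consec (s ∷ mid ++ [ t ]) p q →
      (∀ {w} → w ∈ s ∷ mid ++ [ t ] → InV B w → w ≡ p ⊎ w ≡ q) →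
      ∃₂ λ l r → Walk (E H) s p l × (∀ {w} → w ∈ l → ¬ InV B w) × Walk (E H) t q r × (∀ {w} → w ∈ r → ¬ InV B w)
    arms {B} {s} {t} {p} {q} walk un c only with consec-split⁻ walk c
    ... | l₁ , l₂ , w₁ , _ , w₂ , eq with reverseʷ (λ {a} {b} → H-sym a b) w₂
    ...   | r , w₂′ , r≡ = l₁ , r , w₁ , offl , w₂′ , offr
      where
      verts≡ = trans (cong (_++ [ t ]) eq) (++-assoc l₁ (p ∷ l₂) [ t ])
      un′ = unique-++⁻ l₁ (subst Unique verts≡ un)
      p∉ : ¬ p ∈ l₂ ++ [ t ]
      p∉ i with proj₁ (proj₂ un′)
      ... | a ∷ _ = All.lookup a i refl
      un₂ : Unique (l₂ ++ [ t ])
      un₂ with proj₁ (proj₂ un′)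
      ... | _ ∷ b = b
      offl : ∀ {w} → w ∈ l₁ → ¬ InV B w
      offl i V with only (subst (_ ∈_) (sym verts≡) (∈-++⁺ˡ i)) V
      ... | inj₁ refl = proj₂ (proj₂ un′) i (here refl)
      ... | inj₂ refl = proj₂ (proj₂ un′) i (there (start∈ w₂))
      offr : ∀ {w} → w ∈ r → ¬ InV B w
      offr i V with reverse-walk-∈ {l = l₂} r≡ (∈-++⁺ˡ i)
      ... | j with only (subst (_ ∈_) (sym verts≡) (∈-++⁺ʳ l₁ (there j))) V
      ...   | inj₁ refl = p∉ j
      ...   | inj₂ refl = proj₂ (proj₂ (unique-++⁻ r (subst Unique (sym r≡) (unique-reverse un₂)))) i (here refl)

    module _ (a b : Fin n) (cab : Candidate (a , b)) where
      open Swap a b cab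

      through-extend : ∀ {s t} → Through u v → (∃ λ k → Walk (E T₀) s u k × length k + dx u ≤ dx s) →
        (∃ λ k → Walk (E T₀) t v k × length k + dy v ≤ dy t) → Through s t
      through-extend ((k , wk , le) , (k′ , wk′ , le′)) (m , wm , lm) (m′ , wm′ , lm′) =
        (m ++ k , wm ++ʷ wk , chain m k lm le) , (m′ ++ k′ , wm′ ++ʷ wk′ , chain m′ k′ lm′ le′)
        where
        chain : ∀ (m k : List (Fin n)) {d e f} → length m + e ≤ f → length k + d ≤ e → length (m ++ k) + d ≤ f
        chain m k {d} p q = ℕₚ.≤-trans (ℕₚ.≤-reflexive (trans (cong (_+ d) (length-++ m)) (ℕₚ.+-assoc (length m) (length k) d)))
          (ℕₚ.≤-trans (ℕₚ.+-monoʳ-≤ (length m) q) p)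

      -- The tree paths from s and t first reach u and v and continue as those of uv, through a and
      -- b. The two cases are the two directions in which the supporting path may cross uv.
      sup-gain : ∀ {s t} → Through u v → Sup A G u v s t → dist τ′ s t + m ≤ dist τ s t
      sup-gain {s} {t} th (_ , B , comp , inB , _ , ((mid , refl) , lk , un) , vs⇔ , es⇔)
        with proj₁ (Equivalence.from (es⇔ u v) (inj₁ (refl , refl)))
      ... | inj₁ c with arms {B} (fromLinked mid lk) un c (λ i V → Equivalence.to (vs⇔ _) (i , V))
      ...   | _ , _ , wl , offl , wr′ , offr with gated {B} comp inB wl offl wr′ offr
      ...     | (cs , gs) , (ct , gt) = through-gain cs ct (through-extend th gs gt)
      sup-gain {s} {t} th (_ , B , comp , inB , _ , ((mid , refl) , lk , un) , vs⇔ , es⇔)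
          | inj₂ c with arms {B} (fromLinked mid lk) un c (λ i V → swap (Equivalence.to (vs⇔ _) (i , V)))
      ...   | _ , _ , wl , offl , wr′ , offr with gated {B} comp inB wr′ offr wl offl
      ...     | (ct , gt) , (cs , gs) = through-gain′ ct cs (through-extend th gt gs)

  -- Counting losses against gains

  module Balance (a b : Fin n) (cand : Candidate (a , b)) where

    open Swap a b cand

    private
      stretch stretch′ : Fin n × Fin n → ℕ
      stretch p = if G (proj₁ p) (proj₂ p) then dist τ (proj₁ p) (proj₂ p) else 0
      stretch′ p = if G (proj₁ p) (proj₂ p) then dist τ′ (proj₁ p) (proj₂ p) else 0

    Gain Loss : Fin n × Fin n → Set
    Gain (i , j) = E G i j × dist τ′ i j + m ≤ dist τ i j
    Loss (i , j) = E G i j × dist τ i j < dist τ′ i j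

    gain? : Decidable Gain
    gain? (i , j) = (G i j Bool.≟ true) ×-dec (dist τ′ i j + m ℕ.≤? dist τ i j)

    loss? : Decidable Loss
    loss? (i , j) = (G i j Bool.≟ true) ×-dec (dist τ i j ℕ.<? dist τ′ i j)

    totalStretch-≤ : length (filter loss? pairs) ≤ length (filter gain? pairs) → totalStretch G T′ ≤ totalStretch G T
    totalStretch-≤ = sum-≤ gain? loss? stretch stretch′ m bad even good pairs
      where
      bad : ∀ p → stretch′ p ≤ stretch p + m
      bad (i , j) with G i j
      ... | true = worst i j
      ... | false = z≤n
      even : ∀ p → ¬ Loss p → stretch′ p ≤ stretch p
      even (i , j) ¬l with G i j
      ... | true = ℕₚ.≮⇒≥ (λ lt → ¬l (refl , lt))
      ... | false = z≤n
      good : ∀ p → Gain p → stretch′ p + m ≤ stretch p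
      good (i , j) (e , le) rewrite e = le

  MinimumCost : Set
  MinimumCost = ∀ p q → Bound A G p q → ∀ c₁ c₂ → Cost A G x y c₁ → Cost A G p q c₂ → c₁ ≤ c₂

  Improves : Fin n × Fin n → Set
  Improves (a , b) = Candidate (a , b) × totalStretch G (exchange a b) ≤ totalStretch G T

  module _ (minCost : MinimumCost) where

    -- The edges made longer are xy and some edges of Sup(xy); those made shorter include uv and Sup(uv).
    module Compare (a b : Fin n) (cab : Candidate (a , b))
      (min : ∀ c → Candidate c → dx a + dy b ≤ dx (proj₁ c) + dy (proj₂ c))
      (ra lb : List (Fin n)) (wra : Walk (E T₀) x a ra) (wb : Walk (E T₀) b y lb)
      (una : Unique (ra ++ [ a ])) (unb : Unique (lb ++ [ y ])) (|ra| : length ra ≡ dx a) (|lb| : length lb ≡ dy b)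
      (u v : Fin n) (cuv : Candidate (u , v))
      (max : ∀ c → Candidate c → dx (proj₁ c) + dy (proj₂ c) ≤ dx u + dy v)
      (lu rv ld : List (Fin n)) (wu : Walk (E T₀) u x lu) (wrv : Walk (E T₀) y v rv)
      (earD : Ear τ u v ld) (D≡ : lu ++ x ∷ rv ≡ u ∷ ld) where

      private
        su : Side x u
        su = proj₁ cuv
        sv : Side y v
        sv = proj₁ (proj₂ cuv)
        uv∈H : E H u v
        uv∈H = proj₁ (proj₂ (proj₂ cuv))
        uv≢xy : ¬ (u ≡ x × v ≡ y)
        uv≢xy = proj₂ (proj₂ (proj₂ cuv))

      open Swap a b cab
      open Balance a b cab
      module N = Nearest a b cab min ra lb wra wb una unb |ra| |lb|
      module F = Farthest u v cuv max lu rv ld wu wrv earD D≡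

      sym-G : SymG G
      sym-G = TwoTreeLike.symmetric tl

      through : Through u v
      through = [ (λ t → t) , (λ j → ⊥-elim (N.atE-not-H j uv∈H uv≢xy)) ]′ (N.junction su sv (H→G uv∈H))

      Affected : Fin n → Fin n → Set
      Affected i j = SamePair x y i j ⊎ Sup A G x y i j

      affected : ∀ {B} → TwoConnComp H B → InE B x y → ∀ {i j} → Side x i → Side y j → E G i j → Through i j ⊎ Affected i j
      affected {B} comp inB {i} {j} ci cj e with N.junction ci cj e | (i ≟ x) ×-dec (j ≟ y)
      ... | inj₁ t | _ = inj₁ t
      ... | inj₂ k | yes p = inj₂ (inj₁ (inj₁ p))
      ... | inj₂ k | no ne with mem? A i j
      ...   | yes m = inj₂ (inj₂ (N.atE-sup k e {B} comp inB m))
      ...   | no ¬m = ⊥-elim (N.atE-not-H k (─⁺ G A e ¬m) ne)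

      loss-affected : ∀ {B} → TwoConnComp H B → InE B x y → ∀ {i j} → Loss (i , j) → Affected i j
      loss-affected {B} comp inB {i} {j} (e , lt) with side i | side j
      ... | inj₁ ci | inj₁ cj = ⊥-elim (ℕₚ.<⇒≱ lt (noncross-upper (inj₁ refl) ci cj))
      ... | inj₂ ci | inj₂ cj = ⊥-elim (ℕₚ.<⇒≱ lt (noncross-upper (inj₂ refl) ci cj))
      ... | inj₁ ci | inj₂ cj with affected {B} comp inB ci cj e
      ...   | inj₁ t = ⊥-elim (ℕₚ.<⇒≱ lt (ℕₚ.≤-trans (ℕₚ.m≤m+n _ m) (through-gain ci cj t)))
      ...   | inj₂ k = k
      loss-affected {B} comp inB {i} {j} (e , lt) | inj₂ ci | inj₁ cj with affected {B} comp inB cj ci (sym-G _ _ e)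
      ...   | inj₁ t = ⊥-elim (ℕₚ.<⇒≱ lt (ℕₚ.≤-trans (ℕₚ.m≤m+n _ m) (through-gain′ cj ci t)))
      ...   | inj₂ (inj₁ p) = inj₁ (swap-pair p)
        where
        swap-pair : ∀ {i j} → SamePair x y j i → SamePair x y i j
        swap-pair (inj₁ (p , q)) = inj₂ (q , p)
        swap-pair (inj₂ (p , q)) = inj₁ (q , p)
      ...   | inj₂ (inj₂ k) = inj₂ (sup-sym {A = A} {G} sym-G k)

      -- The `suc` accounts for the removed tree edge xy.
      losses : ∀ {B c} → TwoConnComp H B → InE B x y → Cost A G x y c → length (filter loss? pairs) ≤ suc c
      losses {B} comp inB (L , refl , _ , ordered , iff) =
        unique-⊆-length {ys = order x y ∷ L} (Uniqueₚ.filter⁺ loss? pairs-unique) inside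
        where
        inside : ∀ {p} → p ∈ filter loss? pairs → p ∈ order x y ∷ L
        inside {i , j} k with ∈-filter⁻ loss? {xs = pairs} k
        ... | ij∈ , l with loss-affected {B} comp inB l
        ...   | inj₁ p = here (order-unique (∈-pairs⁻ ij∈) p)
        ...   | inj₂ s with Equivalence.to (iff i j) s
        ...     | inj₁ r = there r
        ...     | inj₂ r = ⊥-elim (ℕₚ.<-asym (∈-pairs⁻ ij∈) (ordered j i r))

      -- The `suc` accounts for uv, which is an edge of `G ─ A` and so cannot already be listed in
      -- its own support.
      gains : ∀ {c} → Cost A G u v c → suc c ≤ length (filter gain? pairs)
      gains (L , refl , un , ord , iff) = unique-⊆-length {xs = order u v ∷ L}
        (All.tabulate (λ {p} k e → uv∉ (subst (_∈ L) (sym e) k)) ∷ un) inside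
        where
        mem-L : ∀ {i j} → (i , j) ∈ L → Sup A G u v i j
        mem-L k = Equivalence.from (iff _ _) (inj₁ k)
        uv∉A : ¬ Mem A u v
        uv∉A = proj₂ (─⁻ G A uv∈H)
        uv∉ : ¬ order u v ∈ L
        uv∉ k with order-cases u v
        ... | inj₁ e = uv∉A (proj₁ (mem-L (subst (_∈ L) e k)))
        ... | inj₂ e = uv∉A (mem-sym A (proj₁ (mem-L (subst (_∈ L) e k))))
        gain-uv : Gain (order u v)
        gain-uv with order-cases u v
        ... | inj₁ e = subst Gain (sym e) (H→G uv∈H , through-gain su sv through)
        ... | inj₂ e = subst Gain (sym e) (sym-G _ _ (H→G uv∈H) , through-gain′ su sv through)
        u≢v : u ≢ v
        u≢v refl = separated su sv
        inside : ∀ {p} → p ∈ order u v ∷ L → p ∈ filter gain? pairs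
        inside (here refl) = ∈-filter⁺ gain? (order-∈pairs u≢v) gain-uv
        inside {i , j} (there k) = ∈-filter⁺ gain? (∈-pairs⁺ (ord i j k))
          (iterative-⊆ {A = A} sym-G it (proj₁ (mem-L k)) , F.sup-gain a b cab through (mem-L k))

      result : ¬ ¬ (totalStretch G T′ ≤ totalStretch G T)
      result c = block-exists H-sym xy∈H (proj₂ N.earE) λ (B , comp , inB) →
        ¬¬-hasSize (Sup A G x y) (sup-sym {A = A} {G} sym-G) (sup-irrefl {A = A} {G}) λ (c₁ , cost₁) →
        ¬¬-hasSize (Sup A G u v) (sup-sym {A = A} {G} sym-G) (sup-irrefl {A = A} {G}) λ (c₂ , cost₂) →
        c (totalStretch-≤ (ℕₚ.≤-trans (losses {B} comp inB cost₁)
          (ℕₚ.≤-trans (s≤s (minCost u v F.farthest-bound c₁ c₂ cost₁ cost₂)) (gains cost₂))))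

    module _ (a b : Fin n) (cab : Candidate (a , b)) (min : ∀ c → Candidate c → dx a + dy b ≤ dx (proj₁ c) + dy (proj₂ c))
      (u v : Fin n) (cuv : Candidate (u , v)) (max : ∀ c → Candidate c → dx (proj₁ c) + dy (proj₂ c) ≤ dx u + dy v) where

      private
        Geodesic : Fin n → Fin n → Set
        Geodesic w r = ∃ λ l → Walk (E T₀) w r l × Unique (l ++ [ r ]) × length l ≡ dist T₀ w r

        reverse-geodesic : ∀ {w r} → Geodesic w r → ∃ λ l → Walk (E T₀) r w l × Unique (l ++ [ w ]) × length l ≡ dist T₀ w r
        reverse-geodesic (l , p , un , eq) with reverse₀ p
        ... | l′ , p′ , l′≡ = l′ , p′ , subst Unique (sym l′≡) (unique-reverse un) , trans (reverse-walk-length {l = l} l′≡) eq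

        go : (∃ λ l → Walk (E T₀) x a l × Unique (l ++ [ a ]) × length l ≡ dx a) → Geodesic b y →
          (lu rv : List (Fin n)) (wu : Walk (E T₀) u x lu) (wr : Walk (E T₀) y v rv) → (∃ λ l → lu ++ x ∷ rv ≡ u ∷ l × Ear τ u v l) →
          ¬ ¬ (totalStretch G (exchange a b) ≤ totalStretch G T)
        go (ra , wra , una , |ra|) (lb , wb , unb , |lb|) lu rv wu wr (ld , D≡ , earD) =
          Compare.result a b cab min ra lb wra wb una unb |ra| |lb| u v cuv max lu rv ld wu wr earD D≡

        go′ : Geodesic u x → (∃ λ l → Walk (E T₀) y v l × Unique (l ++ [ v ]) × length l ≡ dy v) →
          ¬ ¬ (totalStretch G (exchange a b) ≤ totalStretch G T)
        go′ (lu , wu , unu , _) (rv , wr , unr , _) =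
          go (reverse-geodesic (geodesic T₀ (proj₁ cab))) (geodesic T₀ (proj₁ (proj₂ cab))) lu rv wu wr (tree-ear cuv wu wr unu unr)

      compare : ¬ ¬ (totalStretch G (exchange a b) ≤ totalStretch G T)
      compare = go′ (geodesic T₀ (proj₁ cuv)) (reverse-geodesic (geodesic T₀ (proj₁ (proj₂ cuv))))

    ¬¬-improves : ¬ ¬ ∃ Improves
    ¬¬-improves c = ¬¬-candidate λ ex →
      ¬¬-minimum Candidate (λ p → dx (proj₁ p) + dy (proj₂ p)) ex λ ((a , b) , cab , min) →
      ¬¬-maximum Candidate (λ p → dx (proj₁ p) + dy (proj₂ p)) (n + n)
        (λ p → ℕₚ.+-mono-≤ (dist≤n T₀ (proj₁ p) x) (dist≤n T₀ (proj₂ p) y)) ex λ ((u , v) , cuv , max) →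
      compare a b cab min u v cuv max λ le → c ((a , b) , cab , le)

    improves? : ∀ a b → Dec (Improves (a , b))
    improves? a b = (sideX? a ×-dec (sideY? b ×-dec ((H a b Bool.≟ true) ×-dec ¬? ((a ≟ x) ×-dec (b ≟ y)))))
      ×-dec (totalStretch G (exchange a b) ℕ.≤? totalStretch G T)
      where
      sideY? : ∀ w → Dec (Side y w)
      sideY? w with side w
      ... | inj₁ c = no (separated c)
      ... | inj₂ c = yes c

    BetterTree : Set
    BetterTree = ∃ λ T′ → SpanningTree G T′ × totalStretch G T′ ≤ totalStretch G T × (∀ u v → Mem T′ u v → E (G ─ (A ∪ single x y)) u v)

    better-tree : BetterTree
    better-tree = conclude (decidable-stable (any? (λ a → any? (improves? a))) (λ k → ¬¬-improves λ ((a , b) , i) → k (a , b , i)))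
      where
      conclude : (∃ λ a → ∃ λ b → Improves (a , b)) → BetterTree
      conclude (a , b , cand , le) = exchange a b , Swap.spanning′ a b cand , le , Swap.T′⊆ a b cand

theorem3 : ∀ {n} (G : Graph n) → Polygonal2Tree G →
    (A : ESet n) → Safe G A →
    (x y : Fin n) → Bound A G x y →
    (∀ p q → Bound A G p q → ∀ c₁ c₂ →
    Cost A G x y c₁ → Cost A G p q c₂ → c₁ ≤ c₂) →
    Safe G (A ∪ single x y)
theorem3 {n} G poly A (it , T , (sp , opt) , T⊆H) x y bd minCost = iterative-snoc {A = A} it bd , tree (mem? T x y)
  where
  SafeTree : Set
  SafeTree = ∃ λ T′ → MinAvgStretchTree G T′ × (∀ a b → Mem T′ a b → E (G ─ (A ∪ single x y)) a b)
  endpoints : ∀ a b → Mem T a b → SamePair x y a b → Mem T x y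
  endpoints a b m (inj₁ (refl , refl)) = m
  endpoints a b m (inj₂ (refl , refl)) = mem-sym T m
  improve : (∃ λ T′ → SpanningTree G T′ × totalStretch G T′ ≤ totalStretch G T × (∀ u v → Mem T′ u v → E (G ─ (A ∪ single x y)) u v)) → SafeTree
  improve (T′ , sp′ , le , ⊆) = T′ , (sp′ , λ T″ sp″ → ℚₚ.≤-trans (ratio-mono {n} (numEdges G) le) (opt T″ sp″)) , ⊆
  tree : Dec (Mem T x y) → SafeTree
  tree (no ∉T) = T , (sp , opt) , λ a b m → let e , ∉A = ─⁻ G A (T⊆H a b m) in
    ─⁺ G (A ∪ single x y) e λ k → [ ∉A , (λ s → ∉T (endpoints a b m (mem-single⁻ x y a b s))) ]′ (mem-∪⁻ A (single x y) k)
  tree (yes ∈T) = improve (Exchange.better-tree G (polygonal-twoTreeLike poly) A it T sp T⊆H x y bd ∈T minCost)
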